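{- Let $k$ be a natural number and $\varepsilon>0$. There exists $C_*=C_*(k,\varepsilon)$ such that for every $C_0\geq C_*$ the following holds. Let $G$ be a finite abelian group such that $|G|$ is not divisible by any prime less than $C_0$, and let $A\subseteq G$ satisfy $\phi(A)<k$ and $|A|\geq C_0$. Then there exist an integer $0\leq m<k$ and finite subgroups $H_1,\ldots,H_m$ of $G$ such that $|A\cap H_i|>(1-\varepsilon)|H_i|$ for every $i=1,\ldots,m$, and $$|A\setminus(H_1\cup\cdots\cup H_m)|\leq C_0.$$ Moreover, if $m=k-1$, the subgroups can be chosen so that $A\setminus(H_1\cup\cdots\cup H_m)=\emptyset$.
   Context: For subsets $B, A$ of an abelian group $G$, write $B \overset{\ast}{+} B := \{b_1+b_2 : b_1,b_2\in B,\ b_1\neq b_2\}$. A subset $B\subseteq A$ is called sum-avoiding in $A$ if $(B \overset{\ast}{+} B)\cap A=\emptyset$. For a finite set $A$, $\phi(A)$ denotes the largest cardinality of a subset $B\subseteq A$ that is sum-avoiding in $A$. -}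

module Defs where

open import Data.Nat using (ℕ; suc)
open import Data.Fin using (Fin)
open import Data.Fin.Subset using (Subset; _∈_; _∉_; _⊆_; _─_; ⋃; ∣_∣)
open import Data.List using (tabulate)
open import Relation.Binary.PropositionalEquality using (_≡_; _≢_)
open import Algebra.Structures using (IsAbelianGroup)

-- A finite abelian group of order n, presented (up to isomorphism) on the
-- carrier Fin n with propositional equality.
record FinAbGroup (n : ℕ) : Set where
  field
    _∙_ : Fin n → Fin n → Fin n
    e : Fin n
    _⁻¹ : Fin n → Fin n
    isAbelianGroup : IsAbelianGroup _≡_ _∙_ e _⁻¹

module _ {n : ℕ} (G : FinAbGroup n) where
  open FinAbGroup G

  IsSubgroup : Subset n → Set
  IsSubgroup H = (e ∈ H)
               × (∀ {x y} → x ∈ H → y ∈ H → (x ∙ y) ∈ H)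
               × (∀ {x} → x ∈ H → (x ⁻¹) ∈ H)
    where open import Data.Product using (_×_)

  SumAvoidingIn : Subset n → Subset n → Set
  SumAvoidingIn B A = ∀ {b₁ b₂} → b₁ ∈ B → b₂ ∈ B → b₁ ≢ b₂ → (b₁ ∙ b₂) ∉ A

  -- φ(A) < k, i.e. every subset B ⊆ A sum-avoiding in A has |B| < k
  -- (φ(A) is the maximum of such |B|, attained since ∅ qualifies).
  PhiLessThan : Subset n → ℕ → Set
  PhiLessThan A k = ∀ B → B ⊆ A → SumAvoidingIn B A → suc ∣ B ∣ Data.Nat.≤ k
    where import Data.Nat

remainder : {n m : ℕ} → Subset n → (Fin m → Subset n) → Subset n
remainder A H = A ─ ⋃ (tabulate H)

{-# OPTIONS --safe #-}
module Submission where

-- A set with φ(A) < k contains a dense near-clique X, almost all of whose pairwise sums lie in A: otherwise one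
-- passes to non-neighbours at most k times. A union U = X + B of translates that lies almost inside A, after
-- translation by any of a dense set of elements, can be enlarged until it is nearly invariant under a dense set of
-- differences. If doubles of U often left A, Hilbert's cube lemma would yield k elements with all pairwise sums
-- outside A; so the dilates 2^j U lie almost inside A as well, and for some m the union Y of those with j ≤ m hardly
-- changes when m grows. Then 2Y ≈ Y, and the seminorm N(x) = |(Y + x) \ Y| is almost invariant under doubling. By
-- recurrence on a finite net, some q = 2^d - 1 maps the ball {N ≤ 18δ} into {N ≤ 9δ}. Multiplication by q is
-- injective since |G| has no small prime divisor, so the two balls are equal, hence a subgroup, and it lies almost
-- inside A. Applied inside a subgroup this gives a 0–1 law: a subgroup in which A is not sparse lies almost inside A.
-- Two such subgroups with many sums in A are merged into H + K, and any others contribute independent elements to a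
-- sum-avoiding set, so there are fewer than k of them. Ramsey's theorem bounds φ on the remainder, which therefore
-- stays bounded, or else would contribute a further subgroup.

open import Defs

-- The choice of m is circular. How nearly doubling-invariant Y must be depends on the density of
-- its set D of near-periods, which governs the size of the nets in the recurrence. Better
-- invariance needs a larger m. But 2^m d is a near-period of the union of the 2^j U, j ≤ m, only if
-- d is one of U to precision about 2^-m, and forcing such precision makes D thinner. So U and m are
-- refined in stages, each with parameters fixed by the stage before. The unions increase and have
-- at most 2|A| elements, so two consecutive stages hardly differ. The near-periods of the earlier
-- one then serve for all unions in between, and one of these is doubling-invariant to the precision
-- that this D demands. Doubling-invariance is used twice: to make a ball of near-periods a group H,
-- and to locate it. Near-periodicity alone puts only some coset y + H almost inside Y. Then the 2^j
-- y + H are almost inside Y too, two of them must coincide, and division by 2^i - 2^j puts y in H.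
-- Densities are kept as inequalities between natural numbers, such as a ≤ c |D| with a = |A|.

module Proof where
  open import Algebra.Bundles using (AbelianGroup)
  open import Data.Bool using (Bool; true; false; T; _∧_; _∨_; not)
  open import Data.Bool.Properties using (T?; T-∧; T-∨)
  open import Data.Empty using (⊥; ⊥-elim)
  open import Data.Fin using (Fin; zero; suc; toℕ; funToFin; finToFun)
  open import Data.Fin.Properties using (any?; pigeonhole; finToFun-funToFin; toℕ≤pred[n]) renaming (_≟_ to _≟ᶠ_; suc-injective to Fin-suc-injective)
  import Data.Fin.Permutation as Perm
  open import Data.Fin.Subset using (Subset; ∣_∣; _∈_; _─_; ⋃; Empty) renaming (_∩_ to _∩ˢ_)
  import Data.Integer as ℤ
  import Data.Integer.Properties as ℤP
  open import Data.List using (List; []; _∷_; _++_; length; lookup; map; downFrom; filter; take; tabulate)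
  open import Data.List.Membership.Propositional using () renaming (_∈_ to _∈ᴸ_)
  open import Data.List.Membership.Propositional.Properties using (∈-lookup)
  open import Data.List.Properties using (length-downFrom; length-map; length-++; length-take)
  open import Data.List.Relation.Unary.All as All using (All; []; _∷_)
  import Data.List.Relation.Unary.All.Properties as AllP
  open import Data.List.Relation.Unary.AllPairs as AllPairs using (AllPairs; []; _∷_)
  import Data.List.Relation.Unary.AllPairs.Properties as AllPairsP
  open import Data.List.Relation.Unary.Any as Any using (Any; here; there; index)
  import Data.List.Relation.Unary.Any.Properties as AnyP
  open import Data.Nat using (ℕ; zero; suc; _+_; _*_; _∸_; _^_; _≤_; _<_; _>_; z≤n; s≤s; _≤?_; _<?_; NonZero; >-nonZero)
  open import Data.Nat.Coprimality using (Coprime; coprime-Bézout)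
  open import Data.Nat.Divisibility using (_∣_; ∣-trans; ∣⇒≤; 0∣⇒≡0; m∣m*n)
  open import Data.Nat.DivMod using (_/_; m*n/n≡m; /-monoˡ-≤; m/n*n≤m)
  open import Data.Nat.GCD using (module Bézout)
  open import Data.Nat.ListAction using (product)
  open import Data.Nat.Primality using (Prime)
  open import Data.Nat.Primality.Factorisation using (PrimeFactorisation; factorise)
  open import Data.Nat.Properties
  open import Data.Nat.Tactic.RingSolver using (solve-∀)
  open import Data.Product using (Σ; ∃; ∃₂; _×_; _,_; proj₁; proj₂)
  open import Data.Rational using (ℚ; mkℚ; 0ℚ; 1ℚ; _-_; toℚᵘ; *<*) renaming (_/_ to _/ℚ_; _<_ to _<ℚ_; _*_ to _*ℚ_)
  import Data.Rational as ℚ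
  import Data.Rational.Properties as ℚP
  open import Data.Rational.Unnormalised using (mkℚᵘ; _≃_) renaming (*<* to *<*ᵘ)
  import Data.Rational.Unnormalised as ℚᵘ
  import Data.Rational.Unnormalised.Properties as ℚᵘP
  open import Data.Sum using (_⊎_; inj₁; inj₂; [_,_]′)
  open import Data.Unit using (tt)
  open import Data.Vec using (Vec; []; _∷_)
  import Data.Vec as V
  open import Data.Vec.Properties using (lookup-zipWith; lookup-replicate; lookup∘tabulate; []=⇒lookup; lookup⇒[]=)
  open import Function using (_∘_; _|>_; id; case_of_; Equivalence)
  open import Level using (0ℓ)
  open import Relation.Binary.Definitions using (tri<; tri≈; tri>)
  open import Relation.Binary.PropositionalEquality using (_≡_; _≢_; refl; sym; trans; cong; cong₂; subst; subst₂; module ≡-Reasoning)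
  open import Relation.Nullary using (¬_; Dec; yes; no; ¬?; _×-dec_)
  open import Relation.Nullary.Decidable using (⌊_⌋; toWitness; fromWitness; decidable-stable)
  open import Algebra.Properties.CommutativeMonoid.Sum +-0-commutativeMonoid using (sum; ∑-distrib-+; ∑-comm; sum-permute; sum-cong-≗)
  open import Algebra.Properties.Semiring.Sum +-*-semiring using (*-distribˡ-sum)
  import Algebra.Properties.CommutativeMonoid.Mult
  import Algebra.Properties.CommutativeMonoid.Sum
  import Algebra.Properties.Group

  -- Linear arithmetic: the hypotheses, combined with _⊹_ and _⊛_, form l ≤ r, and the last argument is left to the ring solver.
  lin : ∀ {l r} L R s → l ≤ r → L + r + s ≡ R + l → L ≤ R
  lin {l} {r} L R s h eq = +-cancelʳ-≤ r L R (≤-trans (m≤m+n (L + r) s) (≤-trans (≤-reflexive eq) (+-monoʳ-≤ R h)))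

  infixl 6 _⊹_
  infixr 7 _⊛_
  _⊹_ : ∀ {a b c d} → a ≤ b → c ≤ d → a + c ≤ b + d
  _⊹_ = +-mono-≤

  _⊛_ : ∀ c {a b} → a ≤ b → c * a ≤ c * b
  c ⊛ h = *-monoʳ-≤ c h

  -- Counting in decidable subsets of a finite type

  PSet : ℕ → Set
  PSet n = Fin n → Bool

  transport : ∀ {n} (S : PSet n) {x y} → x ≡ y → T (S x) → T (S y)
  transport S = subst (λ x → T (S x))

  ⟦_⟧ : Bool → ℕ
  ⟦ true ⟧ = 1
  ⟦ false ⟧ = 0

  opaque
    ∑ : ∀ {n} → (Fin n → ℕ) → ℕ
    ∑ f = sum f

    card : ∀ {n} → PSet n → ℕ
    card S = ∑ (λ i → ⟦ S i ⟧)

    sumOver : ∀ {n} → PSet n → (Fin n → ℕ) → ℕ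
    sumOver S f = ∑ (λ i → ⟦ S i ⟧ * f i)

  ∧-intro : ∀ {a b} → T a → T b → T (a ∧ b)
  ∧-intro p q = Equivalence.from T-∧ (p , q)

  ∧-fst : ∀ {a b} → T (a ∧ b) → T a
  ∧-fst p = proj₁ (Equivalence.to T-∧ p)

  ∧-snd : ∀ {a b} → T (a ∧ b) → T b
  ∧-snd {a} p = proj₂ (Equivalence.to (T-∧ {a}) p)

  ∨-introˡ : ∀ {a b} → T a → T (a ∨ b)
  ∨-introˡ {a} p = Equivalence.from (T-∨ {a}) (inj₁ p)

  ∨-introʳ : ∀ {a b} → T b → T (a ∨ b)
  ∨-introʳ {a} p = Equivalence.from (T-∨ {a}) (inj₂ p)

  ∨-elim : ∀ {a b} → T (a ∨ b) → T a ⊎ T b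
  ∨-elim = Equivalence.to T-∨

  not-intro : ∀ {a} → ¬ T a → T (not a)
  not-intro {false} _ = tt
  not-intro {true} p = p tt

  not-elim : ∀ {a} → T (not a) → ¬ T a
  not-elim {false} _ ()

  infixr 7 _∩_
  infixr 6 _∪_
  infix 6 _∖_
  _∩_ _∪_ _∖_ : ∀ {n} → PSet n → PSet n → PSet n
  (S ∩ R) x = S x ∧ R x
  (S ∪ R) x = S x ∨ R x
  (S ∖ R) x = S x ∧ not (R x)

  ⟦⟧-mono : ∀ {a b} → (T a → T b) → ⟦ a ⟧ ≤ ⟦ b ⟧
  ⟦⟧-mono {false} h = z≤n
  ⟦⟧-mono {true} {true} h = ≤-refl
  ⟦⟧-mono {true} {false} h = ⊥-elim (h tt)

  ⟦∧⟧ : ∀ a b → ⟦ a ∧ b ⟧ ≡ ⟦ a ⟧ * ⟦ b ⟧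
  ⟦∧⟧ false b = refl
  ⟦∧⟧ true b = sym (+-identityʳ _)

  opaque
    unfolding ∑ card sumOver

    ∑-mono : ∀ {n} {f g : Fin n → ℕ} → (∀ i → f i ≤ g i) → ∑ f ≤ ∑ g
    ∑-mono {zero} h = z≤n
    ∑-mono {suc n} h = +-mono-≤ (h zero) (∑-mono (h ∘ suc))

    ∑-ext : ∀ {n} {f g : Fin n → ℕ} → (∀ i → f i ≡ g i) → ∑ f ≡ ∑ g
    ∑-ext = sum-cong-≗

    card-mono : ∀ {n} {S R : PSet n} → (∀ x → T (S x) → T (R x)) → card S ≤ card R
    card-mono h = ∑-mono (λ i → ⟦⟧-mono (h i))

    card-cover : ∀ {n} {S R Q : PSet n} → (∀ x → T (S x) → T (R x) ⊎ T (Q x)) → card S ≤ card R + card Q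
    card-cover {n} {S} {R} {Q} h = ≤-trans (∑-mono pt) (≤-reflexive (∑-distrib-+ (λ i → ⟦ R i ⟧) (λ i → ⟦ Q i ⟧)))
      where
      pt : ∀ i → ⟦ S i ⟧ ≤ ⟦ R i ⟧ + ⟦ Q i ⟧
      pt i with T? (S i)
      ... | yes p = [ (λ r → ≤-trans (⟦⟧-mono (λ _ → r)) (m≤m+n _ _)) , (λ q → ≤-trans (⟦⟧-mono (λ _ → q)) (m≤n+m _ _)) ]′ (h i p)
      ... | no ¬p = ≤-trans (⟦⟧-mono {b = false} ¬p) z≤n

    card-disjoint : ∀ {n} {S R Q : PSet n} → (∀ x → T (R x) → T (Q x) → ⊥) → (∀ x → T (R x) → T (S x)) → (∀ x → T (Q x) → T (S x)) →
                    card R + card Q ≤ card S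
    card-disjoint {n} {S} {R} {Q} d r q = ≤-trans (≤-reflexive (sym (∑-distrib-+ (λ i → ⟦ R i ⟧) (λ i → ⟦ Q i ⟧)))) (∑-mono pt)
      where
      pt : ∀ i → ⟦ R i ⟧ + ⟦ Q i ⟧ ≤ ⟦ S i ⟧
      pt i with T? (R i)
      ... | yes p = ≤-trans (+-mono-≤ (⟦⟧-mono {b = true} _) (⟦⟧-mono {b = false} (d i p))) (⟦⟧-mono {a = true} (λ _ → r i p))
      ... | no ¬p = +-mono-≤ (⟦⟧-mono {b = false} ¬p) (⟦⟧-mono (q i))

    card-bij : ∀ {n} {S R : PSet n} (φ ψ : Fin n → Fin n) → (∀ x → φ (ψ x) ≡ x) → (∀ x → ψ (φ x) ≡ x) →
               (∀ x → T (S x) → T (R (φ x))) → card S ≤ card R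
    card-bij {n} {S} {R} φ ψ p q h = ≤-trans (card-mono {R = R ∘ φ} h) (≤-reflexive (sym (sum-permute (λ i → ⟦ R i ⟧) π)))
      where
      π : Perm.Permutation n n
      π = Perm.permutation φ ψ p q

    sumOver-mono : ∀ {n} {S : PSet n} {f g} → (∀ i → T (S i) → f i ≤ g i) → sumOver S f ≤ sumOver S g
    sumOver-mono {n} {S} {f} {g} h = ∑-mono pt
      where
      pt : ∀ i → ⟦ S i ⟧ * f i ≤ ⟦ S i ⟧ * g i
      pt i with S i | h i
      ... | true | h′ = +-monoˡ-≤ 0 (h′ tt)
      ... | false | _ = z≤n

    sumOver-* : ∀ {n} (S : PSet n) c f → sumOver S (λ i → c * f i) ≡ c * sumOver S f
    sumOver-* S c f = trans (∑-ext (λ i → trans (sym (*-assoc ⟦ S i ⟧ c (f i))) (trans (cong (_* f i) (*-comm ⟦ S i ⟧ c)) (*-assoc c ⟦ S i ⟧ (f i)))))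
                            (sym (*-distribˡ-sum c (λ i → ⟦ S i ⟧ * f i)))

    sumOver-const : ∀ {n} (S : PSet n) c → sumOver S (λ _ → c) ≡ c * card S
    sumOver-const S c = trans (∑-ext (λ i → *-comm ⟦ S i ⟧ c)) (sym (*-distribˡ-sum c (λ i → ⟦ S i ⟧)))

    sumOver-≤ : ∀ {n} {S : PSet n} {f c} → (∀ i → T (S i) → f i ≤ c) → sumOver S f ≤ c * card S
    sumOver-≤ {S = S} {c = c} h = ≤-trans (sumOver-mono {S = S} h) (≤-reflexive (sumOver-const S c))

    sumOver-≥ : ∀ {n} {S : PSet n} {f c} → (∀ i → T (S i) → c ≤ f i) → c * card S ≤ sumOver S f
    sumOver-≥ {S = S} {c = c} h = ≤-trans (≤-reflexive (sym (sumOver-const S c))) (sumOver-mono {S = S} h)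

    sumOver-card : ∀ {n} (S : PSet n) (R : Fin n → PSet n) → sumOver S (λ x → card (R x)) ≡ ∑ (λ y → card (λ x → S x ∧ R x y))
    sumOver-card {n} S R = trans (∑-ext (λ x → trans (*-distribˡ-sum ⟦ S x ⟧ (λ y → ⟦ R x y ⟧)) (∑-ext (λ y → sym (⟦∧⟧ (S x) (R x y))))))
                             (∑-comm (λ x y → ⟦ S x ∧ R x y ⟧))

    card-∧ : ∀ {n} a (S : PSet n) → card (λ y → a ∧ S y) ≡ ⟦ a ⟧ * card S
    card-∧ a S = trans (∑-ext (λ y → ⟦∧⟧ a (S y))) (sym (*-distribˡ-sum ⟦ a ⟧ (λ y → ⟦ S y ⟧)))

    card-empty : ∀ {n} → card {n} (λ _ → false) ≡ 0
    card-empty {zero} = refl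
    card-empty {suc n} = card-empty {n}

    someElement : ∀ {n} {S : PSet n} → 0 < card S → ∃ λ x → T (S x)
    someElement {n} {S} h with any? (λ x → T? (S x))
    ... | yes p = p
    ... | no ¬p = ⊥-elim (<⇒≱ h (≤-trans (card-mono {R = λ _ → false} (λ x s → ¬p (x , s))) (≤-reflexive (card-empty {n}))))

    element⇒card>0 : ∀ {n} {S : PSet n} x → T (S x) → 0 < card S
    element⇒card>0 {suc n} {S} zero p = ≤-trans (⟦⟧-mono {a = true} (λ _ → p)) (m≤m+n _ _)
    element⇒card>0 {suc n} {S} (suc x) p = ≤-trans (element⇒card>0 {S = S ∘ suc} x p) (m≤n+m _ _)

  exists-below-average : ∀ {n} {S : PSet n} {f} s → 0 < card S → sumOver S f ≤ s → ∃ λ x → T (S x) × card S * f x ≤ s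
  exists-below-average {n} {S} {f} s ne h with any? (λ x → T? (S x) ×-dec (card S * f x ≤? s))
  ... | yes p = p
  ... | no ¬p = ⊥-elim (<⇒≱ (*-monoˡ-< (card S) {{>-nonZero ne}} (n<1+n s)) chain)
    where
    chain : suc s * card S ≤ s * card S
    chain = ≤-trans (sumOver-≥ {S = S} (λ i p → ≰⇒> (λ q → ¬p (i , p , q))))
              (≤-trans (≤-reflexive (sumOver-* S (card S) f)) (≤-trans (*-monoʳ-≤ (card S) h) (≤-reflexive (*-comm (card S) s))))

  ⊆-from-card : ∀ {n} {S R : PSet n} → (∀ x → T (S x) → T (R x)) → card R ≤ card S → ∀ x → T (R x) → T (S x)
  ⊆-from-card {n} {S} {R} sub c x r with T? (S x)
  ... | yes s = s
  ... | no ¬s = ⊥-elim (<⇒≱ (≤-trans (m<n+m (card S) (element⇒card>0 {S = R ∖ S} x (∧-intro r (not-intro ¬s))))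
                  (card-disjoint {S = R} {R = R ∖ S} {Q = S} (λ y p q → not-elim (∧-snd {R y} p) q) (λ y → ∧-fst) sub)) c)

  card-split : ∀ {n} (S R : PSet n) → card S ≤ card (S ∩ R) + card (S ∖ R)
  card-split S R = card-cover {S = S} {R = S ∩ R} {Q = S ∖ R} go
    where
    go : ∀ x → T (S x) → T ((S ∩ R) x) ⊎ T ((S ∖ R) x)
    go x s with T? (R x)
    ... | yes r = inj₁ (∧-intro s r)
    ... | no ¬r = inj₂ (∧-intro s (not-intro ¬r))

  ∖-tri : ∀ {n} (S R Q : PSet n) → card (S ∖ Q) ≤ card (S ∖ R) + card (R ∖ Q)
  ∖-tri {n} S R Q = card-cover {S = S ∖ Q} {R = S ∖ R} {Q = R ∖ Q} go
    where
    go : ∀ z → T ((S ∖ Q) z) → T ((S ∖ R) z) ⊎ T ((R ∖ Q) z)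
    go z p with T? (R z)
    ... | yes r = inj₂ (∧-intro r (∧-snd {S z} p))
    ... | no ¬r = inj₁ (∧-intro (∧-fst p) (not-intro ¬r))

  opaque
    unfolding ∑ card sumOver

    sumOver-swap : ∀ {n} (S Q : PSet n) (R : Fin n → PSet n) →
                   sumOver S (λ x → card (λ y → Q y ∧ R x y)) ≡ sumOver Q (λ y → card (λ x → S x ∧ R x y))
    sumOver-swap S Q R = trans (sumOver-card S (λ x y → Q y ∧ R x y)) (∑-ext (λ y → trans (∑-ext (λ x → cong ⟦_⟧ (comm (S x) (Q y) (R x y)))) (card-∧ (Q y) (λ x → S x ∧ R x y))))
      where
      comm : ∀ a b c → a ∧ (b ∧ c) ≡ b ∧ (a ∧ c)
      comm true b c = refl
      comm false true c = refl
      comm false false c = refl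

  ⋃L : ∀ {n} {A : Set} → (A → PSet n) → List A → PSet n
  ⋃L S [] z = false
  ⋃L S (x ∷ xs) z = S x z ∨ ⋃L S xs z

  card-⋃L-∩ : ∀ {n} {A : Set} (R : PSet n) (S : A → PSet n) δ xs → All (λ y → card (R ∩ S y) ≤ δ) xs → card (R ∩ ⋃L S xs) ≤ length xs * δ
  card-⋃L-∩ R S δ [] [] = ≤-trans (card-mono {R = λ _ → false} (λ z p → ∧-snd {R z} p)) (≤-reflexive card-empty)
  card-⋃L-∩ R S δ (x ∷ xs) (h ∷ hs) = ≤-trans (card-cover go) (+-mono-≤ h (card-⋃L-∩ R S δ xs hs))
    where
    go : ∀ z → T ((R ∩ ⋃L S (x ∷ xs)) z) → T ((R ∩ S x) z) ⊎ T ((R ∩ ⋃L S xs) z)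
    go z p with ∨-elim {S x z} (∧-snd {R z} p)
    ... | inj₁ q = inj₁ (∧-intro (∧-fst p) q)
    ... | inj₂ q = inj₂ (∧-intro (∧-fst p) q)

  -- Truncated inclusion-exclusion: each set adds at least its size minus its overlaps with the
  -- others. It serves as a pigeonhole principle: enough large subsets of `V` must include two that
  -- overlap, in more than `δ` points.
  nearly-disjoint : ∀ {n} {A : Set} (V : PSet n) (S : A → PSet n) s δ xs → All (λ x → s ≤ card (S x)) xs → All (λ x → ∀ z → T (S x z) → T (V z)) xs →
                    AllPairs (λ x y → card (S x ∩ S y) ≤ δ) xs → length xs * s ≤ card V + length xs * length xs * δ
  nearly-disjoint V S s δ xs hs sub ps = ≤-trans (go xs hs ps) (+-monoˡ-≤ _ (card-mono (inV xs sub)))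
    where
    inV : ∀ xs → All (λ x → ∀ z → T (S x z) → T (V z)) xs → ∀ z → T (⋃L S xs z) → T (V z)
    inV (x ∷ xs) (i ∷ is) z p = [ i z , inV xs is z ]′ (∨-elim {S x z} p)
    go : ∀ xs → All (λ x → s ≤ card (S x)) xs → AllPairs (λ x y → card (S x ∩ S y) ≤ δ) xs → length xs * s ≤ card (⋃L S xs) + length xs * length xs * δ
    go [] _ _ = z≤n
    go (x ∷ xs) (h ∷ hs) (p ∷ ps) =
      lin _ _ (suc l * δ) (h ⊹ card-split (S x) U ⊹ card-⋃L-∩ (S x) S δ xs p ⊹ dj ⊹ go xs hs ps)
        (eq l s (card (⋃L S (x ∷ xs))) (card (S x)) (card (S x ∖ U)) (card (S x ∩ U)) (card U) δ)
      where
      U = ⋃L S xs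
      l = length xs
      dj : card (S x ∖ U) + card U ≤ card (⋃L S (x ∷ xs))
      dj = card-disjoint (λ z a b → not-elim (∧-snd {S x z} a) b) (λ z a → ∨-introˡ {S x z} (∧-fst {S x z} a)) (λ z a → ∨-introʳ {S x z} a)
      eq : ∀ l s U' Sx SxU SxI U δ → suc l * s + (Sx + (SxI + SxU) + l * δ + U' + (U + l * l * δ)) + suc l * δ
           ≡ U' + suc l * suc l * δ + (s + Sx + SxI + (SxU + U) + l * s)
      eq = solve-∀

  module Net {n : ℕ} (S : PSet n) (close : Fin n → PSet n) (B : ℕ)
             (bounded : ∀ F → All (λ x → T (S x)) F → AllPairs (λ f g → ¬ T (close f g)) F → length F ≤ B) where

    -- A separated list is extended by any point of `S` far from all its members. Separation bounds
    -- the length, so this stops, and it can stop only when every point of `S` is close to the list.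
    net : ∃ λ F → All (λ x → T (S x)) F × length F ≤ B × (∀ x → T (S x) → ∃ λ i → T (close x (lookup F i)))
    net = extend (suc B) [] [] [] (≤-reflexive (sym (+-identityʳ (suc B))))
      where
      extend : ∀ fuel F → All (λ x → T (S x)) F → AllPairs (λ f g → ¬ T (close f g)) F → suc B ≤ fuel + length F →
               ∃ λ F → All (λ x → T (S x)) F × length F ≤ B × (∀ x → T (S x) → ∃ λ i → T (close x (lookup F i)))
      extend zero F p q h = ⊥-elim (<⇒≱ h (bounded F p q))
      extend (suc fuel) F p q h with any? (λ x → T? (S x) ×-dec ¬? (any? (λ i → T? (close x (lookup F i)))))
      ... | yes (x , s , far) = extend fuel (x ∷ F) (s ∷ p) (All.tabulate far' ∷ q) (≤-trans h (≤-reflexive (sym (+-suc fuel (length F)))))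
        where
        far' : ∀ {y} → y ∈ᴸ F → ¬ T (close x y)
        far' m c = far (index m , subst (λ t → T (close x t)) (AnyP.lookup-index m) c)
      ... | no ¬p = F , p , bounded F p q , λ x s → decidable-stable (any? (λ i → T? (close x (lookup F i)))) (λ nc → ¬p (x , s , nc))

  -- `Q` carries what is known of every pair, such as order and range, over to the pair found to
  -- fail `R`.
  pair-search : ∀ {A : Set} {Q R : A → A → Set} → (∀ x y → Dec (R x y)) → ∀ xs → AllPairs Q xs → AllPairs R xs ⊎ ∃₂ λ x y → Q x y × ¬ R x y
  pair-search R? [] _ = inj₁ []
  pair-search {Q = Q} {R} R? (x ∷ xs) (q ∷ qs) with pair-search R? xs qs | go xs q
    where
    go : ∀ ys → All (Q x) ys → All (R x) ys ⊎ ∃ λ y → Q x y × ¬ R x y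
    go [] _ = inj₁ []
    go (y ∷ ys) (p ∷ ps) with R? x y | go ys ps
    ... | no ¬r | _ = inj₂ (y , p , ¬r)
    ... | yes r | inj₁ rs = inj₁ (r ∷ rs)
    ... | yes r | inj₂ w = inj₂ w
  ... | inj₂ w | _ = inj₂ w
  ... | inj₁ _ | inj₂ (y , w) = inj₂ (x , y , w)
  ... | inj₁ rs | inj₁ r = inj₁ (r ∷ rs)

  ≤/ : ∀ m {n o} .{{_ : NonZero m}} → m * n ≤ o → n ≤ o / m
  ≤/ m {n} {o} h = ≤-trans (≤-reflexive (sym (m*n/n≡m n m))) (/-monoˡ-≤ m (≤-trans (≤-reflexive (*-comm n m)) h))

  */≤ : ∀ m o .{{_ : NonZero m}} → m * (o / m) ≤ o
  */≤ m o = ≤-trans (≤-reflexive (*-comm m (o / m))) (m/n*n≤m o m)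

  pos-factorʳ : ∀ x {y} → 0 < x * y → 0 < y
  pos-factorʳ x {zero} h = ⊥-elim (<⇒≱ h (≤-reflexive (*-zeroʳ x)))
  pos-factorʳ x {suc y} h = s≤s z≤n

  pos-factorˡ : ∀ {x} y → 0 < x * y → 0 < x
  pos-factorˡ {suc x} y h = s≤s z≤n

  opaque
    unfolding ∑ card sumOver

    sumOver-split : ∀ {n} (S P : PSet n) {f} u v → (∀ x → T (S x) → ¬ T (P x) → f x ≤ u) → (∀ x → T (S x) → T (P x) → f x ≤ v) →
                    sumOver S f ≤ u * card S + v * card P
    sumOver-split {n} S P {f} u v h₁ h₂ = ≤-trans (∑-mono pt) (≤-reflexive (trans (∑-distrib-+ (λ x → u * ⟦ S x ⟧) (λ x → v * ⟦ P x ⟧))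
        (cong₂ _+_ (sym (*-distribˡ-sum u (λ x → ⟦ S x ⟧))) (sym (*-distribˡ-sum v (λ x → ⟦ P x ⟧))))))
      where
      pt : ∀ x → ⟦ S x ⟧ * f x ≤ u * ⟦ S x ⟧ + v * ⟦ P x ⟧
      pt x with S x | P x | h₁ x | h₂ x
      ... | false | _ | _ | _ = z≤n
      ... | true | true | _ | k = ≤-trans (≤-reflexive (+-identityʳ (f x))) (≤-trans (k tt tt) (≤-trans (≤-reflexive (sym (*-identityʳ v))) (m≤n+m _ _)))
      ... | true | false | k | _ = ≤-trans (≤-reflexive (+-identityʳ (f x))) (≤-trans (k tt id) (≤-trans (≤-reflexive (sym (*-identityʳ u))) (m≤m+n _ _)))

  ⋃L⇒Any : ∀ {n} {A : Set} {S : A → PSet n} xs {z} → T (⋃L S xs z) → Any (λ x → T (S x z)) xs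
  ⋃L⇒Any {S = S} (x ∷ xs) {z} p = [ here , there ∘ ⋃L⇒Any xs ]′ (∨-elim {S x z} p)

  Any⇒⋃L : ∀ {n} {A : Set} {S : A → PSet n} {xs z} → Any (λ x → T (S x z)) xs → T (⋃L S xs z)
  Any⇒⋃L (here p) = ∨-introˡ p
  Any⇒⋃L {S = S} {xs = x ∷ xs} {z} (there p) = ∨-introʳ {S x z} (Any⇒⋃L p)

  opaque
    unfolding ∑ card

    card≤1 : ∀ {n} {S : PSet n} y → (∀ x → T (S x) → x ≡ y) → card S ≤ 1
    card≤1 {suc n} {S} zero h = +-mono-≤ {⟦ S zero ⟧} {1} (⟦⟧-mono {b = true} _) (≤-trans (card-mono {S = S ∘ suc} {R = λ _ → false} (λ x p → case h (suc x) p of λ ())) (≤-reflexive (card-empty {n})))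
    card≤1 {suc n} {S} (suc y) h = +-mono-≤ {⟦ S zero ⟧} {0} (⟦⟧-mono {b = false} (λ p → case h zero p of λ ())) (card≤1 {S = S ∘ suc} y (λ x p → Fin-suc-injective (h (suc x) p)))

  another-element : ∀ {n} {S : PSet n} y → 1 < card S → ∃ λ x → T (S x) × x ≢ y
  another-element {S = S} y lt with any? (λ x → T? (S x) ×-dec ¬? (x ≟ᶠ y))
  ... | yes p = p
  ... | no ¬p = ⊥-elim (<⇒≱ lt (card≤1 y (λ x s → decidable-stable (x ≟ᶠ y) (λ ne → ¬p (x , s , ne)))))

  -- Groups

  infixl 6 _:+_ _:-_
  infixr 7 _:*_
  data Expr (m : ℕ) : Set where
    var : Fin m → Expr m
    :0 : Expr m
    _:+_ _:-_ : Expr m → Expr m → Expr m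
    _:*_ : ℕ → Expr m → Expr m

  pattern :x = var zero
  pattern :y = var (suc zero)
  pattern :z = var (suc (suc zero))
  pattern :w = var (suc (suc (suc zero)))

  unit : ∀ {m} → Fin m → Vec ℕ m
  unit zero = 1 ∷ V.replicate _ 0
  unit (suc i) = 0 ∷ unit i

  -- An expression is kept as a difference of two coefficient vectors over ℕ, so that solveG needs only refl.
  pos neg : ∀ {m} → Expr m → Vec ℕ m
  pos (var i) = unit i
  pos :0 = V.replicate _ 0
  pos (a :+ b) = V.zipWith _+_ (pos a) (pos b)
  pos (a :- b) = V.zipWith _+_ (pos a) (neg b)
  pos (k :* a) = V.map (k *_) (pos a)
  neg (var i) = V.replicate _ 0
  neg :0 = V.replicate _ 0
  neg (a :+ b) = V.zipWith _+_ (neg a) (neg b)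
  neg (a :- b) = V.zipWith _+_ (neg a) (pos b)
  neg (k :* a) = V.map (k *_) (neg a)

  module Grp {n : ℕ} (G : FinAbGroup n) where
    open FinAbGroup G using (isAbelianGroup)

    bundle : AbelianGroup 0ℓ 0ℓ
    bundle = record { isAbelianGroup = isAbelianGroup }

    open AbelianGroup bundle public using () renaming (_∙_ to infixl 6 _⊕_; ε to 𝟘; _⁻¹ to ⊝_; assoc to ⊕-assoc; comm to ⊕-comm;
      identityˡ to ⊕-idˡ; identityʳ to ⊕-idʳ; inverseˡ to ⊕-invˡ; inverseʳ to ⊕-invʳ)
    open Algebra.Properties.CommutativeMonoid.Mult (AbelianGroup.commutativeMonoid bundle) public
      using () renaming (_×_ to _×ᵐ_; ×-homo-+ to ×ᵐ-homo-+; ×-assocˡ to ×ᵐ-assoc; ×-distrib-+ to ×ᵐ-distrib; ×-homo-1 to ×ᵐ-1)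
    module GP = Algebra.Properties.Group (AbelianGroup.group bundle)
    infixl 6 _⊖_
    infixr 7 _·_

    opaque
      _⊖_ : Fin n → Fin n → Fin n
      x ⊖ y = x ⊕ (⊝ y)

      _·_ : ℕ → Fin n → Fin n
      k · x = k ×ᵐ x

      -- N S x counts the points of S + x outside S; it is a seminorm in x.
      N : PSet n → Fin n → ℕ
      N S x = card (λ z → S (z ⊖ x) ∧ not (S z))

      N-def : ∀ S x → N S x ≡ card (λ z → S (z ⊖ x) ∧ not (S z))
      N-def S x = refl

      ⊖-def : ∀ x y → x ⊖ y ≡ x ⊕ (⊝ y)
      ⊖-def x y = refl

      ·-zero : ∀ x → 0 · x ≡ 𝟘
      ·-zero x = refl

      ·-suc : ∀ k x → suc k · x ≡ x ⊕ k · x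
      ·-suc k x = refl

      ·-homo-+ : ∀ x j k → (j + k) · x ≡ j · x ⊕ k · x
      ·-homo-+ = ×ᵐ-homo-+

      ·-assoc : ∀ x j k → j · (k · x) ≡ (j * k) · x
      ·-assoc = ×ᵐ-assoc

      ·-distrib : ∀ x y k → k · (x ⊕ y) ≡ k · x ⊕ k · y
      ·-distrib = ×ᵐ-distrib

      ·-1 : ∀ x → 1 · x ≡ x
      ·-1 = ×ᵐ-1

    opaque
      unfolding _⊖_ _·_ N

      interchange : ∀ a b c d → (a ⊕ b) ⊕ (c ⊕ d) ≡ (a ⊕ c) ⊕ (b ⊕ d)
      interchange a b c d = begin
        (a ⊕ b) ⊕ (c ⊕ d) ≡⟨ ⊕-assoc a b (c ⊕ d) ⟩
        a ⊕ (b ⊕ (c ⊕ d)) ≡⟨ cong (a ⊕_) (sym (⊕-assoc b c d)) ⟩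
        a ⊕ ((b ⊕ c) ⊕ d) ≡⟨ cong (λ t → a ⊕ (t ⊕ d)) (⊕-comm b c) ⟩
        a ⊕ ((c ⊕ b) ⊕ d) ≡⟨ cong (a ⊕_) (⊕-assoc c b d) ⟩
        a ⊕ (c ⊕ (b ⊕ d)) ≡⟨ sym (⊕-assoc a c (b ⊕ d)) ⟩
        (a ⊕ c) ⊕ (b ⊕ d) ∎
        where open ≡-Reasoning

      ⊖-cancel : ∀ x y → (x ⊖ y) ⊕ y ≡ x
      ⊖-cancel x y = trans (⊕-assoc x (⊝ y) y) (trans (cong (x ⊕_) (⊕-invˡ y)) (⊕-idʳ x))

      ·-𝟘 : ∀ k → k · 𝟘 ≡ 𝟘
      ·-𝟘 zero = refl
      ·-𝟘 (suc k) = trans (⊕-idˡ _) (·-𝟘 k)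

    Env : ℕ → Set
    Env m = Vec (Fin n) m

    lc : ∀ {m} → Vec ℕ m → Env m → Fin n
    lc [] [] = 𝟘
    lc (c ∷ cs) (x ∷ xs) = c · x ⊕ lc cs xs

    opaque
      unfolding _⊖_ _·_ N

      lc-0 : ∀ {m} (ρ : Env m) → lc (V.replicate m 0) ρ ≡ 𝟘
      lc-0 [] = refl
      lc-0 (x ∷ ρ) = trans (⊕-idˡ _) (lc-0 ρ)

      lc-unit : ∀ {m} (i : Fin m) (ρ : Env m) → lc (unit i) ρ ≡ V.lookup ρ i
      lc-unit zero (x ∷ ρ) = trans (cong₂ _⊕_ (·-1 x) (lc-0 ρ)) (⊕-idʳ x)
      lc-unit (suc i) (x ∷ ρ) = trans (⊕-idˡ _) (lc-unit i ρ)

      lc-+ : ∀ {m} (u v : Vec ℕ m) (ρ : Env m) → lc (V.zipWith _+_ u v) ρ ≡ lc u ρ ⊕ lc v ρ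
      lc-+ [] [] [] = sym (⊕-idˡ 𝟘)
      lc-+ (a ∷ u) (b ∷ v) (x ∷ ρ) = trans (cong₂ _⊕_ (·-homo-+ x a b) (lc-+ u v ρ)) (interchange _ _ _ _)

      lc-* : ∀ {m} k (u : Vec ℕ m) (ρ : Env m) → lc (V.map (k *_) u) ρ ≡ k · lc u ρ
      lc-* k [] [] = sym (·-𝟘 k)
      lc-* k (a ∷ u) (x ∷ ρ) = trans (cong₂ _⊕_ (sym (·-assoc x k a)) (lc-* k u ρ)) (sym (·-distrib _ _ k))

    eval : ∀ {m} → Expr m → Env m → Fin n
    eval (var i) ρ = V.lookup ρ i
    eval :0 ρ = 𝟘
    eval (a :+ b) ρ = eval a ρ ⊕ eval b ρ
    eval (a :- b) ρ = eval a ρ ⊖ eval b ρ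
    eval (k :* a) ρ = k · eval a ρ

    opaque
      unfolding _⊖_ _·_ N

      eval-lc : ∀ {m} (e : Expr m) (ρ : Env m) → eval e ρ ⊕ lc (neg e) ρ ≡ lc (pos e) ρ
      eval-lc (var i) ρ = trans (cong (V.lookup ρ i ⊕_) (lc-0 ρ)) (trans (⊕-idʳ _) (sym (lc-unit i ρ)))
      eval-lc :0 ρ = ⊕-idˡ _
      eval-lc (a :+ b) ρ = trans (cong (eval a ρ ⊕ eval b ρ ⊕_) (lc-+ (neg a) (neg b) ρ))
        (trans (interchange _ _ _ _) (trans (cong₂ _⊕_ (eval-lc a ρ) (eval-lc b ρ)) (sym (lc-+ (pos a) (pos b) ρ))))
      eval-lc (a :- b) ρ = trans (cong (eval a ρ ⊖ eval b ρ ⊕_) (lc-+ (neg a) (pos b) ρ))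
        (trans (interchange _ _ _ _) (trans (cong₂ _⊕_ (eval-lc a ρ) flip) (sym (lc-+ (pos a) (neg b) ρ))))
        where
        flip : ⊝ eval b ρ ⊕ lc (pos b) ρ ≡ lc (neg b) ρ
        flip = trans (cong (⊝ eval b ρ ⊕_) (sym (eval-lc b ρ))) (trans (sym (⊕-assoc _ _ _)) (trans (cong (_⊕ lc (neg b) ρ) (⊕-invˡ _)) (⊕-idˡ _)))
      eval-lc (k :* a) ρ = trans (cong (k · eval a ρ ⊕_) (lc-* k (neg a) ρ))
        (trans (sym (·-distrib _ _ k)) (trans (cong (k ·_) (eval-lc a ρ)) (sym (lc-* k (pos a) ρ))))

      solveG : ∀ {m} (ρ : Env m) (a b : Expr m) → V.zipWith _+_ (pos a) (neg b) ≡ V.zipWith _+_ (pos b) (neg a) → eval a ρ ≡ eval b ρ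
      solveG ρ a b eq = GP.∙-cancelʳ (lc (neg b) ρ ⊕ lc (neg a) ρ) (eval a ρ) (eval b ρ) (begin
        eval a ρ ⊕ (lc (neg b) ρ ⊕ lc (neg a) ρ) ≡⟨ cong (eval a ρ ⊕_) (⊕-comm _ _) ⟩
        eval a ρ ⊕ (lc (neg a) ρ ⊕ lc (neg b) ρ) ≡⟨ sym (⊕-assoc _ _ _) ⟩
        eval a ρ ⊕ lc (neg a) ρ ⊕ lc (neg b) ρ   ≡⟨ cong (_⊕ lc (neg b) ρ) (eval-lc a ρ) ⟩
        lc (pos a) ρ ⊕ lc (neg b) ρ              ≡⟨ sym (lc-+ (pos a) (neg b) ρ) ⟩
        lc (V.zipWith _+_ (pos a) (neg b)) ρ       ≡⟨ cong (λ v → lc v ρ) eq ⟩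
        lc (V.zipWith _+_ (pos b) (neg a)) ρ       ≡⟨ lc-+ (pos b) (neg a) ρ ⟩
        lc (pos b) ρ ⊕ lc (neg a) ρ              ≡⟨ cong (_⊕ lc (neg a) ρ) (sym (eval-lc b ρ)) ⟩
        eval b ρ ⊕ lc (neg b) ρ ⊕ lc (neg a) ρ   ≡⟨ ⊕-assoc _ _ _ ⟩
        eval b ρ ⊕ (lc (neg b) ρ ⊕ lc (neg a) ρ) ∎)
        where open ≡-Reasoning

      ·-⊖ : ∀ k x y → k · (x ⊖ y) ≡ k · x ⊖ k · y
      ·-⊖ k x y = GP.∙-cancelʳ (k · y) _ _ (trans (sym (·-distrib _ _ k)) (trans (cong (k ·_) (⊖-cancel x y)) (sym (⊖-cancel (k · x) (k · y)))))

      ·-comm : ∀ j k x → j · (k · x) ≡ k · (j · x)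
      ·-comm j k x = trans (·-assoc x j k) (trans (cong (_· x) (*-comm j k)) (sym (·-assoc x k j)))

      ·-∸ : ∀ {j k} x → k ≤ j → (j ∸ k) · x ≡ j · x ⊖ k · x
      ·-∸ {j} {k} x k≤j = GP.∙-cancelʳ (k · x) _ _ (trans (sym (·-homo-+ x (j ∸ k) k)) (trans (cong (_· x) (m∸n+n≡m k≤j)) (sym (⊖-cancel _ _))))

      ⊕-⊖ : ∀ x y → (x ⊕ y) ⊖ y ≡ x
      ⊕-⊖ x y = solveG (x ∷ y ∷ []) ((:x :+ :y) :- :y) :x refl

      card-shift : ∀ t {S R : PSet n} → (∀ x → T (S x) → T (R (x ⊕ t))) → card S ≤ card R
      card-shift t = card-bij (_⊕ t) (_⊖ t) (λ x → ⊖-cancel x t) (λ x → ⊕-⊖ x t)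

      card-unshift : ∀ t {S R : PSet n} → (∀ x → T (S x) → T (R (x ⊖ t))) → card S ≤ card R
      card-unshift t = card-bij (_⊖ t) (_⊕ t) (λ x → ⊕-⊖ x t) (λ x → ⊖-cancel x t)

    opaque
      unfolding _⊖_ _·_ N

      N-zero : ∀ S v → N S 𝟘 ≤ v
      N-zero S v with N S 𝟘 ≤? v
      ... | yes p = p
      ... | no ¬p with someElement {S = λ z → S (z ⊖ 𝟘) ∧ not (S z)} (≤-trans (s≤s z≤n) (≰⇒> ¬p))
      ... | z , q = ⊥-elim (not-elim (∧-snd {S (z ⊖ 𝟘)} q) (transport S (solveG (z ∷ []) (:x :- :0) :x refl) (∧-fst q)))

      N-⊕ : ∀ S x y → N S (x ⊕ y) ≤ N S x + N S y
      N-⊕ S x y = ≤-trans (card-cover {R = λ z → S (z ⊖ x) ∧ not (S z)} {Q = λ z → S (z ⊖ (x ⊕ y)) ∧ not (S (z ⊖ x))} go)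
                    (+-monoʳ-≤ (N S x) (card-unshift x λ z p → ∧-intro (transport S (eq z) (∧-fst p)) (∧-snd {S (z ⊖ (x ⊕ y))} p)))
        where
        eq : ∀ z → z ⊖ (x ⊕ y) ≡ z ⊖ x ⊖ y
        eq z = solveG (z ∷ x ∷ y ∷ []) (:x :- (:y :+ :z)) (:x :- :y :- :z) refl
        go : ∀ z → T (S (z ⊖ (x ⊕ y)) ∧ not (S z)) → T (S (z ⊖ x) ∧ not (S z)) ⊎ T (S (z ⊖ (x ⊕ y)) ∧ not (S (z ⊖ x)))
        go z p with T? (S (z ⊖ x))
        ... | yes q = inj₁ (∧-intro q (∧-snd {S (z ⊖ (x ⊕ y))} p))
        ... | no ¬q = inj₂ (∧-intro (∧-fst p) (not-intro ¬q))

      escape≤N : ∀ S t → card (λ y → S y ∧ not (S (y ⊕ t))) ≤ N S t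
      escape≤N S t = card-shift t (λ y q → ∧-intro (transport S (sym (⊕-⊖ y t)) (∧-fst q)) (∧-snd {S y} q))

      card≤∩+N : ∀ S x → card S ≤ card (λ z → S (z ⊖ x) ∧ S z) + N S x
      card≤∩+N S x = ≤-trans (card-shift x {R = λ z → S (z ⊖ x)} λ z p → transport S (sym (⊕-⊖ z x)) p)
                       (card-split (λ z → S (z ⊖ x)) S)

      ∩+N≤card : ∀ S x → card (λ z → S (z ⊖ x) ∧ S z) + N S x ≤ card S
      ∩+N≤card S x = ≤-trans (card-disjoint {S = λ z → S (z ⊖ x)} (λ z p q → not-elim (∧-snd {S (z ⊖ x)} q) (∧-snd {S (z ⊖ x)} p)) (λ z → ∧-fst) (λ z → ∧-fst))
                       (card-unshift x λ z p → p)

      -- `N S x` is the size of `S` less that of its intersection with `S + x`, and a shift carries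
      -- this intersection to the one for `⊝ x`.
      N-neg : ∀ S x → N S (⊝ x) ≤ N S x
      N-neg S x = +-cancelˡ-≤ (card (λ z → S (z ⊖ x) ∧ S z)) _ _
        (≤-trans (+-monoˡ-≤ (N S (⊝ x)) same) (≤-trans (∩+N≤card S (⊝ x)) (card≤∩+N S x)))
        where
        same : card (λ z → S (z ⊖ x) ∧ S z) ≤ card (λ z → S (z ⊖ (⊝ x)) ∧ S z)
        same = card-unshift x λ z p → ∧-intro (transport S (trans (solveG (z ∷ x ∷ []) :x (:x :- :y :- (:0 :- :y)) refl)
                 (cong (λ t → z ⊖ x ⊖ t) (⊕-idˡ (⊝ x)))) (∧-snd {S (z ⊖ x)} p)) (∧-fst p)

      N-⊖ : ∀ S x y → N S (x ⊖ y) ≤ N S x + N S y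
      N-⊖ S x y = ≤-trans (N-⊕ S x (⊝ y)) (+-monoʳ-≤ (N S x) (N-neg S y))

      N-· : ∀ S m x → N S (m · x) ≤ m * N S x
      N-· S zero x = N-zero S 0
      N-· S (suc m) x = ≤-trans (N-⊕ S x (m · x)) (+-monoʳ-≤ (N S x) (N-· S m x))

      N-∪ : ∀ S R x → N (S ∪ R) x ≤ N S x + N R x
      N-∪ S R x = card-cover go
        where
        go : ∀ z → T ((S ∪ R) (z ⊖ x) ∧ not ((S ∪ R) z)) → T (S (z ⊖ x) ∧ not (S z)) ⊎ T (R (z ⊖ x) ∧ not (R z))
        go z p with ∨-elim {S (z ⊖ x)} (∧-fst p)
        ... | inj₁ s = inj₁ (∧-intro s (not-intro (λ q → not-elim (∧-snd {(S ∪ R) (z ⊖ x)} p) (∨-introˡ q))))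
        ... | inj₂ r = inj₂ (∧-intro r (not-intro (λ q → not-elim (∧-snd {(S ∪ R) (z ⊖ x)} p) (∨-introʳ {S z} q))))

      N-near : ∀ {S Y} x → (∀ z → T (S z) → T (Y z)) → N Y x ≤ card (Y ∖ S) + N S x
      N-near {S} {Y} x sub = ≤-trans (card-cover {R = λ z → Y (z ⊖ x) ∧ not (S (z ⊖ x))} {Q = λ z → S (z ⊖ x) ∧ not (S z)} go)
                               (+-monoˡ-≤ (N S x) (card-unshift x (λ z p → p)))
        where
        go : ∀ z → T (Y (z ⊖ x) ∧ not (Y z)) → T (Y (z ⊖ x) ∧ not (S (z ⊖ x))) ⊎ T (S (z ⊖ x) ∧ not (S z))
        go z p with T? (S (z ⊖ x))
        ... | yes q = inj₂ (∧-intro q (not-intro (λ s → not-elim (∧-snd {Y (z ⊖ x)} p) (sub z s))))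
        ... | no ¬q = inj₁ (∧-intro (∧-fst p) (not-intro ¬q))

    -- The inverse has to be multiplication by an integer, so that every subgroup is closed under
    -- it: a subgroup containing `m · x` contains `x`.
    Invertible : ℕ → Set
    Invertible m = ∃ λ u → ∀ x → u · (m · x) ≡ x

    TorsionFreeUpTo : ℕ → Set
    TorsionFreeUpTo M = ∀ m → 1 ≤ m → m ≤ M → Invertible m

    opaque
      unfolding _⊖_ _·_ N

      ·-injective : ∀ m → Invertible m → ∀ {x y} → m · x ≡ m · y → x ≡ y
      ·-injective m (u , h) {x} {y} e = trans (sym (h x)) (trans (cong (u ·_) e) (h y))

      multiples-distinct : ∀ {M} → TorsionFreeUpTo M → ∀ {d} → d ≢ 𝟘 → ∀ {i j} → i ≤ M → j ≤ M → i · d ≡ j · d → i ≡ j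
      multiples-distinct {M} tf {d} d≢0 {i} {j} i≤ j≤ e with <-cmp i j
      ... | tri≈ _ p _ = p
      ... | tri< i<j _ _ = ⊥-elim (d≢0 (·-injective (j ∸ i) (tf (j ∸ i) (m<n⇒0<n∸m i<j) (≤-trans (m∸n≤m j i) j≤))
              (trans (·-∸ d (<⇒≤ i<j)) (trans (cong (_⊖ i · d) (sym e)) (trans (⊕-invʳ _) (sym (·-𝟘 (j ∸ i))))))))
      ... | tri> _ _ j<i = ⊥-elim (d≢0 (·-injective (i ∸ j) (tf (i ∸ j) (m<n⇒0<n∸m j<i) (≤-trans (m∸n≤m i j) i≤))
              (trans (·-∸ d (<⇒≤ j<i)) (trans (cong (_⊖ j · d) e) (trans (⊕-invʳ _) (sym (·-𝟘 (i ∸ j))))))))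

  module Halving {n : ℕ} (G : FinAbGroup n) (inv2 : Grp.Invertible G 2) where
    open Grp G

    half : Fin n → Fin n
    half x = proj₁ inv2 · x

    opaque
      unfolding N

      half-2· : ∀ x → half (2 · x) ≡ x
      half-2· = proj₂ inv2

      2·-half : ∀ x → 2 · half x ≡ x
      2·-half x = trans (·-comm 2 (proj₁ inv2) x) (half-2· x)

    -- The dilate 2S; going through `half` keeps membership a Boolean test.
    dil : PSet n → PSet n
    dil S z = S (half z)

    opaque
      unfolding N

      card-double : ∀ {S R : PSet n} → (∀ x → T (S x) → T (R (2 · x))) → card S ≤ card R
      card-double = card-bij (2 ·_) half 2·-half half-2·

      card-half : ∀ {S R : PSet n} → (∀ x → T (S x) → T (R (half x))) → card S ≤ card R
      card-half = card-bij half (2 ·_) half-2· 2·-half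

      half-⊖2· : ∀ z x → half (z ⊖ 2 · x) ≡ half z ⊖ x
      half-⊖2· z x = trans (·-⊖ (proj₁ inv2) z (2 · x)) (cong (half z ⊖_) (half-2· x))

      N-dil-≤ : ∀ S x → N (dil S) (2 · x) ≤ N S x
      N-dil-≤ S x = card-half λ z p → subst (λ t → T (S t ∧ not (S (half z)))) (half-⊖2· z x) p

      N-dil-≥ : ∀ S x → N S x ≤ N (dil S) (2 · x)
      N-dil-≥ S x = card-double λ z p → subst₂′ (sym (trans (half-⊖2· (2 · z) x) (cong (_⊖ x) (half-2· z)))) (sym (half-2· z)) p
        where
        subst₂′ : ∀ {a b c d} → a ≡ c → b ≡ d → T (S a ∧ not (S b)) → T (S c ∧ not (S d))
        subst₂′ refl refl p = p

      card-dil∖ : ∀ S R → card (dil S ∖ R) ≤ card (λ z → S z ∧ not (R (2 · z)))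
      card-dil∖ S R = card-half λ z p → subst (λ t → T (S (half z) ∧ not (R t))) (sym (2·-half z)) p

      -- A set and its dilate have equally many points, hence so have their two differences.
      card-∖dil : ∀ S → card (S ∖ dil S) ≤ card (dil S ∖ S)
      card-∖dil S = +-cancelˡ-≤ (card (S ∩ dil S)) _ _
        (≤-trans (card-disjoint {S = S} (λ z p q → not-elim (∧-snd {S z} q) (∧-snd {S z} p)) (λ z → ∧-fst) (λ z → ∧-fst))
        (≤-trans (card-double {S = S} {R = dil S} λ z p → transport S (sym (half-2· z)) p)
        (≤-trans (card-split (dil S) S) (+-monoˡ-≤ _ (card-mono λ z p → ∧-intro (∧-snd {dil S z} p) (∧-fst p))))))

      compare : ∀ {S R} y {e v} → card (S ∖ R) ≤ e → card (R ∖ S) ≤ e → N R y ≤ v → N S y ≤ v + 2 * e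
      compare {S} {R} y {e} {v} p q r =
        ≤-trans (∖-tri (λ z → S (z ⊖ y)) (λ z → R (z ⊖ y)) S)
        (≤-trans (+-mono-≤ (≤-trans (card-unshift y (λ z t → t)) p) (≤-trans (∖-tri (λ z → R (z ⊖ y)) R S) (+-mono-≤ r q)))
        (≤-reflexive (lemma e v)))
        where
        lemma : ∀ e v → e + (v + e) ≡ v + 2 * e
        lemma = solve-∀

      N-double : ∀ S x → N S (2 · x) ≤ N S x + 2 * card (dil S ∖ S)
      N-double S x = compare {S} {dil S} (2 · x) (card-∖dil S) ≤-refl (N-dil-≤ S x)

      N-halve : ∀ S x → N S x ≤ N S (2 · x) + 2 * card (dil S ∖ S)
      N-halve S x = ≤-trans (N-dil-≥ S x) (compare {dil S} {S} (2 · x) ≤-refl (card-∖dil S) ≤-refl)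

  function-clash : ∀ {r s J} → s ^ r < suc J → (c : Fin (suc J) → Fin r → Fin s) → ∃₂ λ i j → toℕ i < toℕ j × (∀ a → c i a ≡ c j a)
  function-clash few c = let i , j , lt , eq = pigeonhole few (λ j → funToFin (c j)) in
    i , j , lt , λ a → trans (sym (finToFun-funToFin (c i) a)) (trans (cong (λ w → finToFun w a) eq) (finToFun-funToFin (c j) a))

  -- Subgroups from almost doubling-invariant sets

  module Subgroups {n : ℕ} (G : FinAbGroup n) where
    open Grp G

    record IsSub (H : PSet n) : Set where
      field
        0∈ : T (H 𝟘)
        +∈ : ∀ {x y} → T (H x) → T (H y) → T (H (x ⊕ y))
        -∈ : ∀ {x} → T (H x) → T (H (⊝ x))

      ⊖∈ : ∀ {x y} → T (H x) → T (H y) → T (H (x ⊖ y))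
      ⊖∈ {x} {y} p q = transport H (sym (⊖-def x y)) (+∈ p (-∈ q))

      ·∈ : ∀ k {x} → T (H x) → T (H (k · x))
      ·∈ zero {x} p = transport H (sym (·-zero x)) 0∈
      ·∈ (suc k) {x} p = transport H (sym (·-suc k x)) (+∈ p (·∈ k p))

  module Extract {n : ℕ} (G : FinAbGroup n) (inv2 : Grp.Invertible G 2) (Y : PSet n) where
    open Grp G
    open Halving G inv2
    open Subgroups G
    open V using ([]; _∷_)

    -- The failure of `Y` to be invariant under doubling. Doubling or halving `x` raises `N Y x` by
    -- at most 2e.
    e : ℕ
    e = card (dil Y ∖ Y)

    abstract
      2^suc : ∀ j x → 2 ^ suc j · x ≡ 2 · (2 ^ j · x)
      2^suc j x = sym (·-assoc x 2 (2 ^ j))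

      N-2^ : ∀ j x → N Y (2 ^ j · x) ≤ N Y x + j * (2 * e)
      N-2^ zero x = ≤-reflexive (trans (cong (N Y) (·-1 x)) (sym (+-identityʳ _)))
      N-2^ (suc j) x = ≤-trans (≤-reflexive (cong (N Y) (2^suc j x))) (lin _ _ 0 (N-double Y (2 ^ j · x) ⊹ N-2^ j x) (eq (N Y (2 · (2 ^ j · x))) (N Y (2 ^ j · x)) (N Y x) (2 * e) j))
        where
        eq : ∀ a b c d j → a + (b + d + (c + j * d)) + 0 ≡ c + suc j * d + (a + b)
        eq = solve-∀

      N-2^⁻¹ : ∀ j x → N Y x ≤ N Y (2 ^ j · x) + j * (2 * e)
      N-2^⁻¹ zero x = ≤-reflexive (trans (sym (cong (N Y) (·-1 x))) (sym (+-identityʳ _)))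
      N-2^⁻¹ (suc j) x = ≤-trans (lin _ _ 0 (N-halve Y (2 ^ j · x) ⊹ N-2^⁻¹ j x) (eq (N Y (2 · (2 ^ j · x))) (N Y (2 ^ j · x)) (N Y x) (2 * e) j))
                          (≤-reflexive (cong (λ t → N Y t + suc j * (2 * e)) (sym (2^suc j x))))
        where
        eq : ∀ a b c d j → c + (a + d + (b + j * d)) + 0 ≡ a + suc j * d + (b + c)
        eq = solve-∀

    opaque
      Ball : ℕ → PSet n
      Ball v x = ⌊ N Y x ≤? v ⌋

      Ball-in : ∀ {v x} → N Y x ≤ v → T (Ball v x)
      Ball-in = fromWitness

      Ball-out : ∀ {v x} → T (Ball v x) → N Y x ≤ v
      Ball-out = toWitness

    abstract
      -- For `x` in the ball, `Y` and `Y + x` share at least half of `Y`; over all `x` these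
      -- intersections add up to |Y|^2.
      card-Ball : 0 < card Y → ∀ v → 2 * v ≤ card Y → card (Ball v) ≤ 2 * card Y
      card-Ball p v h = *-cancelˡ-≤ (card Y) {{>-nonZero p}} (begin
        card Y * card (Ball v) ≤⟨ sumOver-≥ {S = Ball v} {f = λ x → 2 * I x} (λ x b → big x (Ball-out b)) ⟩
        sumOver (Ball v) (λ x → 2 * I x) ≡⟨ sumOver-* (Ball v) 2 I ⟩
        2 * sumOver (Ball v) I ≡⟨ cong (2 *_) (sumOver-swap (Ball v) Y (λ x z → Y (z ⊖ x))) ⟩
        2 * sumOver Y (λ z → card (λ x → Ball v x ∧ Y (z ⊖ x))) ≤⟨ *-monoʳ-≤ 2 (sumOver-≤ {S = Y} {c = card Y} (λ z _ → refl-card z)) ⟩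
        2 * (card Y * card Y) ≡⟨ eq (card Y) ⟩
        card Y * (2 * card Y) ∎)
        where
        open ≤-Reasoning
        eq : ∀ y → 2 * (y * y) ≡ y * (2 * y)
        eq = solve-∀
        I : Fin n → ℕ
        I x = card (λ z → Y z ∧ Y (z ⊖ x))
        big : ∀ x → N Y x ≤ v → card Y ≤ 2 * I x
        big x b = lin _ _ 0 (card≤∩+N Y x ⊹ card≤∩+N Y x ⊹ 2 ⊛ b ⊹ h ⊹ 2 ⊛ card-mono {R = λ z → Y z ∧ Y (z ⊖ x)} (λ z t → ∧-intro (∧-snd {Y (z ⊖ x)} t) (∧-fst t)))
                    (eq₂ (card Y) (I x) (card (λ z → Y (z ⊖ x) ∧ Y z)) (N Y x) v)
          where
          eq₂ : ∀ y i i' N v → y + (i' + N + (i' + N) + 2 * v + y + 2 * i) + 0 ≡ 2 * i + (y + y + 2 * N + 2 * v + 2 * i')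
          eq₂ = solve-∀
        invol : ∀ z x → z ⊖ (z ⊖ x) ≡ x
        invol z x = solveG (z ∷ x ∷ []) (:x :- (:x :- :y)) :y refl
        refl-card : ∀ z → card (λ x → Ball v x ∧ Y (z ⊖ x)) ≤ card Y
        refl-card z = card-bij (z ⊖_) (z ⊖_) (invol z) (invol z) (λ x t → ∧-snd {Ball v x} t)

    module GroupPart (δ B : ℕ) (D : PSet n) (hD : ∀ t → T (D t) → N Y t ≤ δ) (Y≢∅ : 0 < card Y) (h40 : 40 * δ ≤ card Y)
                     (hB : 2 * card Y ≤ B * card D) (D≢∅ : 0 < card D) (B>0 : 1 ≤ B)
                     (hJ : 4 * (B ^ B) * e ≤ δ) (tf : TorsionFreeUpTo (2 ^ (B ^ B))) where
      -- At least the number of maps from one net to the other, so that two of the exponents 0, ...,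
      -- J induce the same map.
      J : ℕ
      J = B ^ B

      close : Fin n → PSet n
      close x f = Ball (2 * δ) (x ⊖ f)

      abstract
        -- The translates of `D` by a separated list are disjoint and lie in the ball of radius 20δ,
        -- whose size is bounded.
        separated : ∀ v → v ≤ 19 * δ → ∀ F → All (λ x → T (Ball v x)) F → AllPairs (λ f g → ¬ T (close f g)) F → length F ≤ B
        separated v v≤ F inB sep = *-cancelʳ-≤ _ _ (card D) {{>-nonZero D≢∅}} (begin
          length F * card D ≤⟨ nearly-disjoint (Ball (20 * δ)) (λ f z → D (z ⊖ f)) (card D) 0 F
              (All.universal (λ f → card-shift f {R = λ z → D (z ⊖ f)} (λ x p → transport D (sym (⊕-⊖ x f)) p)) F)
              (All.map (λ {f} b z p → Ball-in (sub f z (Ball-out b) p)) inB)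
              (AllPairs.map (λ {f} {g} far → ≤-trans (card-mono {R = λ _ → _} (λ z p → far (Ball-in (meet f g z p)))) (≤-reflexive card-empty)) sep) ⟩
          card (Ball (20 * δ)) + length F * length F * 0 ≡⟨ trans (cong (card (Ball (20 * δ)) +_) (*-zeroʳ (length F * length F))) (+-identityʳ _) ⟩
          card (Ball (20 * δ)) ≤⟨ card-Ball Y≢∅ (20 * δ) (≤-trans (≤-reflexive (sym (*-assoc 2 20 δ))) h40) ⟩
          2 * card Y ≤⟨ hB ⟩
          B * card D ∎)
          where
          open ≤-Reasoning
          sub : ∀ f z → N Y f ≤ v → T (D (z ⊖ f)) → N Y z ≤ 20 * δ
          sub f z b p = ≤-trans (≤-reflexive (cong (N Y) (sym (⊖-cancel z f)))) (≤-trans (N-⊕ Y (z ⊖ f) f)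
                          (lin _ _ 0 (hD _ p ⊹ b ⊹ v≤) (eq (N Y (z ⊖ f)) (N Y f) v δ)))
            where
            eq : ∀ a b v δ → a + b + (δ + v + 19 * δ) + 0 ≡ 20 * δ + (a + b + v)
            eq = solve-∀
          meet : ∀ f g z → T (D (z ⊖ f) ∧ D (z ⊖ g)) → N Y (f ⊖ g) ≤ 2 * δ
          meet f g z p = ≤-trans (≤-reflexive (cong (N Y) (solveG (f ∷ g ∷ z ∷ []) (:x :- :y)
                           ((:z :- :y) :- (:z :- :x)) refl)))
                         (≤-trans (N-⊖ Y (z ⊖ g) (z ⊖ f)) (≤-trans (+-mono-≤ (hD _ (∧-snd {D (z ⊖ f)} p)) (hD _ (∧-fst p))) (≤-reflexive (cong (δ +_) (sym (+-identityʳ δ))))))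

      module Nets (F₀ : List (Fin n)) (F₀⊆ : All (λ x → T (Ball (18 * δ) x)) F₀) (F₀≤ : length F₀ ≤ B)
                  (cover₀ : ∀ x → T (Ball (18 * δ) x) → ∃ λ i → T (close x (lookup F₀ i)))
                  (F₁ : List (Fin n)) (F₁≤ : length F₁ ≤ B) (cover₁ : ∀ x → T (Ball (19 * δ) x) → ∃ λ i → T (close x (lookup F₁ i))) where
        abstract
          2je≤δ : ∀ {j} → j ≤ J → 2 * (j * (2 * e)) ≤ δ
          2je≤δ {j} j≤ = ≤-trans (≤-reflexive (eq j e)) (≤-trans (*-monoˡ-≤ e (*-monoʳ-≤ 4 j≤)) hJ)
            where
            eq : ∀ j e → 2 * (j * (2 * e)) ≡ 4 * j * e
            eq = solve-∀

          je≤δ : ∀ {j} → j ≤ J → j * (2 * e) ≤ δ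
          je≤δ j≤ = ≤-trans (m≤m+n _ _) (2je≤δ j≤)

          orbit : ∀ {j} → j ≤ J → ∀ x → N Y x ≤ 18 * δ → T (Ball (19 * δ) (2 ^ j · x))
          orbit {j} j≤ x b = Ball-in (≤-trans (N-2^ j x) (≤-trans (+-mono-≤ b (je≤δ j≤)) (≤-reflexive (+-comm (18 * δ) δ))))

          -- Orbits starting in the ball of radius 18δ drift by at most δ during J doublings, which
          -- is why the second net belongs to the ball of radius 19δ.
          codes : ∀ (j : Fin (suc J)) (a : Fin (length F₀)) → ∃ λ i → T (close (2 ^ toℕ j · lookup F₀ a) (lookup F₁ i))
          codes j a = cover₁ _ (orbit (toℕ≤pred[n] j) (lookup F₀ a) (Ball-out (All.lookup F₀⊆ (∈-lookup {xs = F₀} a))))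

          few : length F₁ ^ length F₀ < suc J
          few = s≤s (≤-trans (^-monoˡ-≤ (length F₀) F₁≤) (^-monoʳ-≤ B {{>-nonZero B>0}} F₀≤))

          clash : ∃₂ λ i j → toℕ i < toℕ j × (∀ a → proj₁ (codes i a) ≡ proj₁ (codes j a))
          clash = function-clash few (λ j a → proj₁ (codes j a))

        module Return (i d : ℕ) (1≤d : 1 ≤ d) (i≤J : i ≤ J) (d≤J : d ≤ J)
                      (returns : ∀ a → ∃ λ g → N Y (2 ^ i · lookup F₀ a ⊖ g) ≤ 2 * δ × N Y (2 ^ (i + d) · lookup F₀ a ⊖ g) ≤ 2 * δ) where
          m : ℕ
          m = 2 ^ d ∸ 1

          abstract
            m·≡ : ∀ x → m · x ≡ 2 ^ d · x ⊖ x
            m·≡ x = trans (·-∸ x (m^n>0 2 d)) (cong (λ t → 2 ^ d · x ⊖ t) (·-1 x))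

            -- Both 2^i f and 2^(i+d) f are within 2δ of one point g, so 2^i (2^d - 1) f has norm at
            -- most 4δ. Halving i times removes the factor 2^i at a cost of at most J · 2e.
            near-fixed : ∀ a → N Y (m · lookup F₀ a) ≤ 4 * δ + J * (2 * e)
            near-fixed a with returns a
            ... | g , p , q = ≤-trans (N-2^⁻¹ i (m · f)) (+-mono-≤ (≤-trans (≤-reflexive (cong (N Y) shape)) (≤-trans (N-⊖ Y _ _) (≤-trans (+-mono-≤ q p) (≤-reflexive (eq δ))))) (*-monoˡ-≤ (2 * e) i≤J))
              where
              f : Fin n
              f = lookup F₀ a
              eq : ∀ δ → 2 * δ + 2 * δ ≡ 4 * δ
              eq = solve-∀
              pow : 2 ^ i · (2 ^ d · f) ≡ 2 ^ (i + d) · f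
              pow = trans (·-assoc f (2 ^ i) (2 ^ d)) (cong (_· f) (sym (^-distribˡ-+-* 2 i d)))
              shape : 2 ^ i · (m · f) ≡ (2 ^ (i + d) · f ⊖ g) ⊖ (2 ^ i · f ⊖ g)
              shape = trans (cong (2 ^ i ·_) (m·≡ f)) (trans (·-⊖ (2 ^ i) _ _) (trans (cong (_⊖ 2 ^ i · f) pow)
                        (solveG (2 ^ (i + d) · f ∷ 2 ^ i · f ∷ g ∷ []) (:x :- :y) ((:x :- :z) :- (:y :- :z)) refl)))

            -- Split x as f + r with f in the net and r of norm at most 2δ. Then m f and m r = 2^d r
            -- - r contribute 4δ each, and the doubling errors together at most δ.
            contract : ∀ x → T (Ball (18 * δ) x) → T (Ball (9 * δ) (m · x))
            contract x b with cover₀ x b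
            ... | a , c = Ball-in (≤-trans (≤-reflexive (cong (N Y) (trans (cong (m ·_) (sym (trans (⊕-comm f (x ⊖ f)) (⊖-cancel x f)))) (·-distrib f (x ⊖ f) m))))
                (≤-trans (N-⊕ Y (m · f) (m · r)) (≤-trans (+-mono-≤ (near-fixed a) (≤-trans (≤-reflexive (cong (N Y) (m·≡ r))) (N-⊖ Y (2 ^ d · r) r)))
                  (lin _ _ 0 (N-2^ d r ⊹ *-monoˡ-≤ (2 * e) d≤J ⊹ 2 ⊛ Ball-out c ⊹ 2je≤δ ≤-refl) (eq (N Y (2 ^ d · r)) (N Y r) (J * (2 * e)) (d * (2 * e)) δ)))))
              where
              f r : Fin n
              f = lookup F₀ a
              r = x ⊖ f
              eq : ∀ a b J d δ → 4 * δ + J + (a + b) + (b + d + J + 2 * (2 * δ) + δ) + 0 ≡ 9 * δ + (a + d + 2 * b + 2 * J)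
              eq = solve-∀

            result : ∃ λ m → 1 ≤ m × m ≤ 2 ^ J × (∀ x → T (Ball (18 * δ) x) → T (Ball (9 * δ) (m · x)))
            result = m , ∸-monoˡ-≤ 1 (^-monoʳ-≤ 2 1≤d) , ≤-trans (m∸n≤m (2 ^ d) 1) (^-monoʳ-≤ 2 d≤J) , contract

        abstract
          contracting : ∃ λ m → 1 ≤ m × m ≤ 2 ^ J × (∀ x → T (Ball (18 * δ) x) → T (Ball (9 * δ) (m · x)))
          contracting = from clash
            where
            from : (∃₂ λ i j → toℕ i < toℕ j × (∀ a → proj₁ (codes i a) ≡ proj₁ (codes j a))) →
                   ∃ λ m → 1 ≤ m × m ≤ 2 ^ J × (∀ x → T (Ball (18 * δ) x) → T (Ball (9 * δ) (m · x)))
            from (i , j , i<j , same) = Return.result (toℕ i) (toℕ j ∸ toℕ i) (m<n⇒0<n∸m i<j) (toℕ≤pred[n] i) (≤-trans (m∸n≤m (toℕ j) (toℕ i)) (toℕ≤pred[n] j)) ret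
              where
              ret : ∀ a → ∃ λ g → N Y (2 ^ toℕ i · lookup F₀ a ⊖ g) ≤ 2 * δ × N Y (2 ^ (toℕ i + (toℕ j ∸ toℕ i)) · lookup F₀ a ⊖ g) ≤ 2 * δ
              ret a = lookup F₁ (proj₁ (codes i a)) , Ball-out (proj₂ (codes i a)) ,
                subst (λ j′ → N Y (2 ^ j′ · lookup F₀ a ⊖ lookup F₁ (proj₁ (codes i a))) ≤ 2 * δ) (sym (m+[n∸m]≡n (<⇒≤ i<j)))
                  (subst (λ g → N Y (2 ^ toℕ j · lookup F₀ a ⊖ lookup F₁ g) ≤ 2 * δ) (sym (same a)) (Ball-out (proj₂ (codes j a))))

      abstract
        contracting : ∃ λ m → 1 ≤ m × m ≤ 2 ^ J × (∀ x → T (Ball (18 * δ) x) → T (Ball (9 * δ) (m · x)))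
        contracting =
          let F₀ , p , q , r = Net.net (Ball (18 * δ)) close B (separated (18 * δ) (*-monoˡ-≤ δ {18} {19} (n≤1+n 18)))
              F₁ , _ , s , t = Net.net (Ball (19 * δ)) close B (separated (19 * δ) ≤-refl)
          in Nets.contracting F₀ p q r F₁ s t

      H : PSet n
      H = Ball (18 * δ)

      abstract
        -- Multiplication by 2^d - 1 maps Ball (18δ) injectively into the smaller Ball (9δ), so the two balls are equal.
        H-small : ∀ x → T (H x) → N Y x ≤ 9 * δ
        H-small x h =
          let m , 1≤m , m≤ , contract = contracting
              u , inv = tf m 1≤m m≤
          in Ball-out (⊆-from-card {S = Ball (9 * δ)} {R = H} (λ y b → Ball-in (≤-trans (Ball-out b) (*-monoˡ-≤ δ (m≤m+n 9 9))))
               (card-bij (m ·_) (u ·_) (λ y → trans (·-comm m u y) (inv y)) inv contract) x h)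

        H-sub : IsSub H
        H-sub = record
          { 0∈ = Ball-in (N-zero Y _)
          ; +∈ = λ {x} {y} p q → Ball-in (≤-trans (N-⊕ Y x y) (≤-trans (+-mono-≤ (H-small x p) (H-small y q)) (≤-reflexive (eq δ))))
          ; -∈ = λ {x} p → Ball-in (≤-trans (N-neg Y x) (Ball-out p))
          }
          where
          eq : ∀ δ → 9 * δ + 9 * δ ≡ 18 * δ
          eq = solve-∀

        D⊆H : ∀ x → T (D x) → T (H x)
        D⊆H x p = Ball-in (≤-trans (hD x p) (m≤m+n δ _))

    module CosetPart (H : PSet n) (Hsub : IsSub H) (ν P : ℕ) (hν : ∀ h → T (H h) → N Y h ≤ ν) (4ν≤ : 4 * ν ≤ card Y)
                     (Y≢∅ : 0 < card Y) (hP : 2 * card Y ≤ P * card H) (hPe : 4 * (P * e) ≤ card H) (tf : TorsionFreeUpTo (2 ^ P)) where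
      open IsSub Hsub

      gap : Fin n → ℕ
      gap y = card (λ h → H h ∧ not (Y (y ⊕ h)))

      abstract
        -- For each h in `H`, at most ν points of `Y` are moved out of `Y` by h; summing over h and
        -- averaging over `Y` gives a point whose coset is almost inside `Y`.
        good : ∃ λ y → T (Y y) × card Y * gap y ≤ ν * card H
        good = exists-below-average (ν * card H) Y≢∅ (begin
          sumOver Y gap ≡⟨ sumOver-swap Y H (λ y h → not (Y (y ⊕ h))) ⟩
          sumOver H (λ h → card (λ y → Y y ∧ not (Y (y ⊕ h)))) ≤⟨ sumOver-≤ {S = H} (λ h p → ≤-trans (escape≤N Y h) (hν h p)) ⟩
          ν * card H ∎)
          where open ≤-Reasoning

      module At (y : Fin n) (y-good : card Y * gap y ≤ ν * card H) where
        abstract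
          0<H : 0 < card H
          0<H = element⇒card>0 𝟘 0∈

          4gap≤ : 4 * gap y ≤ card H
          4gap≤ = *-cancelˡ-≤ (card Y) {{>-nonZero Y≢∅}} (begin
            card Y * (4 * gap y) ≡⟨ eq (card Y) (gap y) ⟩
            4 * (card Y * gap y) ≤⟨ *-monoʳ-≤ 4 y-good ⟩
            4 * (ν * card H) ≡⟨ sym (*-assoc 4 ν (card H)) ⟩
            4 * ν * card H ≤⟨ *-monoˡ-≤ (card H) 4ν≤ ⟩
            card Y * card H ∎)
            where
            open ≤-Reasoning
            eq : ∀ a b → a * (4 * b) ≡ 4 * (a * b)
            eq = solve-∀

          -- Doubling maps `x + H` onto `2 · x + H`, as `H` is closed under halving, and at most `e`
          -- points of `Y` have their double outside `Y`.
          gap-2· : ∀ x → gap (2 · x) ≤ gap x + e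
          gap-2· x = ≤-trans (card-half {R = λ h → H h ∧ not (Y (2 · x ⊕ 2 · h))} (λ h p → ∧-intro (·∈ (proj₁ inv2) (∧-fst p)) (subst (λ t → T (not (Y (2 · x ⊕ t)))) (sym (2·-half h)) (∧-snd {H h} p))))
            (≤-trans (card-cover {R = λ h → H h ∧ not (Y (x ⊕ h))} {Q = λ h → Y (x ⊕ h) ∧ not (Y (2 · x ⊕ 2 · h))} go)
              (+-monoʳ-≤ (gap x) (≤-trans (card-shift x {R = λ z → Y z ∧ not (Y (2 · z))} (λ h p → subst (λ t → T (Y t ∧ not (Y (2 · (h ⊕ x))))) (⊕-comm x h) (subst (λ t → T (Y (x ⊕ h) ∧ not (Y t))) (dist h) p)))
                (card-double (λ z p → subst (λ t → T (Y t ∧ not (Y (2 · z)))) (sym (half-2· z)) p)))))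
            where
            dist : ∀ h → 2 · x ⊕ 2 · h ≡ 2 · (h ⊕ x)
            dist h = solveG (x ∷ h ∷ []) (2 :* :x :+ 2 :* :y) (2 :* (:y :+ :x)) refl
            go : ∀ h → T (H h ∧ not (Y (2 · x ⊕ 2 · h))) → T (H h ∧ not (Y (x ⊕ h))) ⊎ T (Y (x ⊕ h) ∧ not (Y (2 · x ⊕ 2 · h)))
            go h p with T? (Y (x ⊕ h))
            ... | yes q = inj₂ (∧-intro q (∧-snd {H h} p))
            ... | no ¬q = inj₁ (∧-intro (∧-fst p) (not-intro ¬q))

          gap-2^ : ∀ j → gap (2 ^ j · y) ≤ gap y + j * e
          gap-2^ zero = ≤-reflexive (trans (cong gap (·-1 y)) (sym (+-identityʳ _)))
          gap-2^ (suc j) = ≤-trans (≤-reflexive (cong gap (2^suc j y))) (≤-trans (gap-2· (2 ^ j · y)) (lin _ _ 0 (gap-2^ j) (eq (gap (2 ^ j · y)) (gap y) j e)))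
            where
            eq : ∀ a b j e → a + e + (b + j * e) + 0 ≡ b + suc j * e + a
            eq = solve-∀

        Piece : ℕ → PSet n
        Piece j z = Y z ∧ H (z ⊖ 2 ^ j · y)

        s : ℕ
        s = card H ∸ (gap y + P * e)

        abstract
          2s≥ : card H ≤ 2 * s
          2s≥ = *-cancelˡ-≤ 2 (lin _ _ 0 (4 ⊛ m≤n+m∸n (card H) (gap y + P * e) ⊹ hPe ⊹ 4gap≤) (eq (card H) (gap y) (P * e) s))
            where
            eq : ∀ h g p s → 2 * h + (4 * (g + p + s) + h + h) + 0 ≡ 2 * (2 * s) + (4 * h + 4 * p + 4 * g)
            eq = solve-∀

          piece-big : ∀ {j} → j < suc P → s ≤ card (Piece j)
          piece-big {j} (s≤s j≤) = m≤n+o⇒m∸n≤o (card H) (gap y + P * e) (≤-trans (card-split H (λ h → Y (2 ^ j · y ⊕ h))) (≤-trans (≤-reflexive (+-comm (card (H ∩ (λ h → Y (2 ^ j · y ⊕ h)))) (card (H ∖ (λ h → Y (2 ^ j · y ⊕ h))))))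
            (+-mono-≤ (≤-trans (gap-2^ j) (+-monoʳ-≤ (gap y) (*-monoˡ-≤ e j≤)))
              (card-shift (2 ^ j · y) (λ h p → ∧-intro (transport Y (⊕-comm _ h) (∧-snd {H h} p)) (transport H (sym (⊕-⊖ h _)) (∧-fst p)))))))

          -- The P + 1 pieces have at least |H| / 2 points each, too many to be disjoint in `Y`, as
          -- 2|Y| ≤ P|H|.
          collision : ∃₂ λ i j → (j < i × i < suc P) × ¬ (card (Piece i ∩ Piece j) ≤ 0)
          collision with pair-search {Q = λ i j → j < i × i < suc P} {R = λ i j → card (Piece i ∩ Piece j) ≤ 0} (λ i j → card (Piece i ∩ Piece j) ≤? 0) (downFrom (suc P)) (AllPairsP.applyDownFrom⁺₁ id (suc P) (λ a b → a , b))
          ... | inj₂ w = w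
          ... | inj₁ ps = ⊥-elim (<⇒≱ contra (nearly-disjoint Y Piece s 0 (downFrom (suc P)) (AllP.applyDownFrom⁺₁ id (suc P) piece-big) (All.universal (λ j z → ∧-fst) _) ps))
            where
            contra : card Y + length (downFrom (suc P)) * length (downFrom (suc P)) * 0 < length (downFrom (suc P)) * s
            contra = subst₂ _<_ (sym (trans (cong (card Y +_) (*-zeroʳ (length (downFrom (suc P)) * length (downFrom (suc P))))) (+-identityʳ (card Y)))) (cong (_* s) (sym (length-downFrom (suc P)))) (*-cancelˡ-< 2 _ _ (begin-strict
              2 * card Y ≤⟨ hP ⟩
              P * card H <⟨ m<n+m (P * card H) 0<H ⟩
              suc P * card H ≤⟨ *-monoʳ-≤ (suc P) 2s≥ ⟩
              suc P * (2 * s) ≡⟨ eq (suc P) s ⟩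
              2 * (suc P * s) ∎))
              where
              open ≤-Reasoning
              eq : ∀ a b → a * (2 * b) ≡ 2 * (a * b)
              eq = solve-∀

          y∈H : T (H y)
          y∈H with collision
          ... | i , j , (j<i , s≤s i≤P) , ne with someElement (≰⇒> ne)
          ... | z , p = transport H (proj₂ inv y) (·∈ (proj₁ inv) (transport H (sym (·-∸ y (<⇒≤ lt)))
                (transport H (solveG (z ∷ 2 ^ i · y ∷ 2 ^ j · y ∷ []) ((:x :- :z) :- (:x :- :y)) (:y :- :z) refl)
                  (⊖∈ (∧-snd {Y z} (∧-snd {Piece i z} p)) (∧-snd {Y z} (∧-fst {Piece i z} p))))))
            where
            lt : 2 ^ j < 2 ^ i
            lt = ^-monoʳ-< 2 (s≤s (s≤s z≤n)) j<i
            inv : Invertible (2 ^ i ∸ 2 ^ j)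
            inv = tf (2 ^ i ∸ 2 ^ j) (m<n⇒0<n∸m lt) (≤-trans (m∸n≤m (2 ^ i) (2 ^ j)) (^-monoʳ-≤ 2 i≤P))

          H∖Y-small : card Y * card (H ∖ Y) ≤ ν * card H
          H∖Y-small = ≤-trans (*-monoʳ-≤ (card Y) (card-unshift y (λ h p → ∧-intro (⊖∈ (∧-fst p) y∈H)
             (subst (λ t → T (not (Y t))) (trans (sym (⊖-cancel h y)) (⊕-comm (h ⊖ y) y)) (∧-snd {H h} p))))) y-good

      abstract
        H∖Y-small : card Y * card (H ∖ Y) ≤ ν * card H
        H∖Y-small = At.H∖Y-small (proj₁ good) (proj₂ (proj₂ good))

  recurrence : ℕ → ℕ
  recurrence c = (4 * c) ^ (4 * c)

  -- The first term keeps the doubling errors of the recurrence below the radius a / M. The second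
  -- gives `4 * (P * e)` ≤ |H| for P = 4c, since |H| ≥ a / c.
  stability : ℕ → ℕ → ℕ
  stability M c = 4 * recurrence c * M + 16 * c * c

  module Extraction {n : ℕ} (G : FinAbGroup n) where
    open Grp G
    open Subgroups G

    TF-mono : ∀ {M M'} → M ≤ M' → TorsionFreeUpTo M' → TorsionFreeUpTo M
    TF-mono h tf m p q = tf m p (≤-trans q h)

    -- The radius is δ = a / M. From 2|Y| ≤ 4a ≤ 4c|D| the nets have at most 4c points. The subgroup
    -- contains `D`, which bounds its size from below.
    extract : (inv2 : Invertible 2) → let open Halving G inv2 in (K c M a : ℕ) → 1 ≤ K → 1 ≤ c → 40 * K ≤ M → TorsionFreeUpTo (2 ^ recurrence c) →
              (Y D : PSet n) → 0 < a → card Y ≤ 2 * a → a ≤ K * card Y → a ≤ c * card D → (∀ t → T (D t) → M * N Y t ≤ a) →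
              stability M c * card (dil Y ∖ Y) ≤ a →
              ∃ λ H → IsSub H × a ≤ c * card H × M * card (H ∖ Y) ≤ 9 * K * card H
    extract inv2 K c M a 1≤K 1≤c 40K≤M tf Y D 0<a Y≤ ≤Y ≤D hD hL =
      Gr.H , Gr.H-sub , a≤cH , *-cancelˡ-≤ (card Y) (begin
        card Y * (M * card (Gr.H ∖ Y)) ≡⟨ eq₁ (card Y) M (card (Gr.H ∖ Y)) ⟩
        M * (card Y * card (Gr.H ∖ Y)) ≤⟨ M ⊛ CP.H∖Y-small ⟩
        M * (9 * δ * card Gr.H) ≡⟨ eq₂ M δ (card Gr.H) ⟩
        9 * (M * δ) * card Gr.H ≤⟨ *-monoˡ-≤ (card Gr.H) (9 ⊛ ≤-trans Mδ≤a ≤Y) ⟩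
        9 * (K * card Y) * card Gr.H ≡⟨ eq₃ K (card Y) (card Gr.H) ⟩
        card Y * (9 * K * card Gr.H) ∎)
      where
      open ≤-Reasoning
      eq₁ : ∀ a b c → a * (b * c) ≡ b * (a * c)
      eq₁ = solve-∀
      eq₂ : ∀ a b c → a * (9 * b * c) ≡ 9 * (a * b) * c
      eq₂ = solve-∀
      eq₃ : ∀ k y h → 9 * (k * y) * h ≡ y * (9 * k * h)
      eq₃ = solve-∀
      module E = Extract G inv2 Y
      0<Y : 0 < card Y
      0<Y = pos-factorʳ K (≤-trans 0<a ≤Y)
      0<D : 0 < card D
      0<D = pos-factorʳ c (≤-trans 0<a ≤D)
      instance
        nzY : NonZero (card Y)
        nzY = >-nonZero 0<Y
        nzK : NonZero K
        nzK = >-nonZero 1≤K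
        nzM : NonZero M
        nzM = >-nonZero (≤-trans (≤-trans 1≤K (m≤m+n K _)) 40K≤M)
      δ : ℕ
      δ = a / M
      Mδ≤a : M * δ ≤ a
      Mδ≤a = */≤ M a
      40δ≤Y : 40 * δ ≤ card Y
      40δ≤Y = *-cancelˡ-≤ K (begin
        K * (40 * δ) ≡⟨ eq K δ ⟩
        40 * K * δ ≤⟨ *-monoˡ-≤ δ 40K≤M ⟩
        M * δ ≤⟨ Mδ≤a ⟩
        a ≤⟨ ≤Y ⟩
        K * card Y ∎)
        where
        eq : ∀ K δ → K * (40 * δ) ≡ 40 * K * δ
        eq = solve-∀
      4≤ : ∀ {x} → 1 ≤ x → 1 ≤ 4 * x
      4≤ {x} h = ≤-trans h (m≤m+n x _)
      P≤J : 4 * c ≤ recurrence c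
      P≤J = ≤-trans (≤-reflexive (sym (^-identityʳ (4 * c)))) (^-monoʳ-≤ (4 * c) {{>-nonZero (4≤ 1≤c)}} (4≤ 1≤c))
      dense : ∀ {x} → a ≤ c * x → 2 * card Y ≤ 4 * c * x
      dense {x} h = lin _ _ 0 (2 ⊛ Y≤ ⊹ 4 ⊛ h) (eq (card Y) a c x)
        where
        eq : ∀ y a c x → 2 * y + (2 * (2 * a) + 4 * (c * x)) + 0 ≡ 4 * c * x + (2 * y + 4 * a)
        eq = solve-∀
      eq₄ : ∀ M J c e a → M * (4 * J * e) + a + 16 * c * c * e ≡ a + (4 * J * M + 16 * c * c) * e
      eq₄ = solve-∀
      eq₅ : ∀ c e J M a h → c * (4 * (4 * c * e)) + (a + c * h) + 4 * J * M * e ≡ c * h + ((4 * J * M + 16 * c * c) * e + a)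
      eq₅ = solve-∀
      module Gr = E.GroupPart δ (4 * c) D (λ t p → ≤/ M (hD t p)) 0<Y 40δ≤Y (dense ≤D) 0<D (4≤ 1≤c)
                    (≤/ M (≤-trans (lin _ _ (16 * c * c * E.e) hL (eq₄ M (recurrence c) c E.e a)) ≤-refl)) tf
      a≤cH : a ≤ c * card Gr.H
      a≤cH = ≤-trans ≤D (c ⊛ card-mono Gr.D⊆H)
      module CP = E.CosetPart Gr.H Gr.H-sub (9 * δ) (4 * c) Gr.H-small (≤-trans (≤-trans (≤-reflexive (sym (*-assoc 4 9 δ))) (*-monoˡ-≤ δ (m≤m+n 36 4))) 40δ≤Y) 0<Y (dense a≤cH)
                    (*-cancelˡ-≤ c {{>-nonZero 1≤c}} (lin _ _ (4 * recurrence c * M * E.e) (hL ⊹ a≤cH) (eq₅ c E.e (recurrence c) M a (card Gr.H))))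
                    (TF-mono (^-monoʳ-≤ 2 P≤J) tf)

  -- Density of the cube and size of its shifts after k steps of Doubling.Cube.extend, each of which squares the density ρ.
  cubeDensity : ℕ → ℕ → ℕ
  cubeDensity zero ρ = ρ
  cubeDensity (suc k) ρ = cubeDensity k (64 * ρ * ρ)

  cubeSize : ℕ → ℕ → ℕ → ℕ
  cubeSize zero ρ s = s
  cubeSize (suc k) ρ s = cubeSize k (64 * ρ * ρ) (suc (8 * ρ * s))

  cubePeriod : ℕ → ℕ → ℕ → ℕ
  cubePeriod zero ρ s = 0
  cubePeriod (suc k) ρ s = 2 * ρ * (8 * ρ * s) + cubePeriod k (64 * ρ * ρ) (suc (8 * ρ * s))

  -- Doubling

  module Doubling {n : ℕ} (G : FinAbGroup n) where
    open Grp G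

    Apart : PSet n → Fin n → Fin n → Set
    Apart A x y = x ≢ y × ¬ T (A (x ⊕ y))

    Bounded : PSet n → PSet n → ℕ → Set
    Bounded S A k = ∀ xs → All (λ x → T (S x)) xs → AllPairs (Apart A) xs → length xs < k

    module Cube (a : ℕ) (V E : PSet n) (E⊆V : ∀ x → T (E x) → T (V x)) (V≤ : card V ≤ 2 * a) (d : Fin n) where

      -- Of a Hilbert cube with sides `i · d`, only the vertices that use at most two sides matter
      -- here: their doubles will be the pairwise sums of the independent elements.
      record IsCube (ns : List ℕ) (C : PSet n) : Set where
        field
          C⊆E : ∀ x → T (C x) → T (E x)
          singles : ∀ x → T (C x) → All (λ i → T (E (x ⊕ i · d))) ns
          pairs : ∀ x → T (C x) → AllPairs (λ i j → T (E (x ⊕ i · d ⊕ j · d))) ns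

      -- Hilbert's cube lemma in direction d.
      extend : ∀ k ρ s ns C → 1 ≤ s → IsCube ns C → AllPairs _>_ ns → All (_< s) ns → a < ρ * card C → cubePeriod k ρ s * N V d ≤ a →
               ∃₂ λ ns' C' → IsCube ns' C' × AllPairs _>_ ns' × All (_< cubeSize k ρ s) ns' × a < cubeDensity k ρ * card C' × length ns' ≡ k + length ns
      extend zero ρ s ns C 1≤s cube dec small dense per = ns , C , cube , dec , small , dense , refl
      extend (suc k) ρ s ns C 1≤s cube dec small dense per
        -- The 8ρ translates of `C` by multiples of `s · d` nearly lie in `V`, and `V` is too small
        -- to hold them unless two overlap in more than a / (64ρ^2) points.
        with pair-search {Q = λ i j → j < i × i < q} {R = λ i j → 64 * ρ * ρ * card (S i ∩ S j) ≤ a} (λ i j → 64 * ρ * ρ * card (S i ∩ S j) ≤? a)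
               (downFrom q) (AllPairsP.applyDownFrom⁺₁ id q (λ x y → x , y))
        where
        q = 8 * ρ
        S : ℕ → PSet n
        S i z = C (z ⊖ (i * s) · d) ∧ V z
      ... | inj₁ ps = ⊥-elim (m+1+n≰m (7 * a) {7} impossible)
        where
        open ≤-Reasoning
        q = 8 * ρ
        S : ℕ → PSet n
        S i z = C (z ⊖ (i * s) · d) ∧ V z
        ρ>0 : 0 < ρ
        ρ>0 = pos-factorˡ (card C) (≤-trans (s≤s z≤n) dense)
        instance
          nz : NonZero (64 * ρ * ρ)
          nz = >-nonZero (≤-trans ρ>0 (≤-trans (m≤m*n ρ (64 * ρ) {{>-nonZero (≤-trans ρ>0 (m≤m+n ρ _))}}) (≤-reflexive (*-comm ρ (64 * ρ)))))
        loss σ δ : ℕ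
        loss = q * s * N V d
        σ = card C ∸ loss
        δ = a / (64 * ρ * ρ)
        big : ∀ {i} → i < q → σ ≤ card (S i)
        big {i} i<q = m≤n+o⇒m∸n≤o (card C) loss (≤-trans (card-shift t {R = λ z → C (z ⊖ t)} (λ x p → transport C (sym (⊕-⊖ x t)) p))
           (≤-trans (card-cover {R = λ z → V (z ⊖ t) ∧ not (V z)} {Q = S i} go) (+-monoˡ-≤ (card (S i)) (≤-trans (≤-reflexive (sym (N-def V t))) (≤-trans (N-· V (i * s) d) (*-monoˡ-≤ (N V d) (*-monoˡ-≤ s (<⇒≤ i<q))))))))
          where
          t = (i * s) · d
          go : ∀ z → T (C (z ⊖ t)) → T (V (z ⊖ t) ∧ not (V z)) ⊎ T (S i z)
          go z p with T? (V z)
          ... | yes v = inj₂ (∧-intro p v)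
          ... | no ¬v = inj₁ (∧-intro (E⊆V _ (IsCube.C⊆E cube _ p)) (not-intro ¬v))
        total : q * σ ≤ card V + q * q * δ
        total = subst (λ l → l * σ ≤ card V + l * l * δ) (length-downFrom q)
          (nearly-disjoint V S σ δ (downFrom q) (AllP.applyDownFrom⁺₁ id q big) (All.universal (λ i z p → ∧-snd {C (z ⊖ (i * s) · d)} p) _)
            (AllPairs.map (λ h → ≤/ (64 * ρ * ρ) h) ps))
        -- The 8ρ copies have more than 8a points and lose at most 4a on leaving `V`, but `V` has at
        -- most 2a points and the overlaps account for at most a.
        impossible : 7 * a + 8 ≤ 7 * a
        impossible = lin _ _ a (8 ⊛ dense ⊹ (8 * ρ) ⊛ m≤n+m∸n (card C) loss ⊹ 4 ⊛ ≤-trans (*-monoˡ-≤ (N V d) (m≤m+n (2 * ρ * (8 * ρ * s)) _)) per ⊹ total ⊹ V≤ ⊹ */≤ (64 * ρ * ρ) a)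
           (eq a ρ (card C) σ s (N V d) (card V) δ)
          where
          eq : ∀ a ρ c σ s N v δ → 7 * a + 8 + (8 * (ρ * c) + 8 * ρ * (8 * ρ * s * N + σ) + 4 * a + (v + 8 * ρ * (8 * ρ) * δ) + 2 * a + a) + a
               ≡ 7 * a + (8 * suc a + 8 * ρ * c + 4 * (2 * ρ * (8 * ρ * s) * N) + 8 * ρ * σ + v + 64 * ρ * ρ * δ)
          eq = solve-∀
      ... | inj₂ (i , j , (j<i , i<q) , big) =
        extend k (64 * ρ * ρ) (suc (8 * ρ * s)) (m ∷ ns) C' (s≤s z≤n)
           (record { C⊆E = λ x p → IsCube.C⊆E cube x (∧-fst p)
                   ; singles = λ x p → IsCube.C⊆E cube _ (∧-snd {C x} p) ∷ IsCube.singles cube x (∧-fst p)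
                   ; pairs = λ x p → IsCube.singles cube _ (∧-snd {C x} p) ∷ IsCube.pairs cube x (∧-fst p) })
           (All.map (λ lt → ≤-trans lt s≤m) small ∷ dec)
           (s≤s (*-monoˡ-≤ s (≤-trans (m∸n≤m i j) (<⇒≤ i<q))) ∷ All.map (λ lt → ≤-trans lt (≤-trans s≤m (≤-trans (*-monoˡ-≤ s (≤-trans (m∸n≤m i j) (<⇒≤ i<q))) (n≤1+n _)))) small)
           (≤-trans (≰⇒> big) (*-monoʳ-≤ (64 * ρ * ρ) (card-unshift ((i * s) · d) λ z p → ∧-intro (∧-fst (∧-fst p)) (transport C (shift z) (∧-fst (∧-snd {C (z ⊖ (i * s) · d) ∧ V z} p))))))
           (≤-trans (*-monoˡ-≤ (N V d) (m≤n+m _ (2 * ρ * (8 * ρ * s)))) per)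
           |> λ { (ns' , C' , c , u , v , w , len) → ns' , C' , c , u , v , w , trans len (+-suc k (length ns)) }
        where
        -- The difference of two overlapping translates is the new side. All earlier indices are
        -- below the spacing `s`, so the new one is larger than each of them.
        m = (i ∸ j) * s
        C' : PSet n
        C' y = C y ∧ C (y ⊕ m · d)
        s≤m : s ≤ m
        s≤m = ≤-trans (≤-reflexive (sym (*-identityˡ s))) (*-monoˡ-≤ s (m<n⇒0<n∸m j<i))
        shift : ∀ z → z ⊖ (j * s) · d ≡ z ⊖ (i * s) · d ⊕ m · d
        shift z = trans (solveG (z ∷ (j * s) · d ∷ (i * s) · d ∷ []) (:x :- :y) (:x :- :z :+ (:z :- :y)) refl)
          (cong (z ⊖ (i * s) · d ⊕_) (sym (trans (cong (_· d) (*-distribʳ-∸ s i j)) (·-∸ d (*-monoˡ-≤ s (<⇒≤ j<i))))))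

  -- The first two make the base points lost at any of the k vertices, by leaving `V` or by landing
  -- in `V ∖ A`, fewer than the base points of the cube. The third keeps the vertices distinct.
  doublePrecision doublePeriod doubleOrder : ℕ → ℕ → ℕ
  doublePrecision k e = 2 * k * cubeDensity k e
  doublePeriod k e = cubePeriod k e 1 + 4 * k * cubeDensity k e * cubeSize k e 1
  doubleOrder k e = 2 * cubeSize k e 1

  module DoublingLemma {n : ℕ} (G : FinAbGroup n) where
    open Grp G
    open Doubling G

    module Vertices (k e a : ℕ) (A V : PSet n) (d : Fin n) (bd : Bounded A A k) (tf : TorsionFreeUpTo (2 + doubleOrder k e)) (d≢0 : d ≢ 𝟘)
                    (hA : doublePrecision k e * card (V ∖ A) ≤ a) (hN : doublePeriod k e * N V d ≤ a) (V≤ : card V ≤ 2 * a) where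
      E : PSet n
      E v = V v ∧ not (A (2 · v))
      open Cube a V E (λ x → ∧-fst) V≤ d
      R S : ℕ
      R = cubeDensity k e
      S = cubeSize k e 1
      vertex : Fin n → ℕ → Fin n
      vertex x i = x ⊕ (2 * i) · d
      Bad : ℕ → PSet n
      Bad i x = V x ∧ not (A (vertex x i))
      loss : ℕ
      loss = 2 * S * N V d + card (V ∖ A)

      abstract
        bad-small : ∀ C → (∀ x → T (C x) → T (V x)) → ∀ {i} → i < S → card (C ∩ Bad i) ≤ loss
        bad-small C C⊆V {i} i<S = ≤-trans (card-cover {R = λ x → V x ∧ not (V (x ⊕ t))} {Q = λ x → V (x ⊕ t) ∧ not (A (x ⊕ t))} go)
          (+-mono-≤ (≤-trans (escape≤N V t) (≤-trans (N-· V (2 * i) d) (*-monoˡ-≤ (N V d) (*-monoʳ-≤ 2 (<⇒≤ i<S)))))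
                    (card-shift t (λ x p → p)))
          where
          t : Fin n
          t = (2 * i) · d
          go : ∀ x → T ((C ∩ Bad i) x) → T (V x ∧ not (V (x ⊕ t))) ⊎ T (V (x ⊕ t) ∧ not (A (x ⊕ t)))
          go x p with T? (V (x ⊕ t))
          ... | yes v = inj₂ (∧-intro v (∧-snd {V x} (∧-snd {C x} p)))
          ... | no ¬v = inj₁ (∧-intro (∧-fst (∧-snd {C x} p)) (not-intro ¬v))

      module Found (ns : List ℕ) (C : PSet n) (isCube : IsCube ns C) (dec : AllPairs _>_ ns) (small : All (_< S) ns)
                   (dense : a < R * card C) (lenns : length ns ≡ k) where
        U : PSet n
        U = ⋃L Bad ns

        abstract
          some : ∃ λ x → T ((C ∖ U) x)
          some = someElement (+-cancelˡ-< (card (C ∩ U)) 0 _ (≤-trans (s≤s (≤-trans (≤-reflexive (+-identityʳ _)) (≤-trans (card-⋃L-∩ C Bad loss ns (All.map (bad-small C (λ x p → ∧-fst (IsCube.C⊆E isCube x p))) small)) (≤-reflexive (cong (_* loss) lenns)))))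
                   (≤-trans kloss< (card-split C U))))
            where
            kloss< : k * loss < card C
            kloss< = *-cancelˡ-< (2 * R) _ _ (lin _ _ (suc (cubePeriod k e 1 * N V d)) (2 ⊛ dense ⊹ hA ⊹ hN) (eq k R S (N V d) (card (V ∖ A)) (card C) (cubePeriod k e 1) a))
              where
              eq : ∀ k R S N v c P a → suc (2 * R * (k * (2 * S * N + v))) + (2 * (R * c) + a + a) + suc (P * N) ≡ 2 * R * c + (2 * suc a + 2 * k * R * v + (P + 4 * k * R * S) * N)
              eq = solve-∀

        module At (x : Fin n) (x∈C : T (C x)) (x∉U : ¬ T (U x)) where
          xs : List (Fin n)
          xs = map (vertex x) ns

          abstract

            len : length xs ≡ k
            len = trans (length-map (vertex x) ns) lenns

            avoid : ∀ is → ¬ T (⋃L Bad is x) → All (λ i → ¬ T (Bad i x)) is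
            avoid [] _ = []
            avoid (i ∷ is) h = (λ b → h (∨-introˡ b)) ∷ avoid is (λ b → h (∨-introʳ {Bad i x} b))

            xs⊆A : All (λ y → T (A y)) xs
            xs⊆A = AllP.map⁺ (All.map (λ {i} → inA {i}) (avoid ns x∉U))
              where
              inA : ∀ {i} → ¬ T (Bad i x) → T (A (vertex x i))
              inA {i} h with T? (A (vertex x i))
              ... | yes p = p
              ... | no ¬p = ⊥-elim (h (∧-intro (∧-fst (IsCube.C⊆E isCube x x∈C)) (not-intro ¬p)))

            2·≤ : ∀ {i} → i < S → 2 * i ≤ 2 + doubleOrder k e
            2·≤ i<S = ≤-trans (*-monoʳ-≤ 2 (<⇒≤ i<S)) (m≤n+m (2 * S) 2)

            -- The reason for even multiples of d in `vertex`: the sum of two vertices is twice a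
            -- point of `E`, hence outside `A`.
            sums : ∀ i j → 2 · (x ⊕ i · d ⊕ j · d) ≡ vertex x i ⊕ vertex x j
            sums i j = trans (solveG (x ∷ i · d ∷ j · d ∷ []) (2 :* (:x :+ :y :+ :z))
                         ((:x :+ 2 :* :y) :+ (:x :+ 2 :* :z)) refl)
                       (cong₂ (λ u v → (x ⊕ u) ⊕ (x ⊕ v)) (·-assoc d 2 i) (·-assoc d 2 j))

            apart : ∀ ns → AllPairs _>_ ns → All (_< S) ns → AllPairs (λ i j → T (E (x ⊕ i · d ⊕ j · d))) ns → AllPairs (λ i j → Apart A (vertex x i) (vertex x j)) ns
            apart [] _ _ _ = []
            apart (i ∷ is) (d₁ ∷ ds) (s₁ ∷ ss) (p ∷ ps) = All.zipWith one (All.zip (d₁ , ss) , p) ∷ apart is ds ss ps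
              where
              one : ∀ {j} → (i > j × j < S) × T (E (x ⊕ i · d ⊕ j · d)) → Apart A (vertex x i) (vertex x j)
              one {j} ((i>j , j<S) , q) =
                (λ eq → <-irrefl (sym (*-cancelˡ-≡ i j 2 (multiples-distinct tf d≢0 (2·≤ s₁) (2·≤ j<S) (GP.∙-cancelˡ x _ _ eq)))) i>j) ,
                (λ m → not-elim (∧-snd {V (x ⊕ i · d ⊕ j · d)} q) (transport A (sym (sums i j)) m))

            xs-apart : AllPairs (Apart A) xs
            xs-apart = AllPairsP.map⁺ (apart ns dec small (IsCube.pairs isCube x x∈C))

            absurd : ⊥
            absurd = <-irrefl len (bd xs xs⊆A xs-apart)

        abstract
          absurd : ⊥
          absurd = At.absurd (proj₁ some) (∧-fst (proj₂ some)) (not-elim (∧-snd {C (proj₁ some)} (proj₂ some)))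

      abstract
        small-exceptions : e * card E ≤ a
        small-exceptions = decidable-stable (e * card E ≤? a) (λ ¬p →
          let ns , C , isCube , dec , small , dense , len = extend k e 1 [] E (s≤s z≤n) (record { C⊆E = λ x p → p ; singles = λ x p → [] ; pairs = λ x p → [] }) [] [] (≰⇒> ¬p)
                (≤-trans (*-monoˡ-≤ (N V d) (m≤m+n (cubePeriod k e 1) _)) hN)
          in Found.absurd ns C isCube dec small dense (trans len (+-identityʳ k)))

    double : ∀ k e a (A V : PSet n) d → Bounded A A k → TorsionFreeUpTo (2 + doubleOrder k e) → d ≢ 𝟘 → card V ≤ 2 * a →
             doublePrecision k e * card (V ∖ A) ≤ a → doublePeriod k e * N V d ≤ a →
             e * card (λ v → V v ∧ not (A (2 · v))) ≤ a
    double k e a A V d bd tf d≢0 V≤ hA hN = Vertices.small-exceptions k e a A V d bd tf d≢0 hA hN V≤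

  -- Enlarging a union of translates of the near-clique

  thin : ℕ → ℕ → ℕ
  thin K ω = ω * (4 * K * ω)

  thin^ : ℕ → ℕ → ℕ → ℕ
  thin^ K zero ω = ω
  thin^ K (suc g) ω = thin^ K g (thin K ω)

  ω≤thin : ∀ {K ω} → 1 ≤ K → 1 ≤ ω → ω ≤ thin K ω
  ω≤thin {K} {ω} 1≤K 1≤ω = m≤m*n ω (4 * K * ω) {{>-nonZero (*-mono-≤ {1} {4 * K} {1} {ω} (≤-trans 1≤K (m≤m+n K _)) 1≤ω)}}

  ω≤thin^ : ∀ {K ω} g → 1 ≤ K → 1 ≤ ω → ω ≤ thin^ K g ω
  ω≤thin^ zero _ _ = ≤-refl
  ω≤thin^ (suc g) 1≤K 1≤ω = ≤-trans (ω≤thin 1≤K 1≤ω) (ω≤thin^ g 1≤K (≤-trans 1≤ω (ω≤thin 1≤K 1≤ω)))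

  module Refinement {n : ℕ} (G : FinAbGroup n) (A X : PSet n) (K e a : ℕ) (A≤ : card A ≤ a) (0<a : 0 < a) (1≤K : 1 ≤ K) (4K≤e : 4 * K ≤ e)
                    (≤X : a ≤ K * card X) (clique : ∀ x → T (X x) → e * card (λ y → X y ∧ not (A (Grp._⊕_ G x y))) ≤ a) where
    open Grp G
    instance
      nz-e : NonZero e
      nz-e = >-nonZero (≤-trans (≤-trans 1≤K (m≤m+n K _)) 4K≤e)

    _+X : Fin n → PSet n
    (b +X) z = X (z ⊖ b)

    U : List (Fin n) → PSet n
    U B = ⋃L _+X B

    -- Each `w` in the dense set `W` moves all of `B` into `X`. So `w + U B` is a union of
    -- translates of `X` by elements `w + b` of `X`, and each of these is almost inside `A` by the
    -- near-clique property.
    record State (ω β : ℕ) (B : List (Fin n)) (W : PSet n) : Set where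
      field
        dense : a ≤ ω * card W
        size : length B ≤ β
        base : 1 ≤ ω
        W⊆X : ∀ w → T (W w) → T (X w)
        inside : ∀ w → T (W w) → All (λ b → T (X (w ⊕ b))) B
        U⊇X : card X ≤ card (U B)

    abstract
      clique/ : ∀ x → T (X x) → card (λ y → X y ∧ not (A (x ⊕ y))) ≤ a / e
      clique/ x p = ≤/ e (clique x p)

      outside : ∀ w B → All (λ b → T (X (w ⊕ b))) B → card ((λ z → U B (z ⊖ w)) ∖ A) ≤ length B * (a / e)
      outside w [] [] = ≤-trans (card-mono {R = λ _ → false} (λ z p → p)) (≤-reflexive card-empty)
      outside w (b ∷ B) (p ∷ ps) = ≤-trans (card-cover {R = λ z → X (z ⊖ w ⊖ b) ∧ not (A z)} {Q = (λ z → U B (z ⊖ w)) ∖ A} go)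
        (+-mono-≤ (≤-trans (card-unshift (w ⊕ b) (λ z q → ∧-intro (transport X (eq₁ z) (∧-fst q)) (subst (λ t → T (not (A t))) (eq₂ z) (∧-snd {X (z ⊖ w ⊖ b)} q)))) (clique/ (w ⊕ b) p))
                  (outside w B ps))
        where
        eq₁ : ∀ z → z ⊖ w ⊖ b ≡ z ⊖ (w ⊕ b)
        eq₁ z = solveG (z ∷ w ∷ b ∷ []) (:x :- :y :- :z) (:x :- (:y :+ :z)) refl
        eq₂ : ∀ z → z ≡ (w ⊕ b) ⊕ (z ⊖ (w ⊕ b))
        eq₂ z = solveG (z ∷ w ∷ b ∷ []) :x ((:y :+ :z) :+ (:x :- (:y :+ :z))) refl
        go : ∀ z → T (((λ z → U (b ∷ B) (z ⊖ w)) ∖ A) z) → T (X (z ⊖ w ⊖ b) ∧ not (A z)) ⊎ T (((λ z → U B (z ⊖ w)) ∖ A) z)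
        go z q with ∨-elim {X (z ⊖ w ⊖ b)} (∧-fst q)
        ... | inj₁ r = inj₁ (∧-intro r (∧-snd {U (b ∷ B) (z ⊖ w)} q))
        ... | inj₂ r = inj₂ (∧-intro r (∧-snd {U (b ∷ B) (z ⊖ w)} q))

      W-nonempty : ∀ {ω β B W} → State ω β B W → ∃ λ w → T (W w)
      W-nonempty {ω} st = someElement (pos-factorʳ ω (≤-trans 0<a (State.dense st)))

      -- A translate `w + U B` has at most a / e points outside `A` for each element of `B`, hence
      -- at most a in all. This is what limits the enlargement of `U B`.
      card-U : ∀ {ω β B W} → β ≤ e → State ω β B W → card (U B) ≤ 2 * a
      card-U {B = B} β≤e st = let w , p = W-nonempty st in begin
        card (U B) ≤⟨ card-shift w (λ z q → subst (λ t → T (U B t)) (sym (⊕-⊖ z w)) q) ⟩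
        card (λ z → U B (z ⊖ w)) ≤⟨ card-split (λ z → U B (z ⊖ w)) A ⟩
        card ((λ z → U B (z ⊖ w)) ∩ A) + card ((λ z → U B (z ⊖ w)) ∖ A)
          ≤⟨ +-mono-≤ (≤-trans (card-mono (λ z q → ∧-snd {U B (z ⊖ w)} q)) A≤) (outside w B (State.inside st w p)) ⟩
        a + length B * (a / e) ≤⟨ +-monoʳ-≤ a (≤-trans (*-monoˡ-≤ (a / e) (≤-trans (State.size st) β≤e)) (*/≤ e a)) ⟩
        a + a ≡⟨ cong (a +_) (sym (+-identityʳ a)) ⟩
        2 * a ∎
        where open ≤-Reasoning

    -- The popular differences of A.
    opaque
      Λ : PSet n
      Λ d = ⌊ a ≤? 2 * K * card (λ z → A z ∧ A (z ⊖ d)) ⌋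

      Λ-card : card Λ ≤ 2 * K * a
      Λ-card = *-cancelʳ-≤ _ _ a {{>-nonZero 0<a}} (begin
        card Λ * a ≡⟨ *-comm (card Λ) a ⟩
        a * card Λ ≤⟨ sumOver-≥ {S = Λ} (λ d p → toWitness p) ⟩
        sumOver Λ (λ d → 2 * K * card (λ z → A z ∧ A (z ⊖ d))) ≡⟨ sumOver-* Λ (2 * K) _ ⟩
        2 * K * sumOver Λ (λ d → card (λ z → A z ∧ A (z ⊖ d))) ≡⟨ cong (2 * K *_) (sumOver-swap Λ A (λ d z → A (z ⊖ d))) ⟩
        2 * K * sumOver A (λ z → card (λ d → Λ d ∧ A (z ⊖ d))) ≤⟨ *-monoʳ-≤ (2 * K) (sumOver-≤ {S = A} (λ z _ → ≤-trans (card-bij (z ⊖_) (z ⊖_) (invol z) (invol z) (λ d q → ∧-snd {Λ d} q)) A≤)) ⟩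
        2 * K * (a * card A) ≤⟨ *-monoʳ-≤ (2 * K) (*-monoʳ-≤ a A≤) ⟩
        2 * K * (a * a) ≡⟨ sym (*-assoc (2 * K) a a) ⟩
        2 * K * a * a ∎)
        where
        open ≤-Reasoning
        invol : ∀ z d → z ⊖ (z ⊖ d) ≡ d
        invol z d = solveG (z ∷ d ∷ []) (:x :- (:x :- :y)) :y refl

      -- For most u in `X` both x + u and y + u are in `A`, and each such u represents x - y as a
      -- difference of elements of `A`.
      X-X⊆Λ : ∀ {x y} → T (X x) → T (X y) → T (Λ (x ⊖ y))
      X-X⊆Λ {x} {y} p q = fromWitness (*-cancelˡ-≤ 2 (lin _ _ 0
          (4 ⊛ ≤X ⊹ (4 * K) ⊛ split ⊹ *-monoˡ-≤ (bad x) 4K≤e ⊹ clique x p ⊹ *-monoˡ-≤ (bad y) 4K≤e ⊹ clique y q)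
          (eq a K (card X) (bad x) (bad y) (card I) e)))
        where
        I : PSet n
        I z = A z ∧ A (z ⊖ (x ⊖ y))
        bad : Fin n → ℕ
        bad x = card (λ u → X u ∧ not (A (x ⊕ u)))
        split : card X ≤ card I + bad x + bad y
        split = ≤-trans (card-cover {R = λ u → X u ∧ A (x ⊕ u)} {Q = λ u → X u ∧ not (A (x ⊕ u))} (λ u → go₁ u))
           (≤-trans (+-monoˡ-≤ (bad x) (≤-trans (card-cover {R = λ u → A (x ⊕ u) ∧ A (y ⊕ u)} {Q = λ u → X u ∧ not (A (y ⊕ u))} go₂) (+-monoˡ-≤ (bad y)
              (card-shift x {R = I} (λ u r → ∧-intro (transport A (⊕-comm x u) (∧-fst r)) (transport A (eq₁ u) (∧-snd {A (x ⊕ u)} r)))))))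
            (≤-reflexive (trans (+-assoc (card I) (bad y) (bad x)) (trans (cong (card I +_) (+-comm (bad y) (bad x))) (sym (+-assoc (card I) (bad x) (bad y)))))))
          where
          eq₁ : ∀ u → y ⊕ u ≡ (u ⊕ x) ⊖ (x ⊖ y)
          eq₁ u = solveG (u ∷ x ∷ y ∷ []) (:z :+ :x) ((:x :+ :y) :- (:y :- :z)) refl
          go₁ : ∀ u → T (X u) → T (X u ∧ A (x ⊕ u)) ⊎ T (X u ∧ not (A (x ⊕ u)))
          go₁ u r with T? (A (x ⊕ u))
          ... | yes s = inj₁ (∧-intro r s)
          ... | no ¬s = inj₂ (∧-intro r (not-intro ¬s))
          go₂ : ∀ u → T (X u ∧ A (x ⊕ u)) → T (A (x ⊕ u) ∧ A (y ⊕ u)) ⊎ T (X u ∧ not (A (y ⊕ u)))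
          go₂ u r with T? (A (y ⊕ u))
          ... | yes s = inj₁ (∧-intro (∧-snd {X u} r) s)
          ... | no ¬s = inj₂ (∧-intro (∧-fst r) (not-intro ¬s))
        eq : ∀ a K X b c I e → 2 * a + (4 * (K * X) + 4 * K * (I + b + c) + e * b + a + e * c + a) + 0 ≡ 2 * (2 * K * I) + (4 * a + 4 * K * X + 4 * K * b + e * b + 4 * K * c + e * c)
        eq = solve-∀

    module Popular (ω : ℕ) (W : PSet n) (1≤ω : 1 ≤ ω) (≤W : a ≤ ω * card W) (W⊆X : ∀ w → T (W w) → T (X w)) where
      reps : Fin n → ℕ
      reps d = card (λ x → W x ∧ W (x ⊕ d))

      opaque
        Pop : PSet n
        Pop d = ⌊ card W ≤? 4 * K * ω * reps d ⌋

        Pop-out : ∀ {d} → T (Pop d) → card W ≤ 4 * K * ω * reps d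
        Pop-out = toWitness

        -- All |W|^2 differences of `W` fall into `Λ`, which has at most 2Ka ≤ 2Kω|W| elements. The
        -- unpopular values therefore account for at most half of them, and each popular value for
        -- at most |W|.
        Pop-large : card W ≤ 2 * card Pop
        Pop-large = *-cancelˡ-≤ (2 * K * ω) {{>-nonZero (*-mono-≤ {1} {2 * K} {1} {ω} (≤-trans 1≤K (m≤m+n K _)) 1≤ω)}} (*-cancelʳ-≤ _ _ (card W) {{>-nonZero 0<W}}
          (lin _ _ 0 (p ⊛ all ⊹ few ⊹ *-monoʳ-≤ (card W) Λ-card ⊹ (2 * K * card W) ⊛ ≤W) (eq K ω (card W) (card Λ) (card Pop) a (sumOver Λ reps))))
          where
          p : ℕ
          p = 4 * K * ω
          0<W : 0 < card W
          0<W = pos-factorʳ ω (≤-trans 0<a ≤W)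
          all : card W * card W ≤ sumOver Λ reps
          all = ≤-trans (sumOver-≥ {S = W} (λ x q → card-shift (⊝ x) {R = λ d → Λ d ∧ W (x ⊕ d)} (λ y r → ∧-intro (transport Λ (⊖-def y x) (X-X⊆Λ (W⊆X y r) (W⊆X x q)))
                    (transport W (trans (trans (sym (⊖-cancel y x)) (⊕-comm (y ⊖ x) x)) (cong (x ⊕_) (⊖-def y x))) r))))
                 (≤-reflexive (sumOver-swap W Λ (λ x d → W (x ⊕ d))))
          few : p * sumOver Λ reps ≤ card W * card Λ + p * card W * card Pop
          few = ≤-trans (≤-reflexive (sym (sumOver-* Λ p reps))) (sumOver-split Λ Pop (card W) (p * card W)
                  (λ d _ ¬q → <⇒≤ (≰⇒> (λ le → ¬q (fromWitness le)))) (λ d _ _ → *-monoʳ-≤ p (card-mono (λ x → ∧-fst))))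
          eq : ∀ K ω W Λ P a s → 2 * K * ω * W * W + (4 * K * ω * s + (W * Λ + 4 * K * ω * W * P) + W * (2 * K * a) + 2 * K * W * (ω * W)) + 0
               ≡ 2 * K * ω * (2 * P) * W + (4 * K * ω * (W * W) + 4 * K * ω * s + W * Λ + 2 * K * W * a)
          eq = solve-∀

    weaken : ∀ {ω ω' β β' B W} → ω ≤ ω' → β ≤ β' → State ω β B W → State ω' β' B W
    weaken {W = W} p q st = record
      { dense = ≤-trans (State.dense st) (*-monoˡ-≤ (card W) p)
      ; size = ≤-trans (State.size st) q
      ; base = ≤-trans (State.base st) p
      ; W⊆X = State.W⊆X st
      ; inside = State.inside st
      ; U⊇X = State.U⊇X st
      }

    U-++ˡ : ∀ B C z → T (U B z) → T (U (B ++ C) z)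
    U-++ˡ B C z p = Any⇒⋃L (AnyP.++⁺ˡ (⋃L⇒Any B p))

    U-shift : ∀ B d z → T (U B (z ⊖ d)) → T (U (B ++ map (_⊕ d) B) z)
    U-shift B d z p = Any⇒⋃L (AnyP.++⁺ʳ B (AnyP.map⁺ (Any.map (λ {b} → transport X (eq b)) (⋃L⇒Any B p))))
      where
      eq : ∀ b → z ⊖ d ⊖ b ≡ z ⊖ (b ⊕ d)
      eq b = solveG (z ∷ d ∷ b ∷ []) (:x :- :y :- :z) (:x :- (:z :+ :y)) refl

    module Grow {ω β B W} (st : State ω β B W) (d : Fin n) (pop : card W ≤ 4 * K * ω * card (λ x → W x ∧ W (x ⊕ d))) where
      B' : List (Fin n)
      B' = B ++ map (_⊕ d) B

      W' : PSet n
      W' x = W x ∧ W (x ⊕ d)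

      abstract
        U-grows : card (U B) + N (U B) d ≤ card (U B')
        U-grows = ≤-trans (+-monoʳ-≤ (card (U B)) (≤-reflexive (N-def (U B) d)))
          (card-disjoint {R = U B} {Q = λ z → U B (z ⊖ d) ∧ not (U B z)} (λ z p q → not-elim (∧-snd {U B (z ⊖ d)} q) p) (U-++ˡ B _) (λ z q → U-shift B d z (∧-fst q)))

        grown : State (thin K ω) (2 * β) B' W'
        grown = record
          { dense = ≤-trans (State.dense st) (≤-trans (*-monoʳ-≤ ω pop) (≤-reflexive (sym (*-assoc ω (4 * K * ω) (card W')))))
          ; size = ≤-trans (≤-reflexive (trans (length-++ B) (cong (length B +_) (length-map (_⊕ d) B))))
                     (≤-trans (+-mono-≤ (State.size st) (State.size st)) (≤-reflexive (cong (β +_) (sym (+-identityʳ β)))))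
          ; base = ≤-trans (State.base st) (ω≤thin 1≤K (State.base st))
          ; W⊆X = λ w p → State.W⊆X st w (∧-fst p)
          ; inside = λ w p → AllP.++⁺ (State.inside st w (∧-fst p)) (AllP.map⁺ (All.map (λ {b} → transport X (eq w b)) (State.inside st (w ⊕ d) (∧-snd {W w} p))))
          ; U⊇X = ≤-trans (State.U⊇X st) (card-mono (U-++ˡ B _))
          }
          where
          eq : ∀ w b → (w ⊕ d) ⊕ b ≡ w ⊕ (b ⊕ d)
          eq w b = solveG (w ∷ d ∷ b ∷ []) ((:x :+ :y) :+ :z) (:x :+ (:z :+ :y)) refl

    record Refined (m ω β : ℕ) (B : List (Fin n)) (W : PSet n) : Set where
      field
        B' : List (Fin n)
        W' : PSet n
        D : PSet n
        state : State ω β B' W'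
        B⊆B' : ∀ z → T (U B z) → T (U B' z)
        W'⊆W : ∀ w → T (W' w) → T (W w)
        D-dense : a ≤ 2 * ω * card D
        D-periods : ∀ d → T (D d) → m * N (U B') d ≤ a

    -- Every popular difference that is not a near-period of U B enlarges U B, which happens boundedly often.
    refine : ∀ g m ω β B W → State ω β B W → 2 ^ g * β ≤ e → 2 * m * a < m * card (U B) + g * a → Refined m (thin^ K g ω) (2 ^ g * β) B W
    -- Each enlargement spends one unit of `g` and adds more than a / m points to `U B`, which
    -- preserves the fuel inequality. With no units left it contradicts |U B| ≤ 2a.
    refine zero m ω β B W st β≤ fuel = ⊥-elim (<⇒≱ fuel (≤-trans (≤-reflexive (+-identityʳ _))
      (≤-trans (*-monoʳ-≤ m (card-U (≤-trans (≤-reflexive (sym (+-identityʳ β))) β≤) st)) (≤-reflexive (eq m a)))))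
      where
      eq : ∀ m a → m * (2 * a) ≡ 2 * m * a
      eq = solve-∀
    refine (suc g) m ω β B W st β≤ fuel = choose (any? (λ d → T? (Pop d) ×-dec (a <? m * N (U B) d)))
      where
      open Popular ω W (State.base st) (State.dense st) (State.W⊆X st)
      choose : Relation.Nullary.Dec (∃ λ d → T (Pop d) × a < m * N (U B) d) → Refined m (thin^ K (suc g) ω) (2 ^ suc g * β) B W
      choose (no none) = record
        { B' = B ; W' = W ; D = Pop
        ; state = weaken (ω≤thin^ (suc g) 1≤K (State.base st)) (m≤n*m β (2 ^ suc g) {{>-nonZero (m^n>0 2 (suc g))}}) st
        ; B⊆B' = λ z p → p
        ; W'⊆W = λ w p → p
        ; D-dense = ≤-trans (State.dense st) (≤-trans (*-monoʳ-≤ ω Pop-large) (≤-trans (≤-reflexive (eq ω (card Pop)))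
                      (*-monoˡ-≤ (card Pop) (*-monoʳ-≤ 2 (ω≤thin^ (suc g) 1≤K (State.base st))))))
        ; D-periods = λ d p → ≮⇒≥ (λ lt → none (d , p , lt))
        }
        where
        eq : ∀ w p → w * (2 * p) ≡ 2 * w * p
        eq = solve-∀
      choose (yes (d , pop , big)) = record
        { B' = R.B' ; W' = R.W' ; D = R.D
        ; state = weaken ≤-refl (≤-reflexive (eq (2 ^ g) β)) R.state
        ; B⊆B' = λ z p → R.B⊆B' z (U-++ˡ B _ z p)
        ; W'⊆W = λ w p → ∧-fst (R.W'⊆W w p)
        ; D-dense = R.D-dense
        ; D-periods = R.D-periods
        }
        where
        module S = Grow st d (Pop-out pop)
        eq : ∀ x β → x * (2 * β) ≡ 2 * x * β
        eq = solve-∀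
        eq₂ : ∀ m a u N u' g → suc (2 * m * a) + (m * u + suc g * a + m * N + m * u') + 1 ≡ m * u' + g * a + (suc (2 * m * a) + suc a + m * (u + N))
        eq₂ = solve-∀
        module R = Refined (refine g m (thin K ω) (2 * β) S.B' S.W' S.grown (≤-trans (≤-reflexive (eq (2 ^ g) β)) β≤)
                     (lin _ _ 1 (fuel ⊹ big ⊹ m ⊛ S.U-grows) (eq₂ m a (card (U B)) (N (U B) d) (card (U S.B')) g)))

  -- Iterated dilates and their unions

  precisionFor periodFor orderFor : ℕ → ℕ → ℕ → ℕ
  precisionFor k e zero = e
  precisionFor k e (suc j) = e + doublePrecision k (precisionFor k e j)
  periodFor k e zero = 0
  periodFor k e (suc j) = doublePeriod k (precisionFor k e j) + periodFor k e j
  orderFor k e zero = 0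
  orderFor k e (suc j) = 2 + doubleOrder k (precisionFor k e j) + orderFor k e j

  module Layers {n : ℕ} (G : FinAbGroup n) (inv2 : Grp.Invertible G 2) where
    open Grp G
    open Halving G inv2
    open Doubling G
    open DoublingLemma G
    open Extraction G using (TF-mono)

    half^ : ℕ → Fin n → Fin n
    half^ zero z = z
    half^ (suc i) z = half (half^ i z)

    abstract
      2^·half^ : ∀ i z → 2 ^ i · half^ i z ≡ z
      2^·half^ zero z = ·-1 z
      2^·half^ (suc i) z = trans (sym (·-assoc (half (half^ i z)) 2 (2 ^ i)))
        (trans (·-comm 2 (2 ^ i) _) (trans (cong (2 ^ i ·_) (2·-half (half^ i z))) (2^·half^ i z)))

      half^-2^· : ∀ i z → half^ i (2 ^ i · z) ≡ z
      half^-2^· i z = ·-injective-2^ i (2^·half^ i (2 ^ i · z))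
        where
        ·-injective-2^ : ∀ i {x y} → 2 ^ i · x ≡ 2 ^ i · y → x ≡ y
        ·-injective-2^ zero {x} {y} p = trans (sym (·-1 x)) (trans p (·-1 y))
        ·-injective-2^ (suc i) {x} {y} p = ·-injective-2^ i (·-injective 2 inv2 (trans (·-assoc x 2 (2 ^ i)) (trans p (sym (·-assoc y 2 (2 ^ i))))))

      card-half^ : ∀ i (S : PSet n) → card S ≤ card (λ z → S (half^ i z))
      card-half^ i S = card-bij (2 ^ i ·_) (half^ i) (2^·half^ i) (half^-2^· i) (λ z p → transport S (sym (half^-2^· i z)) p)

      2·≢𝟘 : ∀ {d} → d ≢ 𝟘 → 2 · d ≢ 𝟘
      2·≢𝟘 d≢0 e = d≢0 (·-injective 2 inv2 (trans e (sym (·-𝟘 2))))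

      -- Induction on j, with 2V for `V` and 2d for `d`: a near-period of V doubles to one of 2V
      -- without loss, whereas closeness to `A` worsens at each doubling. Hence `precisionFor` is
      -- computed backwards from the last doubling.
      doublings-inside : ∀ k e a (A : PSet n) → Bounded A A k → ∀ j V d → d ≢ 𝟘 → card V ≤ 2 * a → TorsionFreeUpTo (orderFor k e j) →
                         precisionFor k e j * card (V ∖ A) ≤ a → periodFor k e j * N V d ≤ a →
                         ∀ i → i ≤ j → e * card ((λ z → V (half^ i z)) ∖ A) ≤ a
      doublings-inside k e a A bd zero V d d≢0 V≤ tf hA hN zero z≤n = hA
      doublings-inside k e a A bd (suc j) V d d≢0 V≤ tf hA hN zero z≤n = ≤-trans (*-monoˡ-≤ (card (V ∖ A)) (m≤m+n e _)) hA
      doublings-inside k e a A bd (suc j) V d d≢0 V≤ tf hA hN (suc i) (s≤s i≤j) =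
        doublings-inside k e a A bd j (dil V) (2 · d) (2·≢𝟘 d≢0) (≤-trans (card-half (λ z p → p)) V≤) (TF-mono (m≤n+m _ (2 + doubleOrder k (precisionFor k e j))) tf)
          (≤-trans (*-monoʳ-≤ (precisionFor k e j) (card-dil∖ V A))
            (double k (precisionFor k e j) a A V d bd (TF-mono (m≤m+n _ (orderFor k e j)) tf) d≢0 V≤ (≤-trans (*-monoˡ-≤ (card (V ∖ A)) (m≤n+m _ e)) hA)
              (≤-trans (*-monoˡ-≤ (N V d) (m≤m+n (doublePeriod k (precisionFor k e j)) (periodFor k e j))) hN)))
          (≤-trans (*-monoʳ-≤ (periodFor k e j) (N-dil-≤ V d)) (≤-trans (*-monoˡ-≤ (N V d) (m≤n+m _ (doublePeriod k (precisionFor k e j)))) hN))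
          i i≤j

    -- The union of the dilates 2^j V for j ≤ m, in Horner form.
    layers : PSet n → ℕ → PSet n
    layers V zero z = V z
    layers V (suc m) z = V z ∨ layers V m (half z)

    abstract
      layers-⊇ : ∀ V m z → T (V z) → T (layers V m z)
      layers-⊇ V zero z p = p
      layers-⊇ V (suc m) z p = ∨-introˡ p

      layers-mono : ∀ {V V'} → (∀ z → T (V z) → T (V' z)) → ∀ m z → T (layers V m z) → T (layers V' m z)
      layers-mono h zero z p = h z p
      layers-mono {V} {V'} h (suc m) z p with ∨-elim {V z} p
      ... | inj₁ q = ∨-introˡ (h z q)
      ... | inj₂ q = ∨-introʳ {V' z} (layers-mono h m (half z) q)

      layers-suc : ∀ V m z → T (layers V m z) → T (layers V (suc m) z)
      layers-suc V zero z p = ∨-introˡ p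
      layers-suc V (suc m) z p with ∨-elim {V z} p
      ... | inj₁ q = ∨-introˡ q
      ... | inj₂ q = ∨-introʳ {V z} (layers-suc V m (half z) q)

      layers-+ : ∀ V m i z → T (layers V m z) → T (layers V (m + i) z)
      layers-+ V m zero z p = subst (λ t → T (layers V t z)) (sym (+-identityʳ m)) p
      layers-+ V m (suc i) z p = subst (λ t → T (layers V t z)) (sym (+-suc m i)) (layers-suc V (m + i) z (layers-+ V m i z p))

      layers-≤ : ∀ V {m m'} → m ≤ m' → ∀ z → T (layers V m z) → T (layers V m' z)
      layers-≤ V {m} h z p = subst (λ t → T (layers V t z)) (m+[n∸m]≡n h) (layers-+ V m _ z p)

      -- The next union contains both this one and its dilate, so a small increment of the unions
      -- means near-invariance under doubling.
      layers-dil : ∀ V m → card (dil (layers V m) ∖ layers V m) + card (layers V m) ≤ card (layers V (suc m))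
      layers-dil V m = card-disjoint (λ z p q → not-elim (∧-snd {dil (layers V m) z} p) q) (λ z p → ∨-introʳ {V z} (∧-fst p)) (layers-suc V m)

      layers-outside : ∀ (A V : PSet n) δ m i → (∀ j → j ≤ m → card ((λ z → V (half^ (i + j) z)) ∖ A) ≤ δ) → card ((λ z → layers V m (half^ i z)) ∖ A) ≤ suc m * δ
      layers-outside A V δ zero i h = ≤-trans (subst (λ t → card ((λ z → V (half^ t z)) ∖ A) ≤ δ) (+-identityʳ i) (h 0 z≤n)) (≤-reflexive (sym (+-identityʳ δ)))
      layers-outside A V δ (suc m) i h = ≤-trans (card-cover {R = (λ z → V (half^ i z)) ∖ A} {Q = (λ z → layers V m (half^ (suc i) z)) ∖ A} go)
         (+-mono-≤ (subst (λ t → card ((λ z → V (half^ t z)) ∖ A) ≤ δ) (+-identityʳ i) (h 0 z≤n))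
           (layers-outside A V δ m (suc i) (λ j j≤ → subst (λ t → card ((λ z → V (half^ t z)) ∖ A) ≤ δ) (+-suc i j) (h (suc j) (s≤s j≤)))))
         where
         go : ∀ z → T (((λ z → layers V (suc m) (half^ i z)) ∖ A) z) → T (((λ z → V (half^ i z)) ∖ A) z) ⊎ T (((λ z → layers V m (half^ (suc i) z)) ∖ A) z)
         go z p with ∨-elim {V (half^ i z)} (∧-fst p)
         ... | inj₁ q = inj₁ (∧-intro q (∧-snd {layers V (suc m) (half^ i z)} p))
         ... | inj₂ q = inj₂ (∧-intro q (∧-snd {layers V (suc m) (half^ i z)} p))

      -- For the dilate 2^j V, the element 2^m d is 2^(m-j) times the near-period 2^j d; these
      -- factors add up to less than 2^(m+1).
      N-layers : ∀ V m d → N (layers V m) (2 ^ m · d) ≤ 2 ^ suc m * N V d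
      N-layers V zero d = ≤-trans (≤-reflexive (cong (N V) (·-1 d))) (m≤n*m (N V d) 2)
      N-layers V (suc m) d = ≤-trans (N-∪ V (dil (layers V m)) (2 ^ suc m · d)) (≤-trans (+-mono-≤ (N-· V (2 ^ suc m) d)
        (≤-trans (≤-reflexive (cong (N (dil (layers V m))) (sym (·-assoc d 2 (2 ^ m))))) (≤-trans (N-dil-≤ (layers V m) (2 ^ m · d)) (N-layers V m d))))
        (≤-reflexive (eq (2 ^ suc m) (N V d))))
        where
        eq : ∀ x v → x * v + x * v ≡ 2 * x * v
        eq = solve-∀

      N-translate : ∀ V w d → N (λ z → V (z ⊖ w)) d ≤ N V d
      N-translate V w d = ≤-trans (≤-reflexive (N-def (λ z → V (z ⊖ w)) d)) (≤-trans (card-unshift w (λ z p → subst (λ t → T (V t ∧ not (V (z ⊖ w)))) (eq z) p)) (≤-reflexive (sym (N-def V d))))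
        where
        eq : ∀ z → z ⊖ d ⊖ w ≡ z ⊖ w ⊖ d
        eq z = solveG (z ∷ d ∷ w ∷ []) (:x :- :y :- :z) (:x :- :z :- :y) refl

  -- If all 2L + 1 steps added more than a / L, the final value would exceed 2a.
  small-increment : ∀ (f : ℕ → ℕ) L a m → 0 < a → f (m + suc (2 * L)) ≤ 2 * a → ∃ λ i → i < suc (2 * L) × L * f (suc (m + i)) ≤ L * f (m + i) + a
  small-increment f L a m 0<a bound = pick (search (suc (2 * L)))
    where
    Found : ℕ → Set
    Found t = ∃ λ i → i < t × L * f (suc (m + i)) ≤ L * f (m + i) + a
    search : ∀ t → Found t ⊎ t * a ≤ L * f (m + t)
    search zero = inj₂ z≤n
    search (suc t) with search t
    ... | inj₁ (i , lt , h) = inj₁ (i , m≤n⇒m≤1+n lt , h)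
    ... | inj₂ h with L * f (suc (m + t)) ≤? L * f (m + t) + a
    ... | yes p = inj₁ (t , ≤-refl , p)
    ... | no ¬p = inj₂ (≤-trans (+-monoʳ-≤ a h) (≤-trans (≤-reflexive (+-comm a _)) (≤-trans (<⇒≤ (≰⇒> ¬p)) (≤-reflexive (cong (λ s → L * f s) (sym (+-suc m t)))))))
    pick : Found (suc (2 * L)) ⊎ suc (2 * L) * a ≤ L * f (m + suc (2 * L)) → Found (suc (2 * L))
    pick (inj₁ w) = w
    pick (inj₂ h) = ⊥-elim (<⇒≱ (m<n+m (2 * L * a) 0<a) (≤-trans h (≤-trans (*-monoʳ-≤ L bound) (≤-reflexive (eq L a)))))
      where
      eq : ∀ L a → L * (2 * a) ≡ 2 * L * a
      eq = solve-∀

  -- The core subgroup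

  -- Parameters of a stage: density of W and size of B, number of layers, density at the previous stage.
  record Par : Set where
    constructor par
    field
      ω β m ω⁻ : ℕ

  open Par

  module Numbers (k r K M : ℕ) where
    -- If a set has at most a / `margin` points outside `A`, these are at most |H| / 2r for any `H`
    -- with a ≤ 2 ω⁻ |H|.
    margin : ℕ → ℕ
    margin ω⁻ = 1 + 4 * r * ω⁻

    finePrecision : ℕ → ℕ → ℕ
    finePrecision m ω⁻ = suc m * margin ω⁻

    -- The precision asked of the near-periods of `U`: the first term carries it over to the union
    -- of m + 1 dilates, the second feeds the doubling lemma. It can involve only the density of the
    -- previous stage, because the density of the current stage is computed from it.
    strength : ℕ → ℕ → ℕ
    strength m ω⁻ = 2 * M * 2 ^ suc m + periodFor k (finePrecision m ω⁻) m

    -- The number of steps that `small-increment` needs for the invariance required by near-periods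
    -- of density 1 / 2ω.
    moreLayers : ℕ → ℕ → ℕ
    moreLayers ω m = m + suc (2 * stability M (2 * ω))

    stage : ℕ → ℕ → ℕ → Par
    stage ω β m = par (thin^ K (suc (2 * strength m ω)) ω) (2 ^ suc (2 * strength m ω) * β) m ω

    next : Par → Par
    next p = stage (ω p) (β p) (moreLayers (ω p) (m p))

    final : ℕ → Par → Par
    final zero p = p
    final (suc s) p = final s (next p)

    β-grows : ∀ s p → β p ≤ β (final s p)
    β-grows zero p = ≤-refl
    β-grows (suc s) p = ≤-trans (m≤n*m (β p) (2 ^ suc (2 * strength (moreLayers (ω p) (m p)) (ω p))) {{>-nonZero (m^n>0 2 (suc (2 * strength (moreLayers (ω p) (m p)) (ω p))))}}) (β-grows s (next p))

  module Stages {n : ℕ} (G : FinAbGroup n) (inv2 : Grp.Invertible G 2) (A X : PSet n) (k r K e a : ℕ) (A≤ : card A ≤ a) (0<a : 0 < a) (1≤K : 1 ≤ K) (4K≤e : 4 * K ≤ e)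
                (≤X : a ≤ K * card X) (clique : ∀ x → T (X x) → e * card (λ y → X y ∧ not (A (Grp._⊕_ G x y))) ≤ a) where
    open Grp G
    open Halving G inv2
    open Layers G inv2
    open Subgroups G
    open Refinement G A X K e a A≤ 0<a 1≤K 4K≤e ≤X clique

    -- The term 18Kr makes `H ∖ Z` at most |H| / 2r; the term 40K is what `extract` demands of the
    -- radius a / M.
    M : ℕ
    M = 18 * K * r + 40 * K

    open Numbers k r K M

    record Stage (p : Par) : Set where
      field
        B : List (Fin n)
        W D : PSet n
        state : State (ω p) (β p) B W
        D-dense : a ≤ 2 * ω p * card D
        D-periods : ∀ d → T (D d) → strength (m p) (ω⁻ p) * N (U B) d ≤ a
        ω⁻≥1 : 1 ≤ ω⁻ p
        ω⁻≤ω : ω⁻ p ≤ ω p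

    Placed : List (Fin n) → Fin n → PSet n
    Placed B w z = U B (z ⊖ w)

    Y : List (Fin n) → Fin n → ℕ → PSet n
    Y B w m = layers (Placed B w) m

    nextStage : ∀ ω₀ β₀ m₀ B W → State ω₀ β₀ B W → β (stage ω₀ β₀ m₀) ≤ e →
                Σ (Stage (stage ω₀ β₀ m₀)) λ s → (∀ z → T (U B z) → T (U (Stage.B s) z)) × (∀ w → T (Stage.W s w) → T (W w))
    nextStage ω₀ β₀ m₀ B W st β≤ = record
        { B = R.B' ; W = R.W' ; D = R.D ; state = R.state ; D-dense = R.D-dense ; D-periods = R.D-periods
        ; ω⁻≥1 = State.base st ; ω⁻≤ω = ω≤thin^ (suc (2 * strength m₀ ω₀)) 1≤K (State.base st) } , R.B⊆B' , R.W'⊆W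
      where
      fuel : 2 * strength m₀ ω₀ * a < strength m₀ ω₀ * card (U B) + suc (2 * strength m₀ ω₀) * a
      fuel = ≤-trans (+-monoˡ-≤ (2 * strength m₀ ω₀ * a) 0<a) (m≤n+m _ (strength m₀ ω₀ * card (U B)))
      module R = Refined (refine (suc (2 * strength m₀ ω₀)) (strength m₀ ω₀) ω₀ β₀ B W st β≤ fuel)

    -- Two consecutive stages between which the union of dilates, placed at `w`, grows by at most a
    -- / 2M. `B⁺` and `m⁺` belong to the last stage, where closeness to `A` is tested, and `ω⁺`
    -- bounds the densities of the stages before it.
    record Stable (w : Fin n) (B⁺ : List (Fin n)) (m⁺ ω⁺ : ℕ) : Set where
      field
        B₀ B₁ : List (Fin n)
        D₀ : PSet n
        m₀ ω₀ : ℕ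
        1≤ω₀ : 1 ≤ ω₀
        ω₀≤ : ω₀ ≤ ω⁺
        D-dense : a ≤ 2 * ω₀ * card D₀
        D-periods : ∀ d → T (D₀ d) → 2 * M * 2 ^ suc m₀ * N (U B₀) d ≤ a
        X≤ : card X ≤ card (U B₀)
        B₀⊆B₁ : ∀ z → T (U B₀ z) → T (U B₁ z)
        B₁⊆B⁺ : ∀ z → T (U B₁ z) → T (U B⁺ z)
        m₁≤ : moreLayers ω₀ m₀ ≤ m⁺
        little : 2 * M * card (Y B₁ w (moreLayers ω₀ m₀)) ≤ 2 * M * card (Y B₀ w m₀) + a

    record Built (s : ℕ) (p : Par) (o : Stage p) : Set where
      field
        last : Stage (final s p)
        B⊆ : ∀ z → T (U (Stage.B o) z) → T (U (Stage.B last) z)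
        ω⁻≤ : ω⁻ p ≤ ω⁻ (final s p)
        m≤ : m p ≤ m (final s p)
        stable : ∀ w → 2 * M * card (Y (Stage.B last) w (m (final s p))) < 2 * M * card (Y (Stage.B o) w (m p)) + s * a →
                 Stable w (Stage.B last) (m (final s p)) (ω⁻ (final s p))

    -- A step that is not stable adds more than a to 2M times the size of the union, so the
    -- assumption in `stable` excludes s of them. The place `w` stays open, as it is taken from the
    -- `W` of the last stage.
    build : ∀ s p (o : Stage p) → β (final s p) ≤ e → Built s p o
    build zero p o β≤ = record { last = o ; B⊆ = λ z q → q ; ω⁻≤ = ≤-refl ; m≤ = ≤-refl ; stable = λ w lt → ⊥-elim (<-irrefl (sym (+-identityʳ _)) lt) }
    build (suc s) p o β≤ = continue (nextStage (ω p) (β p) (moreLayers (ω p) (m p)) (Stage.B o) (Stage.W o) (Stage.state o) (≤-trans (β-grows s (next p)) β≤))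
      where
      continue : (Σ (Stage (next p)) λ o' → (∀ z → T (U (Stage.B o) z) → T (U (Stage.B o') z)) × (∀ w → T (Stage.W o' w) → T (Stage.W o w))) → Built (suc s) p o
      continue (o' , B⊆B' , _) = record
        { last = R.last
        ; B⊆ = λ z q → R.B⊆ z (B⊆B' z q)
        ; ω⁻≤ = ≤-trans (Stage.ω⁻≤ω o) R.ω⁻≤
        ; m≤ = ≤-trans (m≤m+n (m p) _) R.m≤
        ; stable = stable
        }
        where
        module R = Built (build s (next p) o' β≤)
        m⁺ : ℕ
        m⁺ = m (final s (next p))
        stable : ∀ w → 2 * M * card (Y (Stage.B R.last) w m⁺) < 2 * M * card (Y (Stage.B o) w (m p)) + suc s * a → Stable w (Stage.B R.last) m⁺ (ω⁻ (final s (next p)))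
        stable w lt with 2 * M * card (Y (Stage.B o') w (moreLayers (ω p) (m p))) ≤? 2 * M * card (Y (Stage.B o) w (m p)) + a
        ... | yes h = record
          { B₀ = Stage.B o ; B₁ = Stage.B o' ; D₀ = Stage.D o ; m₀ = m p ; ω₀ = ω p
          ; 1≤ω₀ = State.base (Stage.state o) ; ω₀≤ = R.ω⁻≤
          ; D-dense = Stage.D-dense o
          ; D-periods = λ d q → ≤-trans (*-monoˡ-≤ (N (U (Stage.B o)) d) (m≤m+n (2 * M * 2 ^ suc (m p)) _)) (Stage.D-periods o d q)
          ; X≤ = State.U⊇X (Stage.state o)
          ; B₀⊆B₁ = B⊆B' ; B₁⊆B⁺ = R.B⊆ ; m₁≤ = R.m≤ ; little = h }
        ... | no ¬h = R.stable w (lin _ _ 1 (lt ⊹ ≰⇒> ¬h) (eq (2 * M * card (Y (Stage.B R.last) w m⁺)) (2 * M * card (Y (Stage.B o) w (m p))) (2 * M * card (Y (Stage.B o') w (moreLayers (ω p) (m p)))) s a))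
          where
          eq : ∀ x y z s a → suc x + (y + suc s * a + z) + 1 ≡ z + s * a + (suc x + suc (y + a))
          eq = solve-∀

    module Settle (w : Fin n) (B⁺ : List (Fin n)) (m⁺ ω⁺ : ℕ) (st : Stable w B⁺ m⁺ ω⁺) (tf : TorsionFreeUpTo (2 ^ recurrence (2 * ω⁺)))
                  (1≤r : 1 ≤ r) (out : margin ω⁺ * card (Y B⁺ w m⁺ ∖ A) ≤ a) where
      open Stable st

      placed-⊆ : ∀ B C → (∀ z → T (U B z) → T (U C z)) → ∀ z → T (Placed B w z) → T (Placed C w z)
      placed-⊆ B C h z = h (z ⊖ w)

      Y₀ Y⁺ D : PSet n
      Y₀ = Y B₀ w m₀
      Y⁺ = Y B⁺ w m⁺
      D t = D₀ (half^ m₀ t)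

      size : ℕ → ℕ
      size m = card (Y B₁ w m)

      abstract
        card-Y⁺ : card Y⁺ ≤ 2 * a
        card-Y⁺ = ≤-trans (card-split Y⁺ A) (≤-trans (+-mono-≤ (≤-trans (card-mono (λ z p → ∧-snd {Y⁺ z} p)) A≤) (≤-trans (m≤n*m _ (margin ω⁺)) out))
                    (≤-reflexive (cong (a +_) (sym (+-identityʳ a)))))

        layer⊆Y⁺ : ∀ {m} → m ≤ moreLayers ω₀ m₀ → ∀ z → T (Y B₁ w m z) → T (Y⁺ z)
        layer⊆Y⁺ {m} m≤ z p = layers-≤ (Placed B⁺ w) (≤-trans m≤ m₁≤) z (layers-mono {Placed B₁ w} {Placed B⁺ w} (placed-⊆ B₁ B⁺ B₁⊆B⁺) m z p)

        increment : ∃ λ i → i < suc (2 * stability M (2 * ω₀)) × stability M (2 * ω₀) * size (suc (m₀ + i)) ≤ stability M (2 * ω₀) * size (m₀ + i) + a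
        increment = small-increment size (stability M (2 * ω₀)) a m₀ 0<a (≤-trans (card-mono (layer⊆Y⁺ ≤-refl)) card-Y⁺)

      module Chosen (i : ℕ) (i< : i < suc (2 * stability M (2 * ω₀)))
                    (small : stability M (2 * ω₀) * size (suc (m₀ + i)) ≤ stability M (2 * ω₀) * size (m₀ + i) + a) where
        Z : PSet n
        Z = Y B₁ w (m₀ + i)

        abstract
          m≤ : m₀ + i ≤ moreLayers ω₀ m₀
          m≤ = +-monoʳ-≤ m₀ (<⇒≤ i<)

          Y₀⊆Z : ∀ z → T (Y₀ z) → T (Z z)
          Y₀⊆Z z p = layers-+ (Placed B₁ w) m₀ i z (layers-mono {Placed B₀ w} {Placed B₁ w} (placed-⊆ B₀ B₁ B₀⊆B₁) m₀ z p)

          card-Z : card Z ≤ 2 * a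
          card-Z = ≤-trans (card-mono (layer⊆Y⁺ m≤)) card-Y⁺

          a≤Z : a ≤ K * card Z
          a≤Z = ≤-trans ≤X (*-monoʳ-≤ K (≤-trans X≤ (≤-trans (card-shift w {R = Placed B₀ w} (λ z p → subst (λ t → T (U B₀ t)) (sym (⊕-⊖ z w)) p))
                  (card-mono (λ z p → Y₀⊆Z z (layers-⊇ (Placed B₀ w) m₀ z p))))))

          a≤D : a ≤ 2 * ω₀ * card D
          a≤D = ≤-trans D-dense (*-monoʳ-≤ (2 * ω₀) (card-half^ m₀ D₀))

          Z∖Y₀ : 2 * M * card (Z ∖ Y₀) ≤ a
          Z∖Y₀ = +-cancelˡ-≤ (2 * M * card Y₀) _ _ (≤-trans (≤-reflexive (trans (+-comm _ (2 * M * card (Z ∖ Y₀))) (sym (*-distribˡ-+ (2 * M) (card (Z ∖ Y₀)) (card Y₀)))))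
                   (≤-trans (*-monoʳ-≤ (2 * M) (≤-trans (card-disjoint {S = Z} (λ z p q → not-elim (∧-snd {Z z} p) q) (λ z → ∧-fst) Y₀⊆Z) (card-mono (layers-≤ (Placed B₁ w) m≤)))) little))

          -- `D` is the dilate of `D₀` by 2^m₀. Near-periods of `U B₀` pass to `Y₀` by `N-layers`,
          -- and on to `Z` because `Z` has at most a / 2M further points.
          periods : ∀ t → T (D t) → M * N Z t ≤ a
          periods t p = *-cancelˡ-≤ 2 (lin _ _ 0 (Z∖Y₀ ⊹ D-periods d p ⊹ (2 * M) ⊛ near ⊹ (2 * M) ⊛ layered ⊹ (2 * M * 2 ^ suc m₀) ⊛ N-translate (U B₀) w d)
                          (eq M (2 ^ suc m₀) (N Z t) (card (Z ∖ Y₀)) (N Y₀ t) (N (Placed B₀ w) d) (N (U B₀) d) a))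
            where
            d : Fin n
            d = half^ m₀ t
            near : N Z t ≤ card (Z ∖ Y₀) + N Y₀ t
            near = N-near t Y₀⊆Z
            layered : N Y₀ t ≤ 2 ^ suc m₀ * N (Placed B₀ w) d
            layered = ≤-trans (≤-reflexive (cong (N Y₀) (sym (2^·half^ m₀ t)))) (N-layers (Placed B₀ w) m₀ d)
            eq : ∀ M q z y y₀ v u a → 2 * (M * z) + (a + a + 2 * M * (y + y₀) + 2 * M * (q * v) + 2 * M * q * u) + 0 ≡ 2 * a + (2 * M * y + 2 * M * q * u + 2 * M * z + 2 * M * y₀ + 2 * M * q * v)
            eq = solve-∀

          stable-Z : stability M (2 * ω₀) * card (dil Z ∖ Z) ≤ a
          stable-Z = +-cancelˡ-≤ (stability M (2 * ω₀) * card Z) _ _ (≤-trans (≤-reflexive (trans (+-comm _ (stability M (2 * ω₀) * card (dil Z ∖ Z))) (sym (*-distribˡ-+ (stability M (2 * ω₀)) (card (dil Z ∖ Z)) (card Z)))))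
                       (≤-trans (*-monoʳ-≤ (stability M (2 * ω₀)) (layers-dil (Placed B₁ w) (m₀ + i))) small))

          recurrence≤ : recurrence (2 * ω₀) ≤ recurrence (2 * ω⁺)
          recurrence≤ = ≤-trans (^-monoˡ-≤ (4 * (2 * ω₀)) le) (^-monoʳ-≤ (4 * (2 * ω⁺)) {{>-nonZero (≤-trans (≤-trans 1≤ω₀ (≤-trans (m≤n*m ω₀ 2) (m≤n*m (2 * ω₀) 4))) le)}} le)
            where
            le : 4 * (2 * ω₀) ≤ 4 * (2 * ω⁺)
            le = *-monoʳ-≤ 4 (*-monoʳ-≤ 2 ω₀≤)

          subgroup : ∃ λ H → IsSub H × a ≤ 2 * ω⁺ * card H × r * card (H ∖ A) ≤ card H
          subgroup = let H , sub , large , inZ = Extraction.extract G inv2 K (2 * ω₀) M a 1≤K (≤-trans 1≤ω₀ (m≤n*m ω₀ 2)) (m≤n+m _ (18 * K * r))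
                                           (Extraction.TF-mono G (^-monoʳ-≤ 2 recurrence≤) tf) Z D 0<a card-Z a≤Z a≤D periods stable-Z
                     in H , sub , ≤-trans large (*-monoˡ-≤ (card H) (*-monoʳ-≤ 2 ω₀≤)) , fullness H (≤-trans large (*-monoˡ-≤ (card H) (*-monoʳ-≤ 2 ω₀≤))) inZ
            where
            ω⁺>0 : 1 ≤ ω⁺
            ω⁺>0 = ≤-trans 1≤ω₀ ω₀≤
            fullness : ∀ H → a ≤ 2 * ω⁺ * card H → M * card (H ∖ Z) ≤ 9 * K * card H → r * card (H ∖ A) ≤ card H
            fullness H large inZ = *-cancelˡ-≤ 2 (lin _ _ 0 (near ⊹ far ⊹ (2 * r) ⊛ ∖-tri H Z A) (eq r (card (H ∖ A)) (card (H ∖ Z)) (card (Z ∖ A)) (card H)))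
              where
              near : 2 * r * card (H ∖ Z) ≤ card H
              near = *-cancelˡ-≤ (9 * K) {{>-nonZero (≤-trans 1≤K (m≤n*m K 9))}} (lin _ _ (40 * K * card (H ∖ Z)) inZ (eq₁ K r (card (H ∖ Z)) (card H)))
                where
                eq₁ : ∀ K r g h → 9 * K * (2 * r * g) + 9 * K * h + 40 * K * g ≡ 9 * K * h + (18 * K * r + 40 * K) * g
                eq₁ = solve-∀
              far : 2 * r * card (Z ∖ A) ≤ card H
              far = *-cancelˡ-≤ (2 * ω⁺) {{>-nonZero (≤-trans ω⁺>0 (m≤n*m ω⁺ 2))}} (lin _ _ (card (Z ∖ A))
                      (margin ω⁺ ⊛ card-mono {S = Z ∖ A} {R = Y⁺ ∖ A} (λ z p → ∧-intro (layer⊆Y⁺ m≤ z (∧-fst p)) (∧-snd {Z z} p)) ⊹ out ⊹ large)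
                      (eq₂ r ω⁺ (card (Z ∖ A)) (card (Y⁺ ∖ A)) a (card H)))
                where
                eq₂ : ∀ r ω z y a h → 2 * ω * (2 * r * z) + ((1 + 4 * r * ω) * y + a + 2 * ω * h) + z ≡ 2 * ω * h + ((1 + 4 * r * ω) * z + (1 + 4 * r * ω) * y + a)
                eq₂ = solve-∀
              eq : ∀ r g x y h → 2 * (r * g) + (h + h + 2 * r * (x + y)) + 0 ≡ 2 * h + (2 * r * x + 2 * r * y + 2 * r * g)
              eq = solve-∀

      abstract
        subgroup : ∃ λ H → IsSub H × a ≤ 2 * ω⁺ * card H × r * card (H ∖ A) ≤ card H
        subgroup = let i , i< , small = increment in Chosen.subgroup i i< small

  -- Each failure to be a near-clique of precision f K costs a factor f K of the density K.
  densities : (ℕ → ℕ) → ℕ → ℕ → ℕ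
  densities f K zero = K
  densities f K (suc i) = densities f (K * f K) i

  module NearCliques {n : ℕ} (G : FinAbGroup n) where
    open Grp G
    open Doubling G

    nonNeighbours : PSet n → PSet n → Fin n → PSet n
    nonNeighbours A Z x y = Z y ∧ (not ⌊ x ≟ᶠ y ⌋ ∧ not (A (x ⊕ y)))

    record NearClique (f : ℕ → ℕ) (A : PSet n) (K : ℕ) : Set where
      field
        X : PSet n
        X⊆A : ∀ x → T (X x) → T (A x)
        dense : card A ≤ K * card X
        sparse : ∀ x → T (X x) → f K * card (nonNeighbours A X x) ≤ card X

    -- Prepending x to an independent list of its non-neighbours lowers the bound j by one. `f` is
    -- evaluated at the density already reached, since the precision needed later depends on that
    -- density.
    nearClique : ∀ f A j K Z → (∀ x → T (Z x) → T (A x)) → card A ≤ K * card Z → Bounded Z A j → ∃ λ i → i < j × NearClique f A (densities f K i)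
    nearClique f A zero K Z Z⊆A dense bd = ⊥-elim (n≮0 (bd [] [] []))
    nearClique f A (suc j) K Z Z⊆A dense bd = choose (any? (λ x → T? (Z x) ×-dec (card Z <? f K * card (nonNeighbours A Z x))))
      where
      choose : Dec (∃ λ x → T (Z x) × card Z < f K * card (nonNeighbours A Z x)) → ∃ λ i → i < suc j × NearClique f A (densities f K i)
      choose (no none) = 0 , s≤s z≤n , record { X = Z ; X⊆A = Z⊆A ; dense = dense ; sparse = λ x p → ≮⇒≥ (λ lt → none (x , p , lt)) }
      choose (yes (x , x∈Z , many)) =
        let i , i<j , nc = nearClique f A j (K * f K) Z′ (λ y p → Z⊆A y (∧-fst p))
                             (≤-trans dense (≤-trans (*-monoʳ-≤ K (<⇒≤ many)) (≤-reflexive (sym (*-assoc K (f K) (card Z′)))))) bd′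
        in suc i , s≤s i<j , nc
        where
        Z′ : PSet n
        Z′ = nonNeighbours A Z x
        bd′ : Bounded Z′ A j
        bd′ xs ps qs = ≤-pred (bd (x ∷ xs) (x∈Z ∷ All.map ∧-fst ps)
          (All.map (λ {y} p → (λ e → not-elim (∧-fst {not ⌊ x ≟ᶠ y ⌋} (∧-snd {Z y} p)) (fromWitness e)) , not-elim (∧-snd {not ⌊ x ≟ᶠ y ⌋} (∧-snd {Z y} p))) ps ∷ qs))

  sumBelow : (ℕ → ℕ) → ℕ → ℕ
  sumBelow g zero = 0
  sumBelow g (suc k) = g k + sumBelow g k

  term≤sumBelow : ∀ g {i k} → i < k → g i ≤ sumBelow g k
  term≤sumBelow g {i} {suc k} (s≤s i≤k) with m≤n⇒m<n∨m≡n i≤k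
  ... | inj₁ i<k = ≤-trans (term≤sumBelow g i<k) (m≤n+m _ (g k))
  ... | inj₂ refl = m≤m+n (g k) _

  module Constants (k r : ℕ) where
    M : ℕ → ℕ
    M K = 18 * K * r + 40 * K

    lastStage : ℕ → Par
    lastStage K = Numbers.final k r K (M K) (suc (4 * M K)) (Numbers.stage k r K (M K) K 1 0)

    target : ℕ → ℕ
    target K = Numbers.finePrecision k r K (M K) (Par.m (lastStage K)) (Par.ω⁻ (lastStage K))

    opaque
      -- In `cliquePrecision`, 4K makes the differences of `X` popular, β keeps |U B| ≤ 2a, and the
      -- last term keeps the placed `U B` of the last stage close enough to `A` to survive all its
      -- doublings.
      cliquePrecision order threshold : ℕ → ℕ
      cliquePrecision K = 4 * K + Par.β (lastStage K) + precisionFor k (target K) (Par.m (lastStage K)) * Par.β (lastStage K)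
      order K = orderFor k (target K) (Par.m (lastStage K)) + 2 ^ recurrence (2 * Par.ω⁻ (lastStage K))
      threshold K = 1 + 2 * cliquePrecision K + 2 * Par.ω (lastStage K) + order K

      4K≤cliquePrecision : ∀ K → 4 * K ≤ cliquePrecision K
      4K≤cliquePrecision K = ≤-trans (m≤m+n (4 * K) _) (m≤m+n _ _)

      β≤cliquePrecision : ∀ K → Par.β (lastStage K) ≤ cliquePrecision K
      β≤cliquePrecision K = ≤-trans (m≤n+m _ (4 * K)) (m≤m+n _ _)

      precision≤cliquePrecision : ∀ K → precisionFor k (target K) (Par.m (lastStage K)) * Par.β (lastStage K) ≤ cliquePrecision K
      precision≤cliquePrecision K = m≤n+m _ (4 * K + Par.β (lastStage K))

      orderFor≤order : ∀ K → orderFor k (target K) (Par.m (lastStage K)) ≤ order K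
      orderFor≤order K = m≤m+n _ _

      recurrence≤order : ∀ K → 2 ^ recurrence (2 * Par.ω⁻ (lastStage K)) ≤ order K
      recurrence≤order K = m≤n+m _ (orderFor k (target K) (Par.m (lastStage K)))

      0<threshold : ∀ K → 0 < threshold K
      0<threshold K = s≤s z≤n

      cliquePrecision≤threshold : ∀ K → 2 * cliquePrecision K ≤ threshold K
      cliquePrecision≤threshold K = ≤-trans (n≤1+n _) (≤-trans (m≤m+n (suc (2 * cliquePrecision K)) _) (m≤m+n _ (order K)))

      ω<threshold : ∀ K → 2 * Par.ω (lastStage K) < threshold K
      ω<threshold K = s≤s (≤-trans (m≤n+m _ (2 * cliquePrecision K)) (m≤m+n _ (order K)))

      order≤threshold : ∀ K → order K ≤ threshold K
      order≤threshold K = m≤n+m (order K) (1 + 2 * cliquePrecision K + 2 * Par.ω (lastStage K))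

    density : ℕ → ℕ
    density i = densities (λ K → 2 * cliquePrecision K) 1 i

    -- The near-clique occurs at one of k possible densities, and the sum dominates the thresholds
    -- of all of them.
    coreSize : ℕ
    coreSize = 2 + sumBelow (λ i → threshold (density i)) k

    coreIndex : ℕ
    coreIndex = 1 + sumBelow (λ i → 2 * Par.ω⁻ (lastStage (density i))) k

  module Core {n : ℕ} (G : FinAbGroup n) (k r : ℕ) (1≤r : 1 ≤ r) where
    open Grp G
    open Subgroups G
    open Doubling G
    open NearCliques G
    open Constants k r
    open Extraction G using (TF-mono)

    module FromClique (inv2 : Invertible 2) (A : PSet n) (bd : Bounded A A k) (K : ℕ) (1≤K : 1 ≤ K) (nc : NearClique (λ K → 2 * cliquePrecision K) A K)
                      (large : threshold K ≤ card A) (tf : TorsionFreeUpTo (order K)) where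
      open NearClique nc
      a e : ℕ
      a = card A
      e = cliquePrecision K
      abstract
        0<a : 0 < a
        0<a = ≤-trans (0<threshold K) large

        4K≤e : 4 * K ≤ e
        4K≤e = 4K≤cliquePrecision K

        2e≤a : 2 * e ≤ a
        2e≤a = ≤-trans (cliquePrecision≤threshold K) large

        clique : ∀ x → T (X x) → e * card (λ y → X y ∧ not (A (x ⊕ y))) ≤ a
        clique x p = *-cancelˡ-≤ 2 (lin _ _ 0 ((2 * e) ⊛ split ⊹ sparse x p ⊹ card-mono X⊆A ⊹ 2e≤a) (eq e (card (λ y → X y ∧ not (A (x ⊕ y)))) (card (nonNeighbours A X x)) (card X) a))
          where
          -- The 1 is the diagonal: 2x may lie outside `A`, yet x is not its own non-neighbour. The
          -- bound 2e ≤ a absorbs it.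
          split : card (λ y → X y ∧ not (A (x ⊕ y))) ≤ card (nonNeighbours A X x) + 1
          split = ≤-trans (card-cover {R = nonNeighbours A X x} {Q = λ y → ⌊ x ≟ᶠ y ⌋} go) (+-monoʳ-≤ (card (nonNeighbours A X x)) (card≤1 x (λ y q → sym (toWitness q))))
            where
            go : ∀ y → T (X y ∧ not (A (x ⊕ y))) → T (nonNeighbours A X x y) ⊎ T ⌊ x ≟ᶠ y ⌋
            go y q with T? ⌊ x ≟ᶠ y ⌋
            ... | yes s = inj₂ s
            ... | no ¬s = inj₁ (∧-intro {X y} (∧-fst {X y} q) (∧-intro (not-intro ¬s) (∧-snd {X y} q)))
          eq : ∀ e b c x a → 2 * (e * b) + (2 * e * (c + 1) + x + a + a) + 0 ≡ 2 * a + (2 * e * b + 2 * e * c + x + 2 * e)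
          eq = solve-∀

      open Refinement G A X K e a ≤-refl 0<a 1≤K 4K≤e dense clique
      module S = Stages G inv2 A X k r K e a ≤-refl 0<a 1≤K 4K≤e dense clique
      open Numbers k r K (M K) using (stage; final; β-grows; strength; margin; finePrecision)

      par₀ : Par
      par₀ = stage K 1 0

      abstract
        start : State K 1 (𝟘 ∷ []) X
        start = record
          { dense = dense ; size = ≤-refl ; base = 1≤K ; W⊆X = λ w p → p
          ; inside = λ w p → transport X (sym (⊕-idʳ w)) p ∷ []
          ; U⊇X = card-mono (λ z p → ∨-introˡ (transport X (solveG (z ∷ []) :x (:x :- :0) refl) p))
          }

      module Last (p : Par) (last : S.Stage p) (B₀ : List (Fin n)) (β≤e : Par.β p ≤ e) (ω< : 2 * Par.ω p < a)
                  (P≤e : precisionFor k (finePrecision (Par.m p) (Par.ω⁻ p)) (Par.m p) * Par.β p ≤ e)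
                  (tfₒ : TorsionFreeUpTo (orderFor k (finePrecision (Par.m p) (Par.ω⁻ p)) (Par.m p)))
                  (tfᵣ : TorsionFreeUpTo (2 ^ recurrence (2 * Par.ω⁻ p)))
                  (stable : ∀ w → 2 * M K * card (S.Y (S.Stage.B last) w (Par.m p)) < 2 * M K * card (S.Y B₀ w 0) + suc (4 * M K) * a →
                            S.Stable w (S.Stage.B last) (Par.m p) (Par.ω⁻ p)) where
        open S.Stage last
        E : ℕ
        E = margin (Par.ω⁻ p)
        Q : ℕ
        Q = finePrecision (Par.m p) (Par.ω⁻ p)

        module Placement (w : Fin n) (w∈W : T (W w)) (d : Fin n) (d∈D : T (D d)) (d≢0 : d ≢ 𝟘) where
          V : PSet n
          V = S.Placed B w

          abstract
            V∖A : precisionFor k Q (Par.m p) * card (V ∖ A) ≤ a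
            V∖A = ≤-trans (*-monoʳ-≤ P (≤-trans (outside w B (State.inside state w w∈W)) (*-monoˡ-≤ (a / e) (State.size state))))
                    (≤-trans (≤-reflexive (sym (*-assoc P (Par.β p) (a / e)))) (≤-trans (*-monoˡ-≤ (a / e) P≤e) (*/≤ e a)))
              where
              P : ℕ
              P = precisionFor k Q (Par.m p)

            V≤ : card V ≤ 2 * a
            V≤ = ≤-trans (card-unshift w (λ z q → q)) (card-U β≤e state)

            N-V : periodFor k Q (Par.m p) * N V d ≤ a
            N-V = ≤-trans (*-monoʳ-≤ (periodFor k Q (Par.m p)) (Layers.N-translate G inv2 (U B) w d))
                    (≤-trans (*-monoˡ-≤ (N (U B) d) (m≤n+m _ (2 * M K * 2 ^ suc (Par.m p)))) (D-periods d d∈D))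

            inside-A : E * card (S.Y B w (Par.m p) ∖ A) ≤ a
            inside-A = ≤-trans (*-monoʳ-≤ E (Layers.layers-outside G inv2 A V (a / Q) (Par.m p) 0 (λ j j≤ → ≤/ Q
                          (Layers.doublings-inside G inv2 k Q a A bd (Par.m p) V d d≢0 V≤ tfₒ V∖A N-V j j≤))))
                        (≤-trans (≤-reflexive (eq E (suc (Par.m p)) (a / Q))) (*/≤ Q a))
              where
              eq : ∀ E m x → E * (m * x) ≡ m * E * x
              eq = solve-∀

            grown : 2 * M K * card (S.Y B w (Par.m p)) < 2 * M K * card (S.Y B₀ w 0) + suc (4 * M K) * a
            grown = ≤-trans (s≤s (≤-trans (*-monoʳ-≤ (2 * M K) Y≤) (≤-reflexive (eq (M K) a)))) (≤-trans (+-monoˡ-≤ (4 * M K * a) 0<a) (m≤n+m _ (2 * M K * card (S.Y B₀ w 0))))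
              where
              eq : ∀ M a → 2 * M * (2 * a) ≡ 4 * M * a
              eq = solve-∀
              Y≤ : card (S.Y B w (Par.m p)) ≤ 2 * a
              Y≤ = ≤-trans (card-split (S.Y B w (Par.m p)) A) (≤-trans (+-mono-≤ (card-mono (λ z q → ∧-snd {S.Y B w (Par.m p) z} q)) (≤-trans (m≤n*m _ (E)) inside-A))
                     (≤-reflexive (cong (a +_) (sym (+-identityʳ a)))))

            subgroup : ∃ λ H → IsSub H × a ≤ 2 * Par.ω⁻ p * card H × r * card (H ∖ A) ≤ card H
            subgroup = S.Settle.subgroup w B (Par.m p) (Par.ω⁻ p) (stable w grown) tfᵣ 1≤r inside-A

        abstract
          subgroup : ∃ λ H → IsSub H × a ≤ 2 * Par.ω⁻ p * card H × r * card (H ∖ A) ≤ card H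
          subgroup = let w , w∈W = W-nonempty state
                         -- a > 2ω makes |D| > 1, and the doubling lemma needs a nonzero direction.
                         d , d∈D , d≢0 = another-element 𝟘 (*-cancelˡ-< (2 * Par.ω p) 1 (card D) (≤-trans (≤-trans (s≤s (≤-reflexive (*-identityʳ (2 * Par.ω p)))) ω<) D-dense))
                     in Placement.subgroup w w∈W d d∈D d≢0

      abstract
        subgroup : ∃ λ H → IsSub H × a ≤ 2 * Par.ω⁻ (lastStage K) * card H × r * card (H ∖ A) ≤ card H
        subgroup = let s₀ , _ , _ = S.nextStage K 1 0 (𝟘 ∷ []) X start (≤-trans (β-grows (suc (4 * M K)) par₀) (β≤cliquePrecision K))
                       b = S.build (suc (4 * M K)) par₀ s₀ (β≤cliquePrecision K)
                   in Last.subgroup (lastStage K) (S.Built.last b) (S.Stage.B s₀) (β≤cliquePrecision K) (≤-trans (ω<threshold K) large) (precision≤cliquePrecision K)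
                        (TF-mono (orderFor≤order K) tf) (TF-mono (recurrence≤order K) tf) (S.Built.stable b)

    abstract
      1≤density : ∀ i K → 1 ≤ K → 1 ≤ densities (λ K → 2 * cliquePrecision K) K i
      1≤density zero K h = h
      1≤density (suc i) K h = 1≤density i (K * (2 * cliquePrecision K)) (*-mono-≤ {1} {K} {1} {2 * cliquePrecision K} h
        (≤-trans h (≤-trans (m≤n*m K 4) (≤-trans (4K≤cliquePrecision K) (m≤n*m (cliquePrecision K) 2)))))

    abstract
      core : ∀ A → coreSize ≤ card A → TorsionFreeUpTo coreSize → Bounded A A k →
             ∃ λ H → IsSub H × card A ≤ coreIndex * card H × r * card (H ∖ A) ≤ card H
      core A large tf bd =
        let i , i<k , nc = nearClique (λ K → 2 * cliquePrecision K) A k 1 A (λ x p → p) (≤-reflexive (sym (*-identityˡ (card A)))) bd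
            T≤ = ≤-trans (term≤sumBelow (λ i → threshold (density i)) i<k) (m≤n+m _ 2)
            H , sub , dense , full = FromClique.subgroup (tf 2 (s≤s z≤n) (m≤m+n 2 _)) A bd (density i) (1≤density i 1 (s≤s z≤n)) nc
                                       (≤-trans T≤ large) (TF-mono (≤-trans (order≤threshold (density i)) T≤) tf)
        in H , sub , ≤-trans dense (*-monoˡ-≤ (card H) (≤-trans (term≤sumBelow (λ i → 2 * Par.ω⁻ (lastStage (density i))) i<k) (n≤1+n _))) , full

  -- Invertibility of small integers from the order of the group

  prime-divisor : ∀ d → 2 ≤ d → ∃ λ p → Prime p × p ∣ d
  prime-divisor d 2≤d = go (PrimeFactorisation.factors f) (PrimeFactorisation.isFactorisation f) (PrimeFactorisation.factorsPrime f)
    where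
    f = factorise d {{>-nonZero (≤-trans (s≤s z≤n) 2≤d)}}
    go : ∀ ps → d ≡ product ps → All Prime ps → ∃ λ p → Prime p × p ∣ d
    go [] eq _ = ⊥-elim (<⇒≱ 2≤d (≤-reflexive eq))
    go (p ∷ ps) eq (pp ∷ _) = p , pp , subst (p ∣_) (sym eq) (m∣m*n _)

  coprime-to-order : ∀ {C n} → (∀ p → Prime p → p < C → ¬ (p ∣ n)) → ∀ m → 1 ≤ m → m < C → Coprime m n
  coprime-to-order {C} {n} noSmall m 1≤m m<C {d} (d∣m , d∣n) with d ≤? 1
  ... | yes d≤1 = ≤-antisym d≤1 (n≢0⇒n>0 (λ { refl → <⇒≱ 1≤m (≤-reflexive (0∣⇒≡0 d∣m)) }))
  ... | no d≰1 = let p , pp , p∣d = prime-divisor d (≰⇒> d≰1)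
                 in ⊥-elim (noSmall p pp (≤-<-trans (∣⇒≤ {{>-nonZero 1≤m}} (∣-trans p∣d d∣m)) m<C) (∣-trans p∣d d∣n))

  module Order {n : ℕ} (G : FinAbGroup n) where
    open Grp G
    private module S = Algebra.Properties.CommutativeMonoid.Sum (AbelianGroup.commutativeMonoid bundle)

    opaque
      unfolding _·_

      -- Translation by x permutes G, so the sum of all elements equals itself plus n · x.
      n·x≡𝟘 : ∀ x → n · x ≡ 𝟘
      n·x≡𝟘 x = GP.∙-cancelˡ (S.sum {n} (λ i → i)) _ _ (begin
        S.sum {n} (λ i → i) ⊕ n · x ≡⟨ cong (S.sum {n} (λ i → i) ⊕_) (sym (S.sum-replicate n {x})) ⟩
        S.sum {n} (λ i → i) ⊕ S.sum {n} (λ _ → x) ≡⟨ sym (S.∑-distrib-+ (λ i → i) (λ _ → x)) ⟩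
        S.sum {n} (λ i → i ⊕ x) ≡⟨ sym (S.sum-permute (λ i → i) (Perm.permutation (_⊕ x) (_⊖ x) (λ y → ⊖-cancel y x) (λ y → ⊕-⊖ y x))) ⟩
        S.sum {n} (λ i → i) ≡⟨ sym (⊕-idʳ _) ⟩
        S.sum {n} (λ i → i) ⊕ 𝟘 ∎)
        where open ≡-Reasoning

    bézout-invertible : ∀ {m} → Bézout.Identity 1 m n → Invertible m
    bézout-invertible {m} (Bézout.+- u v eq) = u , λ x → begin
      u · (m · x) ≡⟨ ·-assoc x u m ⟩
      (u * m) · x ≡⟨ cong (_· x) (sym eq) ⟩
      (1 + v * n) · x ≡⟨ ·-homo-+ x 1 (v * n) ⟩
      1 · x ⊕ (v * n) · x ≡⟨ cong₂ _⊕_ (·-1 x) (trans (sym (·-assoc x v n)) (trans (cong (v ·_) (n·x≡𝟘 x)) (·-𝟘 v))) ⟩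
      x ⊕ 𝟘 ≡⟨ ⊕-idʳ x ⟩
      x ∎
      where open ≡-Reasoning
    -- Here u m is -1 modulo n, so the inverse is -u, written as (n - 1) u.
    bézout-invertible {m} (Bézout.-+ u v eq) = (n ∸ 1) * u , λ x → begin
      ((n ∸ 1) * u) · (m · x) ≡⟨ sym (·-assoc (m · x) (n ∸ 1) u) ⟩
      (n ∸ 1) · (u · (m · x)) ≡⟨ cong ((n ∸ 1) ·_) (·-assoc x u m) ⟩
      (n ∸ 1) · ((u * m) · x) ≡⟨ GP.∙-cancelʳ ((u * m) · x) _ _ (trans (last ((u * m) · x)) (sym (close x))) ⟩
      x ∎
      where
      open ≡-Reasoning
      1≤n : ∀ {n} → Fin n → 1 ≤ n
      1≤n {suc n} _ = s≤s z≤n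
      last : ∀ y → (n ∸ 1) · y ⊕ y ≡ 𝟘
      last y = trans (cong ((n ∸ 1) · y ⊕_) (sym (·-1 y))) (trans (sym (·-homo-+ y (n ∸ 1) 1)) (trans (cong (_· y) (m∸n+n≡m (1≤n y))) (n·x≡𝟘 y)))
      close : ∀ x → x ⊕ (u * m) · x ≡ 𝟘
      close x = trans (cong (_⊕ (u * m) · x) (sym (·-1 x))) (trans (sym (·-homo-+ x 1 (u * m))) (trans (cong (_· x) eq) (trans (sym (·-assoc x v n)) (trans (cong (v ·_) (n·x≡𝟘 x)) (·-𝟘 v)))))

    torsionFree : ∀ {C M} → (∀ p → Prime p → p < C → ¬ (p ∣ n)) → M < C → TorsionFreeUpTo M
    torsionFree noSmall M<C m 1≤m m≤M = bézout-invertible (coprime-Bézout (coprime-to-order noSmall m 1≤m (≤-<-trans m≤M M<C)))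

  -- Passing between `Subset`, lists and Boolean predicates

  members : ∀ {n} → Subset n → PSet n
  members A x = V.lookup A x

  ∈⇒member : ∀ {n} {A : Subset n} {x} → x ∈ A → T (members A x)
  ∈⇒member {x = x} p = subst T (sym ([]=⇒lookup p)) _

  member⇒∈ : ∀ {n} {A : Subset n} {x} → T (members A x) → x ∈ A
  member⇒∈ {A = A} {x} p with V.lookup A x in eq
  ... | true = lookup⇒[]= x A eq

  opaque
    unfolding ∑ card

    ∣∣≡card : ∀ {n} (A : Subset n) → ∣ A ∣ ≡ card (members A)
    ∣∣≡card [] = refl
    ∣∣≡card (true ∷ A) = cong suc (∣∣≡card A)
    ∣∣≡card (false ∷ A) = ∣∣≡card A

  card-ext : ∀ {n} {S R : PSet n} → (∀ x → S x ≡ R x) → card S ≡ card R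
  card-ext h = ≤-antisym (card-mono (λ x p → subst T (h x) p)) (card-mono (λ x p → subst T (sym (h x)) p))

  toSubset : ∀ {n} → PSet n → Subset n
  toSubset S = V.tabulate S

  members-toSubset : ∀ {n} (S : PSet n) x → members (toSubset S) x ≡ S x
  members-toSubset S x = lookup∘tabulate S x

  fromList : ∀ {n} → List (Fin n) → PSet n
  fromList = ⋃L (λ x z → ⌊ x ≟ᶠ z ⌋)

  fromList-Any : ∀ {n} {xs : List (Fin n)} {z} → T (fromList xs z) → Any (λ x → x ≡ z) xs
  fromList-Any {xs = xs} p = Any.map toWitness (⋃L⇒Any {S = λ x z → ⌊ x ≟ᶠ z ⌋} xs p)

  card-fromList : ∀ {n} (xs : List (Fin n)) → AllPairs _≢_ xs → length xs ≤ card (fromList xs)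
  card-fromList [] _ = z≤n
  card-fromList (x ∷ xs) (d ∷ ds) = ≤-trans (+-mono-≤ (element⇒card>0 {S = λ z → ⌊ x ≟ᶠ z ⌋} x (fromWitness refl)) (card-fromList xs ds))
    (card-disjoint (λ z p q → let ne , e = All.lookupAny d (fromList-Any {xs = xs} q) in ne (trans (toWitness p) (sym e)))
       (λ z p → ∨-introˡ p) (λ z p → ∨-introʳ {⌊ x ≟ᶠ z ⌋} p))

  AllPairs-lookup : ∀ {A : Set} {R : A → A → Set} → (∀ {x y} → R x y → R y x) → ∀ {xs x y} → AllPairs R xs → Any (_≡ x) xs → Any (_≡ y) xs → x ≢ y → R x y
  AllPairs-lookup symm (p ∷ ps) (here refl) (here refl) ne = ⊥-elim (ne refl)
  AllPairs-lookup {R = R} symm (p ∷ ps) (here refl) (there j) ne = let r , e = All.lookupAny p j in subst (R _) e r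
  AllPairs-lookup {R = R} symm (p ∷ ps) (there i) (here refl) ne = let r , e = All.lookupAny p i in symm (subst (R _) e r)
  AllPairs-lookup symm (p ∷ ps) (there i) (there j) ne = AllPairs-lookup symm ps i j ne

  module Translate {n : ℕ} (G : FinAbGroup n) where
    open Grp G
    open Doubling G

    bounded : ∀ (A : Subset n) k → PhiLessThan G A k → Bounded (members A) (members A) k
    bounded A k phi xs inA apart = ≤-trans (s≤s (≤-trans (card-fromList xs (AllPairs.map proj₁ apart)) (≤-reflexive (sym size)))) (phi B B⊆A avoiding)
      where
      B : Subset n
      B = toSubset (fromList xs)
      size : ∣ B ∣ ≡ card (fromList xs)
      size = trans (∣∣≡card B) (card-ext (members-toSubset (fromList xs)))
      inList : ∀ {x} → x ∈ B → Any (_≡ x) xs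
      inList {x} p = fromList-Any {xs = xs} (subst T (members-toSubset (fromList xs) x) (∈⇒member p))
      B⊆A : ∀ {x} → x ∈ B → x ∈ A
      B⊆A p = let a , e = All.lookupAny inA (inList p) in subst (_∈ A) e (member⇒∈ a)
      symm : ∀ {x y} → Apart (members A) x y → Apart (members A) y x
      symm {x} {y} (ne , out) = (λ e → ne (sym e)) , (λ p → out (subst (λ t → T (members A t)) (⊕-comm y x) p))
      avoiding : SumAvoidingIn G B A
      avoiding p q ne s = proj₂ (AllPairs-lookup symm apart (inList p) (inList q) ne) (∈⇒member s)

  -- Families of subgroups

  module SubgroupFacts {n : ℕ} (G : FinAbGroup n) where
    open Grp G
    open Subgroups G

    card>0 : ∀ {H} → IsSub H → 0 < card H
    card>0 sub = element⇒card>0 𝟘 (IsSub.0∈ sub)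

    ∩-sub : ∀ {H K} → IsSub H → IsSub K → IsSub (H ∩ K)
    ∩-sub {H} p q = record
      { 0∈ = ∧-intro P.0∈ Q.0∈
      ; +∈ = λ {x} {y} u v → ∧-intro (P.+∈ (∧-fst u) (∧-fst v)) (Q.+∈ (∧-snd {H x} u) (∧-snd {H y} v))
      ; -∈ = λ {x} u → ∧-intro (P.-∈ (∧-fst u)) (Q.-∈ (∧-snd {H x} u))
      }
      where
      module P = IsSub p
      module Q = IsSub q

    -- The cosets of H by the multiples of an x outside H are distinct.
    small-index : ∀ M → TorsionFreeUpTo M → ∀ {H H₀} → IsSub H → IsSub H₀ → (∀ x → T (H x) → T (H₀ x)) → card H₀ ≤ M * card H → ∀ x → T (H₀ x) → T (H x)
    small-index M tf {H} {H₀} sub sub₀ H⊆H₀ index x x∈H₀ with T? (H x)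
    ... | yes p = p
    ... | no x∉H = ⊥-elim (<⇒≱ (m<n+m (M * card H) (card>0 sub)) (≤-trans total index))
      where
      Piece : ℕ → PSet n
      Piece i z = H (z ⊖ i · x)
      disjoint : ∀ {j i} → j < i → i < suc M → card (Piece i ∩ Piece j) ≤ 0
      disjoint {j} {i} j<i (s≤s i≤M) = ≤-trans (card-mono {R = λ _ → false} (λ z p → x∉H (inH z p))) (≤-reflexive card-empty)
        where
        inH : ∀ z → T ((Piece i ∩ Piece j) z) → T (H x)
        inH z p = let u , inv = tf (i ∸ j) (m<n⇒0<n∸m j<i) (≤-trans (m∸n≤m i j) i≤M) in
          transport H (inv x) (IsSub.·∈ sub u (transport H (sym (·-∸ x (<⇒≤ j<i)))
            (transport H (solveG (z ∷ i · x ∷ j · x ∷ []) ((:x :- :z) :- (:x :- :y)) (:y :- :z) refl)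
              (IsSub.⊖∈ sub (∧-snd {Piece i z} p) (∧-fst p)))))
      total : suc M * card H ≤ card H₀
      total = subst (λ l → l * card H ≤ card H₀) (length-downFrom (suc M)) (≤-trans
        (nearly-disjoint H₀ Piece (card H) 0 (downFrom (suc M)) (All.universal (λ i → card-shift (i · x) (λ z p → transport H (sym (⊕-⊖ z (i · x))) p)) _)
          (All.universal (λ i z p → transport H₀ (⊖-cancel z (i · x)) (IsSub.+∈ sub₀ (H⊆H₀ _ p) (IsSub.·∈ sub₀ i x∈H₀))) _)
          (AllPairsP.applyDownFrom⁺₁ id (suc M) disjoint))
        (≤-reflexive (trans (cong (card H₀ +_) (*-zeroʳ (length (downFrom (suc M)) * length (downFrom (suc M))))) (+-identityʳ (card H₀)))))

    -- Otherwise the trivial subgroup would have index at most `M` in `H`, and so be all of it.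
    large : ∀ M → TorsionFreeUpTo M → ∀ {H} → IsSub H → 1 < card H → M < card H
    large M tf {H} sub big = ≰⇒> λ le → <⇒≱ big (card≤1 𝟘 (λ x p → toWitness (small-index M tf trivial sub
        (λ y q → transport H (sym (toWitness q)) (IsSub.0∈ sub))
        (≤-trans le (≤-trans (≤-reflexive (sym (*-identityʳ M))) (*-monoʳ-≤ M (card>0 trivial)))) x p)))
      where
      trivial : IsSub (λ y → ⌊ y ≟ᶠ 𝟘 ⌋)
      trivial = record
        { 0∈ = fromWitness refl
        ; +∈ = λ p q → fromWitness (trans (cong₂ _⊕_ (toWitness p) (toWitness q)) (⊕-idʳ 𝟘))
        ; -∈ = λ p → fromWitness (trans (cong ⊝_ (toWitness p)) (trans (sym (⊕-idˡ (⊝ 𝟘))) (⊕-invʳ 𝟘)))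
        }

    -- Translation by an x in `H` outside `H₀` carries `H ∩ H₀` into `H ∖ H₀`, which would then be
    -- at least half of `H`.
    contained : ∀ {H H₀} → IsSub H → IsSub H₀ → 2 * card (H ∖ H₀) < card H → ∀ x → T (H x) → T (H₀ x)
    contained {H} {H₀} sub sub₀ few x x∈H with T? (H₀ x)
    ... | yes p = p
    ... | no x∉ = ⊥-elim (<⇒≱ few (≤-trans (card-split H H₀) (≤-trans (+-monoˡ-≤ (card (H ∖ H₀)) move) (≤-reflexive (cong (card (H ∖ H₀) +_) (sym (+-identityʳ _)))))))
      where
      move : card (H ∩ H₀) ≤ card (H ∖ H₀)
      move = card-shift x (λ z p → ∧-intro (IsSub.+∈ sub (∧-fst p) x∈H)
        (not-intro (λ q → x∉ (transport H₀ (solveG (z ∷ x ∷ []) ((:x :+ :y) :- :x) :y refl) (IsSub.⊖∈ sub₀ q (∧-snd {H z} p))))))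

    pairs : PSet n → PSet n → PSet n → ℕ
    pairs A H K = sumOver H (λ h → card (λ x → K x ∧ A (h ⊕ x)))

    module Sum {H K} (subH : IsSub H) (subK : IsSub K) where
      private
        module P = IsSub subH
        module Q = IsSub subK

      opaque
        S : PSet n
        S z = ⌊ any? (λ h → T? (H h ∧ K (z ⊖ h))) ⌋

        S-in : ∀ {z} h → T (H h) → T (K (z ⊖ h)) → T (S z)
        S-in h p q = fromWitness (h , ∧-intro p q)

        S-out : ∀ {z} → T (S z) → ∃ λ h → T (H h) × T (K (z ⊖ h))
        S-out {z} p = let h , q = toWitness p in h , ∧-fst q , ∧-snd {H h} q

      abstract
        H⊆S : ∀ z → T (H z) → T (S z)
        H⊆S z p = S-in z p (transport K (solveG (z ∷ []) :0 (:x :- :x) refl) Q.0∈)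

        K⊆S : ∀ z → T (K z) → T (S z)
        K⊆S z p = S-in 𝟘 P.0∈ (transport K (solveG (z ∷ []) :x (:x :- :0) refl) p)

        S-sub : IsSub S
        S-sub = record
          { 0∈ = H⊆S 𝟘 P.0∈
          ; +∈ = λ {x} {y} p q → let h , h∈ , x∈ = S-out p
                                     g , g∈ , y∈ = S-out q
                                 in S-in (h ⊕ g) (P.+∈ h∈ g∈) (transport K (solveG (x ∷ y ∷ h ∷ g ∷ [])
                                      ((:x :- :z) :+ (:y :- :w))
                                      ((:x :+ :y) :- (:z :+ :w)) refl) (Q.+∈ x∈ y∈))
          ; -∈ = λ {x} p → let h , h∈ , x∈ = S-out p
                           in S-in (⊝ h) (P.-∈ h∈) (transport K (trans (trans (sym (⊕-idˡ _)) (trans (sym (⊖-def 𝟘 (x ⊖ h)))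
                                (solveG (x ∷ h ∷ []) (:0 :- (:x :- :y)) ((:0 :- :x) :- (:0 :- :y)) refl)))
                                (cong₂ _⊖_ (trans (⊖-def 𝟘 x) (⊕-idˡ (⊝ x))) (trans (⊖-def 𝟘 h) (⊕-idˡ (⊝ h))))) (Q.-∈ x∈))
          }

        reps : Fin n → ℕ
        reps z = card (λ h → H h ∧ K (z ⊖ h))

        reps≤ : ∀ z → T (S z) → reps z ≤ card (H ∩ K)
        reps≤ z s = let h₀ , h₀∈ , z₀∈ = S-out s in
          card-unshift h₀ (λ h p → ∧-intro (P.⊖∈ (∧-fst p) h₀∈) (transport K
            (solveG (z ∷ h ∷ h₀ ∷ []) ((:x :- :z) :- (:x :- :y)) (:y :- :z) refl) (Q.⊖∈ z₀∈ (∧-snd {H h} p))))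

        reps≥ : ∀ z → T (S z) → card (H ∩ K) ≤ reps z
        reps≥ z s = let h₀ , h₀∈ , z₀∈ = S-out s in
          card-shift h₀ (λ h p → ∧-intro (P.+∈ (∧-fst p) h₀∈) (transport K
            (solveG (z ∷ h ∷ h₀ ∷ []) ((:x :- :z) :- :y) (:x :- (:y :+ :z)) refl) (Q.⊖∈ z₀∈ (∧-snd {H h} p))))

        -- Every element of H + K has card (H ∩ K) representations.
        pairs≤ : ∀ A → pairs A H K ≤ card (H ∩ K) * card (A ∩ S)
        pairs≤ A = begin
          pairs A H K ≤⟨ sumOver-mono {S = H} (λ h _ → card-shift h {R = λ z → A z ∧ K (z ⊖ h)} (λ x p → ∧-intro (transport A (⊕-comm h x) (∧-snd {K x} p)) (transport K (sym (⊕-⊖ x h)) (∧-fst p)))) ⟩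
          sumOver H (λ h → card (λ z → A z ∧ K (z ⊖ h))) ≡⟨ sumOver-swap H A (λ h z → K (z ⊖ h)) ⟩
          sumOver A reps ≤⟨ sumOver-split A (A ∩ S) 0 (card (H ∩ K)) (λ z a ¬s → ≤-trans (card-mono {R = λ _ → false} (λ h p → ¬s (∧-intro a (S-in h (∧-fst p) (∧-snd {H h} p))))) (≤-reflexive card-empty))
                                (λ z _ s → reps≤ z (∧-snd {A z} s)) ⟩
          card (H ∩ K) * card (A ∩ S) ∎
          where open ≤-Reasoning

        card-S : card (H ∩ K) * card S ≤ card H * card K
        card-S = begin
          card (H ∩ K) * card S ≤⟨ sumOver-≥ {S = S} reps≥ ⟩
          sumOver S reps ≡⟨ sumOver-swap S H (λ z h → K (z ⊖ h)) ⟩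
          sumOver H (λ h → card (λ z → S z ∧ K (z ⊖ h))) ≤⟨ sumOver-≤ {S = H} (λ h _ → card-unshift h (λ z p → ∧-snd {S z} p)) ⟩
          card K * card H ≡⟨ *-comm (card K) (card H) ⟩
          card H * card K ∎
          where open ≤-Reasoning

        dense-in-S : ∀ A δ → card H * card K ≤ δ * pairs A H K → card S ≤ δ * card (A ∩ S)
        dense-in-S A δ h = *-cancelˡ-≤ (card (H ∩ K)) {{>-nonZero (card>0 (∩-sub subH subK))}} (≤-trans card-S (≤-trans h (≤-trans (*-monoʳ-≤ δ (pairs≤ A)) (≤-reflexive (eq δ (card (H ∩ K)) (card (A ∩ S)))))))
          where
          eq : ∀ d x y → d * (x * y) ≡ x * (d * y)
          eq = solve-∀

  module ZeroOneLaw {n : ℕ} (G : FinAbGroup n) (k r : ℕ) (3≤r : 3 ≤ r) where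
    open Grp G
    open Subgroups G
    open SubgroupFacts G
    open Doubling G
    open Constants k r
    open Core G k r (≤-trans (s≤s z≤n) 3≤r)

    abstract
      -- The core subgroup of `A ∩ H₀` is almost inside `H₀`, hence inside it, and its bounded index
      -- forces it to be all of `H₀`. The bound k passes to `A ∩ H₀` because sums of elements of
      -- `H₀` stay in `H₀`.
      zero-one : ∀ δ A H₀ → Bounded A A k → IsSub H₀ → δ * coreSize ≤ card H₀ → 1 ≤ δ → card H₀ ≤ δ * card (A ∩ H₀) → TorsionFreeUpTo (coreSize + δ * coreIndex) →
                 r * card (H₀ ∖ A) ≤ card H₀
      zero-one δ A H₀ bd sub₀ big 1≤δ dense tf =
        let H , sub , H-dense , full = core (A ∩ H₀) (*-cancelˡ-≤ δ {{>-nonZero 1≤δ}} (≤-trans big dense)) (Extraction.TF-mono G (m≤m+n coreSize _) tf) bd′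
        in finish H sub H-dense full
        where
        bd′ : Bounded (A ∩ H₀) (A ∩ H₀) k
        bd′ xs ps qs = bd xs (All.map ∧-fst ps) (restrict xs ps qs)
          where
          restrict : ∀ xs → All (λ x → T ((A ∩ H₀) x)) xs → AllPairs (Apart (A ∩ H₀)) xs → AllPairs (Apart A) xs
          restrict [] _ _ = []
          restrict (x ∷ xs) (p ∷ ps) (q ∷ qs) = All.zipWith (λ { {y} (y∈ , (ne , out)) → ne , λ s → out (∧-intro s (IsSub.+∈ sub₀ (∧-snd {A x} p) (∧-snd {A y} y∈))) }) (ps , q) ∷ restrict xs ps qs
        finish : ∀ H → IsSub H → card (A ∩ H₀) ≤ coreIndex * card H → r * card (H ∖ (A ∩ H₀)) ≤ card H → r * card (H₀ ∖ A) ≤ card H₀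
        finish H sub H-dense full = ≤-trans (*-monoʳ-≤ r (card-mono (λ x p → ∧-intro (H₀⊆H x (∧-fst p)) (not-intro (λ q → not-elim (∧-snd {H₀ x} p) (∧-fst q))))))
                                      (≤-trans full (card-mono H⊆H₀))
          where
          H⊆H₀ : ∀ x → T (H x) → T (H₀ x)
          H⊆H₀ = contained sub sub₀ (≰⇒> λ le → <⇒≱ (card>0 sub) (lin _ _ 0 (2 ⊛ full ⊹ 2 ⊛ *-monoˡ-≤ (card (H ∖ (A ∩ H₀))) 3≤r ⊹ (6 ⊛ card-mono {S = H ∖ H₀} {R = H ∖ (A ∩ H₀)} (λ x p → ∧-intro (∧-fst p) (not-intro (λ q → not-elim (∧-snd {H x} p) (∧-snd {A x} q))))) ⊹ 3 ⊛ le)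
                      (eq r (card H) (card (H ∖ (A ∩ H₀))) (card (H ∖ H₀)))))
            where
            eq : ∀ r h g c → h + (2 * h + 2 * (r * g) + 6 * g + 3 * (2 * c)) + 0 ≡ 0 + (2 * (r * g) + 2 * (3 * g) + 6 * c + 3 * h)
            eq = solve-∀
          H₀⊆H : ∀ x → T (H₀ x) → T (H x)
          H₀⊆H = small-index (δ * coreIndex) (Extraction.TF-mono G (m≤n+m _ coreSize) tf) sub sub₀ H⊆H₀
                   (≤-trans dense (≤-trans (*-monoʳ-≤ δ H-dense) (≤-reflexive (sym (*-assoc δ coreIndex (card H))))))

  -- The part of A outside a family of subgroups

  ramsey : ℕ → ℕ → ℕ
  ramsey k zero = k
  ramsey k (suc m) = ramsey k m * suc (ramsey k m)

  ramsey-≤ : ∀ k {m m'} → m ≤ m' → ramsey k m ≤ ramsey k m'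
  ramsey-≤ k {m} {m'} h with m≤n⇒m<n∨m≡n h
  ... | inj₂ refl = ≤-refl
  ramsey-≤ k {m} {suc m'} h | inj₁ (s≤s lt) = ≤-trans (ramsey-≤ k lt) (m≤m*n (ramsey k m') (suc (ramsey k m')))

  module Residual {n : ℕ} (G : FinAbGroup n) (inv2 : Grp.Invertible G 2) where
    open Grp G
    open Subgroups G
    open Doubling G

    Avoids : PSet n → Fin n → Fin n → Set
    Avoids H x y = ¬ T (H (x ⊕ y))

    length-filters : ∀ (H : PSet n) xs → length xs ≡ length (filter (λ y → T? (H y)) xs) + length (filter (λ y → ¬? (T? (H y))) xs)
    length-filters H [] = refl
    length-filters H (x ∷ xs) with H x
    ... | true = cong suc (length-filters H xs)
    ... | false = trans (cong suc (length-filters H xs)) (sym (+-suc _ _))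

    -- If x + y and x + z lie in H but x does not, then y + z is not in H, since otherwise 2x would be.
    avoid-within : ∀ {H} → IsSub H → ∀ {x y z} → ¬ T (H x) → T (H (x ⊕ y)) → T (H (x ⊕ z)) → Avoids H y z
    avoid-within {H} sub {x} {y} {z} x∉ p q s = x∉ (transport H (proj₂ inv2 x) (IsSub.·∈ sub (proj₁ inv2)
      (transport H (solveG (x ∷ y ∷ z ∷ []) (((:x :+ :y) :+ (:x :+ :z)) :- (:y :+ :z)) (2 :* :x) refl)
        (IsSub.⊖∈ sub (IsSub.+∈ sub p q) s))))

    within : ∀ {H} → IsSub H → ∀ {Q : Fin n → Fin n → Set} {x} → ¬ T (H x) → ∀ {ys} → All (λ y → T (H (x ⊕ y))) ys → AllPairs Q ys → AllPairs (λ y z → Q y z × Avoids H y z) ys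
    within sub x∉ [] [] = []
    within {H} sub x∉ (p ∷ ps) (q ∷ qs) = All.zipWith (λ { (s , u) → s , avoid-within {H} sub x∉ p u }) (q , ps) ∷ within {H} sub x∉ ps qs

    -- Join x and y when x + y is in `H`; by `avoid-within` this graph is triangle-free. Either some
    -- point has L neighbours, which are then independent, or the neighbours of each chosen point
    -- can be discarded cheaply until s independent points are chosen.
    thinOut : ∀ {H} → IsSub H → ∀ L {P : Fin n → Set} {Q : Fin n → Fin n → Set} → (∀ {x} → P x → ¬ T (H x)) → ∀ s xs → All P xs → AllPairs Q xs → s * suc L ≤ length xs →
              ∃ λ ys → All P ys × AllPairs (λ x y → Q x y × Avoids H x y) ys × (L ≤ length ys ⊎ s ≤ length ys)
    thinOut sub L P⇒ zero xs ps qs len = [] , [] , [] , inj₂ z≤n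
    thinOut {H} sub L {P} {Q} P⇒ (suc s) (x ∷ xs) (p ∷ ps) (q ∷ qs) len = choose (L ≤? length near)
      where
      near far : List (Fin n)
      near = filter (λ y → T? (H (x ⊕ y))) xs
      far = filter (λ y → ¬? (T? (H (x ⊕ y)))) xs
      P′ : Fin n → Set
      P′ y = P y × Q x y × Avoids H x y
      choose : Dec (L ≤ length near) → ∃ λ ys → All P ys × AllPairs (λ x y → Q x y × Avoids H x y) ys × (L ≤ length ys ⊎ suc s ≤ length ys)
      choose (yes h) = near , AllP.filter⁺ (λ y → T? (H (x ⊕ y))) ps , within {H} sub (P⇒ p) (AllP.all-filter (λ y → T? (H (x ⊕ y))) xs) (AllPairsP.filter⁺ (λ y → T? (H (x ⊕ y))) qs) , inj₁ h
      choose (no h) = extend (thinOut {H} sub L {P′} {Q} (λ p → P⇒ (proj₁ p)) s far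
          (All.zipWith (λ { (u , v , w) → u , v , w }) (AllP.filter⁺ (λ y → ¬? (T? (H (x ⊕ y)))) ps , All.zip (AllP.filter⁺ (λ y → ¬? (T? (H (x ⊕ y)))) q , AllP.all-filter (λ y → ¬? (T? (H (x ⊕ y)))) xs)))
          (AllPairsP.filter⁺ (λ y → ¬? (T? (H (x ⊕ y)))) qs)
          (lin _ _ 1 (len ⊹ ≰⇒> h ⊹ ≤-reflexive (length-filters (λ y → H (x ⊕ y)) xs)) (eq s L (length near) (length far) (length xs))))
        where
        eq : ∀ s L u v l → s * suc L + (suc l + L + (u + v)) + 1 ≡ v + (suc s * suc L + suc u + l)
        eq = solve-∀
        extend : (∃ λ ys → All P′ ys × AllPairs (λ x y → Q x y × Avoids H x y) ys × (L ≤ length ys ⊎ s ≤ length ys)) → ∃ λ ys → All P ys × AllPairs (λ x y → Q x y × Avoids H x y) ys × (L ≤ length ys ⊎ suc s ≤ length ys)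
        extend (ys , ps , qs , inj₁ h) = ys , All.map proj₁ ps , qs , inj₁ h
        extend (ys , ps , qs , inj₂ h) = x ∷ ys , p ∷ All.map proj₁ ps , All.map proj₂ ps ∷ qs , inj₂ (s≤s h)

    avoidAll : ∀ L Hs → All IsSub Hs → ∀ {P : Fin n → Set} {Q : Fin n → Fin n → Set} → (∀ {x} → P x → ¬ T (⋃L id Hs x)) → ∀ xs → All P xs → AllPairs Q xs → ramsey L (length Hs) ≤ length xs →
               ∃ λ ys → All P ys × AllPairs (λ x y → Q x y × ¬ T (⋃L id Hs (x ⊕ y))) ys × L ≤ length ys
    avoidAll L [] _ P⇒ xs ps qs len = xs , ps , AllPairs.map (λ q → q , λ b → b) qs , len
    avoidAll L (H ∷ Hs) (sub ∷ subs) {P} {Q} P⇒ xs ps qs len = next (thinOut {H} sub L′ {P} {Q} (λ p h → P⇒ p (∨-introˡ h)) L′ xs ps qs len)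
      where
      L′ : ℕ
      L′ = ramsey L (length Hs)
      next : (∃ λ ys → All P ys × AllPairs (λ x y → Q x y × Avoids H x y) ys × (L′ ≤ length ys ⊎ L′ ≤ length ys)) → ∃ λ ys → All P ys × AllPairs (λ x y → Q x y × ¬ T (⋃L id (H ∷ Hs) (x ⊕ y))) ys × L ≤ length ys
      next (ys , ps , qs , len) =
        let zs , ps′ , qs′ , len′ = avoidAll L Hs subs {P} (λ {x} p h → P⇒ p (∨-introʳ {H x} h)) ys ps qs ([ id , id ]′ len)
        in zs , ps′ , AllPairs.map (λ { {x} {y} ((q , a) , b) → q , λ u → [ a , b ]′ (∨-elim {H (x ⊕ y)} u) }) qs′ , len′

    -- Once the sums avoid every subgroup, avoiding the residue is the same as avoiding `A`, where
    -- the bound k applies.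
    residual-bounded : ∀ A k Hs → All IsSub Hs → Bounded A A k → Bounded (A ∖ ⋃L id Hs) (A ∖ ⋃L id Hs) (ramsey k (length Hs))
    residual-bounded A k Hs subs bd xs ps qs = ≰⇒> λ len →
      let ys , ps′ , qs′ , len′ = avoidAll k Hs subs {λ x → T ((A ∖ ⋃L id Hs) x)} {Apart (A ∖ ⋃L id Hs)} (λ {x} p → not-elim (∧-snd {A x} p)) xs ps qs len
      in <⇒≱ (bd ys (All.map ∧-fst ps′) (AllPairs.map (λ { ((ne , out) , u) → ne , λ s → out (∧-intro s (not-intro u)) }) qs′)) len′

    bounded-≤ : ∀ {S A j j'} → j ≤ j' → Bounded S A j → Bounded S A j'
    bounded-≤ h bd xs ps qs = ≤-trans (bd xs ps qs) h

  -- Independent elements from distinct subgroups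

  module Assembly {n : ℕ} (G : FinAbGroup n) (A : PSet n) (k t r : ℕ) (bd : Doubling.Bounded G A A k) (3≤r : 3 ≤ r) (t≤r : t ≤ r) (1≤t : 1 ≤ t) where
    open Grp G
    open Subgroups G
    open SubgroupFacts G
    open Doubling G

    -- If fewer than |H||K| / t^2 pairs have their sum in `A`, then by Markov at most |H| / t
    -- elements of `H` have more than |K| / t such sums.
    δ : ℕ
    δ = t * t

    record Full (H : PSet n) : Set where
      field
        sub : IsSub H
        nontrivial : 1 < card H
        full : r * card (H ∖ A) ≤ card H

    open Full

    Small : PSet n → PSet n → Set
    Small H K = δ * pairs A H K < card H * card K

    module Select (M : ℕ) (tf : TorsionFreeUpTo M) (t≤M : t ≤ M) where

      -- One element is picked greedily from each subgroup. `Q` is what earlier picks forbid; it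
      -- fills at most u / t of each remaining subgroup. A pick b raises u by two, for A - b and for
      -- b itself. The third unit of the budget pays for avoiding the elements that are heavy for a
      -- later subgroup.
      select : ∀ Hs → All Full Hs → AllPairs Small Hs → ∀ u Q → All (λ H → t * card (H ∩ Q) ≤ u * card H) Hs → u + 3 * length Hs < t →
               ∃ λ xs → length xs ≡ length Hs × All (λ x → T (A x)) xs × All (λ x → ¬ T (Q x)) xs × AllPairs (Apart A) xs
      select [] _ _ u Q _ _ = [] , refl , [] , [] , []
      select (H ∷ Hs) (f ∷ fs) (sm ∷ sms) u Q (q ∷ qs) budget = choose good
        where
        Heavy : PSet n → PSet n
        Heavy K b = ⌊ card K <? t * card (K ∩ (λ x → A (b ⊕ x))) ⌋

        heavy-rare : ∀ {K} → Full K → Small H K → t * card (H ∩ Heavy K) ≤ card H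
        heavy-rare {K} fK small = <⇒≤ (*-cancelʳ-< (card K) _ _ (≤-<-trans (≤-reflexive (eq₁ t (card (H ∩ Heavy K)) (card K)))
            (≤-<-trans (*-monoʳ-≤ t (≤-trans (sumOver-≥ {S = H ∩ Heavy K} {f = λ b → t * card (λ x → K x ∧ A (b ⊕ x))} (λ b p → <⇒≤ (toWitness (∧-snd {H b} p))))
              (≤-trans (≤-reflexive (sumOver-* (H ∩ Heavy K) t _)) (*-monoʳ-≤ t part)))) (≤-<-trans (≤-reflexive (sym (*-assoc t t (pairs A H K)))) small))))
          where
          eq₁ : ∀ t x k → t * x * k ≡ t * (k * x)
          eq₁ = solve-∀
          part : sumOver (H ∩ Heavy K) (λ b → card (λ x → K x ∧ A (b ⊕ x))) ≤ pairs A H K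
          part = ≤-trans (≤-reflexive (sumOver-swap (H ∩ Heavy K) K (λ b x → A (b ⊕ x)))) (≤-trans (sumOver-mono {S = K} (λ x _ → card-mono (λ b p → ∧-intro (∧-fst (∧-fst p)) (∧-snd {(H ∩ Heavy K) b} p))))
                   (≤-reflexive (sym (sumOver-swap H K (λ b x → A (b ⊕ x))))))

        U : PSet n
        U = ⋃L Heavy Hs

        heavies : t * card (H ∩ U) ≤ length Hs * card H
        heavies = go Hs fs sm
          where
          go : ∀ Ks → All Full Ks → All (Small H) Ks → t * card (H ∩ ⋃L Heavy Ks) ≤ length Ks * card H
          go [] _ _ = ≤-trans (*-monoʳ-≤ t (≤-trans (card-mono {R = λ _ → false} (λ z p → ∧-snd {H z} p)) (≤-reflexive card-empty))) (≤-reflexive (*-zeroʳ t))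
          go (K ∷ Ks) (fK ∷ fKs) (s ∷ ss) = ≤-trans (*-monoʳ-≤ t (card-cover {R = H ∩ Heavy K} {Q = H ∩ ⋃L Heavy Ks}
               (λ z p → [ (λ v → inj₁ (∧-intro (∧-fst p) v)) , (λ v → inj₂ (∧-intro (∧-fst p) v)) ]′ (∨-elim {Heavy K z} (∧-snd {H z} p)))))
            (≤-trans (≤-reflexive (*-distribˡ-+ t (card (H ∩ Heavy K)) (card (H ∩ ⋃L Heavy Ks)))) (+-mono-≤ (heavy-rare fK s) (go Ks fKs ss)))

        Good : PSet n
        Good b = H b ∧ (A b ∧ (not (Q b) ∧ not (U b)))

        good : ∃ λ b → T (Good b)
        good = someElement (n≢0⇒n>0 (λ none → <⇒≱ (*-monoˡ-< (card H) {{>-nonZero (card>0 (sub f))}} few)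
            (lin _ _ 0 (t ⊛ cover ⊹ t ⊛ ≤-reflexive none ⊹ *-monoˡ-≤ (card (H ∖ A)) t≤r ⊹ full f ⊹ q ⊹ heavies)
              (eq t r (card H) (card Good) (card (H ∖ A)) (card (H ∩ Q)) (card (H ∩ U)) u (length Hs)))))
          where
          few : 1 + u + length Hs < t
          few = ≤-<-trans (≤-trans (m≤m+n (1 + u + length Hs) (2 + 2 * length Hs)) (≤-reflexive (eq₂ u (length Hs)))) budget
            where
            eq₂ : ∀ u l → 1 + u + l + (2 + 2 * l) ≡ u + 3 * suc l
            eq₂ = solve-∀
          eq : ∀ t r h g x y z u l → t * h + (t * (g + (x + (y + z))) + t * 0 + r * x + h + u * h + l * h) + 0 ≡ (1 + u + l) * h + (t * h + t * g + t * x + r * x + t * y + t * z)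
          eq = solve-∀
          cover : card H ≤ card Good + (card (H ∖ A) + (card (H ∩ Q) + card (H ∩ U)))
          cover = ≤-trans (card-cover {R = Good} {Q = λ b → (H ∖ A) b ∨ ((H ∩ Q) b ∨ (H ∩ U) b)} go)
            (+-monoʳ-≤ (card Good) (≤-trans (card-cover {R = H ∖ A} {Q = λ b → (H ∩ Q) b ∨ (H ∩ U) b} (λ b p → ∨-elim {(H ∖ A) b} p))
              (+-monoʳ-≤ (card (H ∖ A)) (card-cover (λ b p → ∨-elim {(H ∩ Q) b} p)))))
            where
            go : ∀ b → T (H b) → T (Good b) ⊎ T ((H ∖ A) b ∨ ((H ∩ Q) b ∨ (H ∩ U) b))
            go b h with T? (A b) | T? (Q b) | T? (U b)
            ... | no ¬a | _ | _ = inj₂ (∨-introˡ {(H ∖ A) b} (∧-intro {H b} h (not-intro ¬a)))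
            ... | yes a | yes q | _ = inj₂ (∨-introʳ {(H ∖ A) b} (∨-introˡ {(H ∩ Q) b} (∧-intro {H b} h q)))
            ... | yes a | no ¬q | yes v = inj₂ (∨-introʳ {(H ∖ A) b} (∨-introʳ {(H ∩ Q) b} (∧-intro {H b} h v)))
            ... | yes a | no ¬q | no ¬v = inj₁ (∧-intro {H b} h (∧-intro {A b} a (∧-intro {not (Q b)} (not-intro ¬q) (not-intro ¬v))))

        choose : (∃ λ b → T (Good b)) → ∃ λ xs → length xs ≡ suc (length Hs) × All (λ x → T (A x)) xs × All (λ x → ¬ T (Q x)) xs × AllPairs (Apart A) xs
        choose (b , p) = let xs , len , inA , outQ , apart = select Hs fs sms (2 + u) Q′ (forbidden Hs fs qs light) budget′ in
            b ∷ xs , cong suc len , b∈A ∷ inA , b∉Q ∷ All.map (λ {x} o s → o (∨-introˡ {Q x} s)) outQ ,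
            All.map (λ {x} o → (λ e → o (∨-introʳ {Q x} (∨-introʳ {A (b ⊕ x)} (fromWitness e)))) , (λ s → o (∨-introʳ {Q x} (∨-introˡ {A (b ⊕ x)} s)))) outQ ∷ apart
          where
          b∈A : T (A b)
          b∈A = ∧-fst {A b} (∧-snd {H b} p)
          b∉Q : ¬ T (Q b)
          b∉Q = not-elim (∧-fst {not (Q b)} (∧-snd {A b} (∧-snd {H b} p)))
          b∉U : ¬ T (U b)
          b∉U = not-elim (∧-snd {not (Q b)} (∧-snd {A b} (∧-snd {H b} p)))
          Q′ : PSet n
          Q′ x = Q x ∨ (A (b ⊕ x) ∨ ⌊ b ≟ᶠ x ⌋)
          budget′ : 2 + u + 3 * length Hs < t
          budget′ = ≤-<-trans (≤-trans (n≤1+n _) (≤-reflexive (eq u (length Hs)))) budget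
            where
            eq : ∀ u l → suc (2 + u + 3 * l) ≡ u + 3 * suc l
            eq = solve-∀
          light : All (λ K → t * card (K ∩ (λ x → A (b ⊕ x))) ≤ card K) Hs
          light = go Hs b∉U
            where
            go : ∀ Ks → ¬ T (⋃L Heavy Ks b) → All (λ K → t * card (K ∩ (λ x → A (b ⊕ x))) ≤ card K) Ks
            go [] _ = []
            go (K ∷ Ks) v = ≮⇒≥ (λ lt → v (∨-introˡ {Heavy K b} (fromWitness lt))) ∷ go Ks (λ w → v (∨-introʳ {Heavy K b} w))
          forbidden : ∀ Ks → All Full Ks → All (λ K → t * card (K ∩ Q) ≤ u * card K) Ks → All (λ K → t * card (K ∩ (λ x → A (b ⊕ x))) ≤ card K) Ks → All (λ K → t * card (K ∩ Q′) ≤ (2 + u) * card K) Ks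
          forbidden [] _ _ _ = []
          -- |K| > M ≥ t, so the single point b is at most a fraction 1 / t of `K`.
          forbidden (K ∷ Ks) (fK ∷ fKs) (x ∷ xs) (y ∷ ys) = lin _ _ 0 (t ⊛ cover ⊹ x ⊹ y ⊹ <⇒≤ (≤-<-trans t≤M (large M tf (sub fK) (nontrivial fK)))) (eq t (card (K ∩ Q′)) (card (K ∩ Q)) (card (K ∩ (λ x → A (b ⊕ x)))) u (card K)) ∷ forbidden Ks fKs xs ys
            where
            eq : ∀ t c x y u k → t * c + (t * (x + (y + 1)) + u * k + k + k) + 0 ≡ (2 + u) * k + (t * c + t * x + t * y + t)
            eq = solve-∀
            cover : card (K ∩ Q′) ≤ card (K ∩ Q) + (card (K ∩ (λ x → A (b ⊕ x))) + 1)
            cover = ≤-trans (card-cover {R = K ∩ Q} {Q = λ x → K x ∧ (A (b ⊕ x) ∨ ⌊ b ≟ᶠ x ⌋)} (λ z v → [ (λ a → inj₁ (∧-intro (∧-fst {K z} v) a)) , (λ a → inj₂ (∧-intro (∧-fst {K z} v) a)) ]′ (∨-elim {Q z} (∧-snd {K z} v))))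
              (+-monoʳ-≤ (card (K ∩ Q)) (≤-trans (card-cover {R = K ∩ (λ x → A (b ⊕ x))} {Q = λ x → ⌊ b ≟ᶠ x ⌋} (λ z v → [ (λ a → inj₁ (∧-intro (∧-fst {K z} v) a)) , inj₂ ]′ (∨-elim {A (b ⊕ z)} (∧-snd {K z} v))))
                (+-monoʳ-≤ (card (K ∩ (λ x → A (b ⊕ x)))) (card≤1 b (λ x v → sym (toWitness v))))))

      few-subgroups : ∀ Hs → All Full Hs → AllPairs Small Hs → 3 * k < t → length Hs < k
      few-subgroups Hs fs sms budget = ≰⇒> λ le →
        let xs , len , inA , _ , apart = select (take k Hs) (AllP.take⁺ k fs) (AllPairsP.take⁺ k sms) 0 (λ _ → false) (All.universal (λ H → none H) _)
                                           (subst (λ l → 3 * l < t) (sym (trans (length-take k Hs) (m≤n⇒m⊓n≡m le))) budget)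
        in <-irrefl (trans len (trans (length-take k Hs) (m≤n⇒m⊓n≡m le))) (bd xs inA apart)
        where
        none : ∀ H → t * card (H ∩ (λ _ → false)) ≤ 0
        none H = ≤-trans (*-monoʳ-≤ t (≤-trans (card-mono {R = λ _ → false} (λ z p → ∧-snd {H z} p)) (≤-reflexive card-empty))) (≤-reflexive (*-zeroʳ t))

  data Without {A : Set} (y : A) : List A → List A → Set where
    here : ∀ {xs} → Without y (y ∷ xs) xs
    there : ∀ {x xs ys} → Without y xs ys → Without y (x ∷ xs) (x ∷ ys)

  Without-All : ∀ {A : Set} {P : A → Set} {y xs ys} → Without y xs ys → All P xs → P y × All P ys
  Without-All here (p ∷ ps) = p , ps
  Without-All (there w) (p ∷ ps) = let q , qs = Without-All w ps in q , p ∷ qs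

  Without-AllPairs : ∀ {A : Set} {R : A → A → Set} {y xs ys} → Without y xs ys → AllPairs R xs → AllPairs R ys
  Without-AllPairs here (p ∷ ps) = ps
  Without-AllPairs (there w) (p ∷ ps) = proj₂ (Without-All w p) ∷ Without-AllPairs w ps

  Without-length : ∀ {A : Set} {y : A} {xs ys} → Without y xs ys → length xs ≡ suc (length ys)
  Without-length here = refl
  Without-length (there w) = cong suc (Without-length w)

  Without-⋃ : ∀ {n} {K : PSet n} {xs ys z} → Without K xs ys → T (⋃L id xs z) → T (K z) ⊎ T (⋃L id ys z)
  Without-⋃ {K = K} {z = z} here p = ∨-elim {K z} p
  Without-⋃ {z = z} (there {x} w) p = [ (λ q → inj₂ (∨-introˡ {x z} q)) , (λ q → [ inj₁ , (λ s → inj₂ (∨-introʳ {x z} s)) ]′ (Without-⋃ w q)) ]′ (∨-elim {x z} p)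

  search : ∀ {A : Set} {R : A → Set} → (∀ x → Dec (R x)) → ∀ xs → All R xs ⊎ ∃₂ λ y ys → Without y xs ys × ¬ R y
  search R? [] = inj₁ []
  search R? (x ∷ xs) with R? x | search R? xs
  ... | no ¬r | _ = inj₂ (x , xs , here , ¬r)
  ... | yes r | inj₁ rs = inj₁ (r ∷ rs)
  ... | yes r | inj₂ (y , ys , w , ¬s) = inj₂ (y , x ∷ ys , there w , ¬s)

  module Collect {n : ℕ} (G : FinAbGroup n) (A : PSet n) (k t r : ℕ) (bd : Doubling.Bounded G A A k) (3≤r : 3 ≤ r) (t≤r : t ≤ r) (1≤t : 1 ≤ t)
                 (zo : ∀ S → Subgroups.IsSub G S → 1 < card S → card S ≤ t * t * card (A ∩ S) → r * card (S ∖ A) ≤ card S) where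
    open Grp G
    open Subgroups G
    open SubgroupFacts G
    open Doubling G
    open Assembly G A k t r bd 3≤r t≤r 1≤t
    open Full

    residue : List (PSet n) → PSet n
    residue Hs = A ∖ ⋃L id Hs

    record Family : Set where
      constructor family
      field
        Hs : List (PSet n)
        fulls : All Full Hs
        smalls : AllPairs Small Hs

    open Family

    Covers : Family → PSet n → Set
    Covers F S = ∀ z → T (S z) → T (⋃L id (Hs F) z)

    -- Many sums in `A` make `A` dense in H + K, to which the 0-1 law then applies.
    merge : ∀ {H K} → Full H → Full K → ¬ Small H K → ∃ λ S → Full S × (∀ z → T (H z) → T (S z)) × (∀ z → T (K z) → T (S z))
    merge {H} {K} fH fK big = Σs.S , record
        { sub = Σs.S-sub ; nontrivial = ≤-trans (nontrivial fH) (card-mono Σs.H⊆S)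
        ; full = zo Σs.S Σs.S-sub (≤-trans (nontrivial fH) (card-mono Σs.H⊆S)) (Σs.dense-in-S A δ (≮⇒≥ big)) } , Σs.H⊆S , Σs.K⊆S
      where
      module Σs = SubgroupFacts.Sum G (sub fH) (sub fK)

    -- A merge takes one member out of the list before the sum is inserted again, so the bound `f`
    -- on the length decreases.
    insert : ∀ f (F : Family) → length (Hs F) ≤ f → ∀ H → Full H → ∃ λ F′ → Covers F′ H × Covers F′ (⋃L id (Hs F))
    insert f F len H fH = choose f len (search (λ K → δ * pairs A H K <? card H * card K) (Hs F))
      where
      choose : ∀ f → length (Hs F) ≤ f → All (Small H) (Hs F) ⊎ (∃₂ λ K Ks → Without K (Hs F) Ks × ¬ Small H K) → ∃ λ F′ → Covers F′ H × Covers F′ (⋃L id (Hs F))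
      choose f len (inj₁ sm) = family (H ∷ Hs F) (fH ∷ fulls F) (sm ∷ smalls F) , (λ z p → ∨-introˡ p) , (λ z p → ∨-introʳ {H z} p)
      choose zero len (inj₂ (K , Ks , w , big)) = ⊥-elim (n≮0 (≤-trans (≤-reflexive (sym (Without-length w))) len))
      choose (suc f) len (inj₂ (K , Ks , w , big)) =
        let fK , fKs = Without-All w (fulls F)
            S , fS , H⊆S , K⊆S = merge fH fK big
            F′ , coversS , coversKs = insert f (family Ks fKs (Without-AllPairs w (smalls F))) (≤-pred (≤-trans (≤-reflexive (sym (Without-length w))) len)) S fS
        in F′ , (λ z p → coversS z (H⊆S z p)) , λ z p → [ (λ q → coversS z (K⊆S z q)) , coversKs z ]′ (Without-⋃ w p)

    module Exhaust (C : ℕ) (step : ∀ F → C < card (residue (Hs F)) → ∃ λ H → Full H × ∃ λ z → T (H z) × T (residue (Hs F) z)) where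
      exhaust : ∀ f F → card (residue (Hs F)) ≤ f → ∃ λ F′ → card (residue (Hs F′)) ≤ C
      exhaust f F le with card (residue (Hs F)) ≤? C
      exhaust f F le | yes small = F , small
      exhaust zero F le | no big = ⊥-elim (big (≤-trans le z≤n))
      exhaust (suc f) F le | no big =
        let H , fH , z , z∈H , z∈R = step F (≰⇒> big)
            F′ , coversH , coversF = insert (length (Hs F)) F ≤-refl H fH
            shrink : card (residue (Hs F′)) < card (residue (Hs F))
            shrink = ≤-trans (m<n+m (card (residue (Hs F′))) (element⇒card>0 {S = λ y → residue (Hs F) y ∧ H y} z (∧-intro z∈R z∈H)))
              (card-disjoint (λ y p q → not-elim (∧-snd {A y} q) (coversH y (∧-snd {residue (Hs F) y} p))) (λ y p → ∧-fst p)
                (λ y q → ∧-intro (∧-fst {A y} q) (not-intro (λ s → not-elim (∧-snd {A y} q) (coversF y s)))))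
        in exhaust f F′ (≤-pred (≤-trans shrink le))

    -- An element x of A outside the family, together with one element from each subgroup, would be a sum-avoiding set.
    module Complete (M C : ℕ) (tf : TorsionFreeUpTo M) (M≥ : t + 2 * t * (1 + C) + 2 * t * k ≤ M) (1≤k : 1 ≤ k) (budget : 3 + 3 * k < t) where
      complete : ∀ F → card (residue (Hs F)) ≤ C → length (Hs F) + 1 ≡ k → ∀ x → ¬ T (residue (Hs F) x)
      complete F small len x x∈R =
        let ys , lys , inA , outQ , apart = Select.select M tf (≤-trans (≤-trans (m≤m+n t (2 * t * (1 + C))) (m≤m+n _ (2 * t * k))) M≥) (Hs F) (fulls F) (smalls F) 1 Q
                                              (All.map (λ {H} → light H) (zipAll (fulls F)))
                                              (≤-<-trans (+-mono-≤ (s≤s (z≤n {2})) (*-monoʳ-≤ 3 (≤-trans (m≤m+n _ 1) (≤-reflexive len)))) budget)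
        in <-irrefl (trans (cong suc lys) (trans (+-comm 1 (length (Hs F))) len))
             (bd (x ∷ ys) (∧-fst x∈R ∷ inA) (All.map (λ {y} o → (λ e → o (∨-introʳ {A (x ⊕ y)} (fromWitness e))) , (λ s → o (∨-introˡ s))) outQ ∷ apart))
        where
        Q : PSet n
        Q y = A (x ⊕ y) ∨ ⌊ x ≟ᶠ y ⌋
        zipAll : ∀ {Ks} → All Full Ks → All (λ H → Full H × (T (H x) → T (⋃L id Ks x))) Ks
        zipAll [] = []
        zipAll {K ∷ Ks} (f ∷ fs) = (f , λ p → ∨-introˡ p) ∷ All.map (λ { (g , h) → g , λ p → ∨-introʳ {K x} (h p) }) (zipAll fs)
        -- For y in `H` with x + y in `A`, the sum is in the residue, which has at most C elements,
        -- or in some member `K`. The latter y form a coset of `H ∩ K`; if it were large, `H` would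
        -- lie in `K`, and x with it.
        light : ∀ H → Full H × (T (H x) → T (⋃L id (Hs F) x)) → t * card (H ∩ Q) ≤ 1 * card H
        light H (f , x∈H⇒) = *-cancelˡ-≤ 2 (lin _ _ 0 ((2 * t) ⊛ cover ⊹ (2 * t) ⊛ small ⊹ (2 * t) ⊛ card-⋃L-∩ H piece (card H / (2 * t * k)) (Hs F) (All.map (λ {K} (g , h) → rare K (sub g) (λ p → not-elim (∧-snd {A x} x∈R) (h p))) (zipAll (fulls F)))
                ⊹ (2 * t * (card H / (2 * t * k))) ⊛ few ⊹ */≤ (2 * t * k) (card H) ⊹ C-small)
                (eq t C k (card (H ∩ Q)) (card (residue (Hs F))) (card (H ∩ ⋃L piece (Hs F))) (length (Hs F)) (card H / (2 * t * k)) (card H)))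
          where
          instance
            nz : NonZero (2 * t * k)
            nz = >-nonZero (*-mono-≤ {1} {2 * t} {1} {k} (≤-trans 1≤t (m≤n*m t 2)) 1≤k)
          M<H : M < card H
          M<H = large M tf (sub f) (nontrivial f)
          few : length (Hs F) ≤ k
          few = ≤-trans (m≤m+n _ 1) (≤-reflexive len)
          C-small : 2 * t * (1 + C) ≤ card H
          C-small = ≤-trans (≤-trans (≤-trans (m≤n+m _ t) (m≤m+n _ (2 * t * k))) M≥) (<⇒≤ M<H)
          piece : PSet n → PSet n
          piece K y = K (x ⊕ y)
          cover : card (H ∩ Q) ≤ 1 + (card (residue (Hs F)) + card (H ∩ ⋃L piece (Hs F)))
          cover = ≤-trans (card-cover {R = λ y → ⌊ x ≟ᶠ y ⌋} {Q = λ y → residue (Hs F) (x ⊕ y) ∨ (H ∩ ⋃L piece (Hs F)) y} go)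
            (+-mono-≤ (card≤1 x (λ y p → sym (toWitness p))) (≤-trans (card-cover {R = λ y → residue (Hs F) (x ⊕ y)} {Q = H ∩ ⋃L piece (Hs F)} (λ y p → ∨-elim {residue (Hs F) (x ⊕ y)} p))
              (+-monoˡ-≤ (card (H ∩ ⋃L piece (Hs F))) (card-shift x (λ y p → subst (λ s → T (residue (Hs F) s)) (⊕-comm x y) p)))))
            where
            translate : ∀ Ks {y} → T (⋃L id Ks (x ⊕ y)) → T (⋃L piece Ks y)
            translate (K ∷ Ks) {y} p = [ (λ q → ∨-introˡ q) , (λ q → ∨-introʳ {K (x ⊕ y)} (translate Ks q)) ]′ (∨-elim {K (x ⊕ y)} p)
            go : ∀ y → T ((H ∩ Q) y) → T ⌊ x ≟ᶠ y ⌋ ⊎ T (residue (Hs F) (x ⊕ y) ∨ (H ∩ ⋃L piece (Hs F)) y)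
            go y p with ∨-elim {A (x ⊕ y)} (∧-snd {H y} p)
            ... | inj₂ q = inj₁ q
            ... | inj₁ q with T? (⋃L id (Hs F) (x ⊕ y))
            ... | yes s = inj₂ (∨-introʳ {residue (Hs F) (x ⊕ y)} (∧-intro {H y} (∧-fst {H y} p) (translate (Hs F) s)))
            ... | no ¬s = inj₂ (∨-introˡ {residue (Hs F) (x ⊕ y)} (∧-intro {A (x ⊕ y)} q (not-intro ¬s)))
          rare : ∀ K → IsSub K → ¬ T (K x) → card (H ∩ piece K) ≤ card H / (2 * t * k)
          rare K subK x∉K = ≤/ (2 * t * k) (≮⇒≥ λ lt → heavy lt (someElement (pos-factorʳ (2 * t * k) (≤-trans (s≤s z≤n) lt))))
            where
            heavy : card H < 2 * t * k * card (H ∩ piece K) → ¬ ∃ λ y → T ((H ∩ piece K) y)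
            heavy lt (y , p) = x∉K (transport K (⊕-⊖ x y) (IsSub.⊖∈ subK (∧-snd {H y} p)
              (∧-snd {H y} (small-index M tf (∩-sub (sub f) subK) (sub f) (λ z → ∧-fst)
                (≤-trans (<⇒≤ lt) (*-mono-≤ (≤-trans (m≤n+m _ (t + 2 * t * (1 + C))) M≥) (card-unshift y (λ z q → ∧-intro (IsSub.⊖∈ (sub f) (∧-fst q) (∧-fst p))
                  (transport K (solveG (x ∷ z ∷ y ∷ []) ((:x :+ :y) :- (:x :+ :z)) (:y :- :z) refl) (IsSub.⊖∈ subK (∧-snd {H z} q) (∧-snd {H y} p)))))))
                y (∧-fst p)))))
          eq : ∀ t C k q R p l d h → 2 * (t * q) + (2 * t * (1 + (R + p)) + 2 * t * C + 2 * t * (l * d) + 2 * t * d * k + h + h) + 0 ≡ 2 * (1 * h) + (2 * t * q + 2 * t * R + 2 * t * p + 2 * t * d * l + 2 * t * k * d + 2 * t * (1 + C))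
          eq = solve-∀

  -- Rational densities, the constants and the final answer

  denominator : ℚ → ℕ
  denominator (mkℚ _ d _) = suc d

  integer-core : ∀ p d h s → d * h < s * suc d → (ℤ.+ suc d ℤ.- ℤ.+ suc p) ℤ.* ℤ.+ h ℤ.< ℤ.+ s ℤ.* ℤ.+ suc d
  integer-core p d h s lt = ℤP.≤-<-trans (ℤP.*-monoʳ-≤-nonNeg (ℤ.+ h) num≤) (subst₂ ℤ._<_ (ℤP.pos-* d h) (ℤP.pos-* s (suc d)) (ℤ.+<+ lt))
    where
    num≤ : ℤ.+ suc d ℤ.- ℤ.+ suc p ℤ.≤ ℤ.+ d
    num≤ = ℤP.≤-trans (ℤP.≤-reflexive (trans (ℤP.m-n≡m⊖n (suc d) (suc p)) (ℤP.[1+m]⊖[1+n]≡m⊖n d p))) (ℤP.m⊖n≤m d p)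

  -- With ε ≥ 1 / q, having g missing points out of h, (q + 1) g ≤ h, leaves more than (1 - ε) h.
  density-bound : ∀ ε → 0ℚ <ℚ ε → ∀ h g s → 0 < h → suc (denominator ε) * g ≤ h → h ≤ s + g → ((1ℚ - ε) *ℚ (ℤ.+ h /ℚ 1)) <ℚ (ℤ.+ s /ℚ 1)
  density-bound (mkℚ (ℤ.+ zero) d _) (*<* (ℤ.+<+ lt)) = ⊥-elim (n≮0 lt)
  density-bound (mkℚ (ℤ.-[1+ p ]) d _) (*<* ())
  density-bound ε@(mkℚ (ℤ.+ suc p) d _) _ h g s 0<h few enough = ℚP.toℚᵘ-cancel-< (ℚᵘP.<-respˡ-≃ (ℚᵘP.≃-sym lhs) (ℚᵘP.<-respʳ-≃ (ℚᵘP.≃-sym (ℚP.toℚᵘ-fromℚᵘ (mkℚᵘ (ℤ.+ s) 0))) core))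
    where
    lhs : toℚᵘ ((1ℚ - ε) *ℚ (ℤ.+ h /ℚ 1)) ≃ (ℚᵘ.1ℚᵘ ℚᵘ.- mkℚᵘ (ℤ.+ suc p) d) ℚᵘ.* mkℚᵘ (ℤ.+ h) 0
    lhs = ℚᵘP.≃-trans (ℚP.toℚᵘ-homo-* (1ℚ - ε) (ℤ.+ h /ℚ 1)) (ℚᵘP.*-cong (ℚᵘP.≃-trans (ℚP.toℚᵘ-homo-+ 1ℚ (ℚ.- ε)) (ℚᵘP.+-cong {ℚᵘ.1ℚᵘ} {ℚᵘ.1ℚᵘ} ℚᵘP.≃-refl (ℚP.toℚᵘ-homo‿- ε))) (ℚP.toℚᵘ-fromℚᵘ (mkℚᵘ (ℤ.+ h) 0)))
    -- The coefficient one above the denominator makes the inequality strict; for g = 0 the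
    -- strictness comes from 0 < h.
    few′ : ∀ g → suc (suc d) * g ≤ h → suc d * g < h
    few′ zero _ = ≤-trans (s≤s (≤-reflexive (*-zeroʳ (suc d)))) 0<h
    few′ (suc g) le = ≤-trans (s≤s (m≤n+m (suc d * suc g) g)) le
    counting : d * h < s * suc d
    counting = lin _ _ 0 (suc d ⊛ enough ⊹ few′ g few) (eq d h s g)
      where
      eq : ∀ d h s g → suc (d * h) + (suc d * (s + g) + h) + 0 ≡ s * suc d + (suc d * h + suc (suc d * g))
      eq = solve-∀
    core : (ℚᵘ.1ℚᵘ ℚᵘ.- mkℚᵘ (ℤ.+ suc p) d) ℚᵘ.* mkℚᵘ (ℤ.+ h) 0 ℚᵘ.< mkℚᵘ (ℤ.+ s) 0
    core = *<*ᵘ (subst₂ ℤ._<_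
      (trans (cong (ℤ._* ℤ.+ h) (cong₂ ℤ._+_ (sym (ℤP.*-identityˡ (ℤ.+ suc d))) (sym (ℤP.*-identityʳ (ℤ.-[1+ p ]))))) (sym (ℤP.*-identityʳ _)))
      (cong (λ x → ℤ.+ s ℤ.* ℤ.+ x) (eq d)) (integer-core p d h s counting))
      where
      eq : ∀ d → suc d ≡ suc ((d + 0) * 1)
      eq d = cong suc (sym (trans (*-identityʳ (d + 0)) (+-identityʳ d)))

  members-⋃ : ∀ {n} (Hs : List (PSet n)) x → members (⋃ (tabulate (λ i → toSubset (lookup Hs i)))) x ≡ ⋃L id Hs x
  members-⋃ [] x = lookup-replicate x false
  members-⋃ (H ∷ Hs) x = trans (lookup-zipWith _∨_ x (toSubset H) _) (cong₂ _∨_ (members-toSubset H x) (members-⋃ Hs x))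

  ─-out : ∀ {n} (A B : Subset n) x → T (members (A ─ B) x) → T (members A x) × ¬ T (members B x)
  ─-out (a ∷ A) (true ∷ B) zero ()
  ─-out (a ∷ A) (false ∷ B) zero p = p , id
  ─-out (a ∷ A) (true ∷ B) (suc x) p = ─-out A B x p
  ─-out (a ∷ A) (false ∷ B) (suc x) p = ─-out A B x p

  module Main (k : ℕ) (ε : ℚ) (0<ε : 0ℚ <ℚ ε) where
    -- `t` pays for k picks at cost 3 and for one further element. `k′` bounds φ on the residue. In
    -- `C`, twice the core index makes any subgroup found in a larger residue nontrivial. `M`
    -- collects all requirements on torsion.
    t r k′ C M : ℕ
    t = 4 + 3 * k
    r = t + suc (denominator ε) + 3
    k′ = ramsey k k
    C = Constants.coreSize k′ r + 2 * Constants.coreIndex k′ r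
    M = t + 2 * t * (1 + C) + 2 * t * k + (Constants.coreSize k r + t * t * Constants.coreIndex k r) + t * t * Constants.coreSize k r + Constants.coreSize k′ r

    3≤r : 3 ≤ r
    3≤r = m≤n+m 3 (t + suc (denominator ε))

    t≤r : t ≤ r
    t≤r = ≤-trans (m≤m+n t (suc (denominator ε))) (m≤m+n _ 3)

    module Structure {n : ℕ} (G : FinAbGroup n) (A : PSet n) (bd : Doubling.Bounded G A A k) (tf : Grp.TorsionFreeUpTo G M) where
      open Grp G
      open Subgroups G
      open SubgroupFacts G
      open Doubling G

      abstract
        within-M : ∀ a b c d e f → a ≤ a + b + c + d + e + f × a + b + c ≤ a + b + c + d + e + f × d ≤ a + b + c + d + e + f × e ≤ a + b + c + d + e + f × f ≤ a + b + c + d + e + f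
        within-M a b c d e f =
          ≤-trans (≤-trans (m≤m+n a b) (m≤m+n _ c)) abc ,
          abc ,
          ≤-trans (m≤n+m d (a + b + c)) (≤-trans (m≤m+n _ e) (m≤m+n _ f)) ,
          ≤-trans (m≤n+m e (a + b + c + d)) (m≤m+n _ f) ,
          m≤n+m f _
          where
          abc : a + b + c ≤ a + b + c + d + e + f
          abc = ≤-trans (m≤m+n _ d) (≤-trans (m≤m+n _ e) (m≤m+n _ f))

        bounds : t ≤ M × t + 2 * t * (1 + C) + 2 * t * k ≤ M × Constants.coreSize k r + t * t * Constants.coreIndex k r ≤ M × t * t * Constants.coreSize k r ≤ M × Constants.coreSize k′ r ≤ M
        bounds = within-M t (2 * t * (1 + C)) (2 * t * k) (Constants.coreSize k r + t * t * Constants.coreIndex k r) (t * t * Constants.coreSize k r) (Constants.coreSize k′ r)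

        tf-mono : ∀ {M'} → M' ≤ M → TorsionFreeUpTo M'
        tf-mono h = Extraction.TF-mono G h tf

        1≤k : 1 ≤ k
        1≤k = bd [] [] []

        zo : ∀ S → IsSub S → 1 < card S → card S ≤ t * t * card (A ∩ S) → r * card (S ∖ A) ≤ card S
        zo S sub big dense = ZeroOneLaw.zero-one G k r 3≤r (t * t) A S bd sub
          (≤-trans (proj₁ (proj₂ (proj₂ (proj₂ bounds)))) (<⇒≤ (large M tf sub big))) (s≤s z≤n) dense (tf-mono (proj₁ (proj₂ (proj₂ bounds))))

      open Collect G A k t r bd 3≤r t≤r (s≤s z≤n) zo public
      open Assembly G A k t r bd 3≤r t≤r (s≤s z≤n) public using (Full; module Full; module Select)
      open Family public

      abstract
        few : ∀ F → length (Hs F) < k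
        few F = Select.few-subgroups M tf (proj₁ bounds) (Hs F) (fulls F) (smalls F) (m<n+m (3 * k) {4} (s≤s z≤n))

        subs : ∀ {Ks} → All Full Ks → All IsSub Ks
        subs = All.map Full.sub

        step : ∀ F → C < card (residue (Hs F)) → ∃ λ H → Full H × ∃ λ z → T (H z) × T (residue (Hs F) z)
        step F big =
          let H , sub , dense , full = Core.core G k′ r (≤-trans (s≤s z≤n) 3≤r) R (≤-trans (m≤m+n _ _) (<⇒≤ big)) (tf-mono (proj₂ (proj₂ (proj₂ (proj₂ bounds))))) bdR
          in H , record { sub = sub ; nontrivial = nontrivial dense
                        ; full = ≤-trans (*-monoʳ-≤ r (card-mono {S = H ∖ A} {R = H ∖ R} (λ x p → ∧-intro {H x} (∧-fst p) (not-intro (λ q → not-elim (∧-snd {H x} p) (∧-fst {A x} q)))))) full } ,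
             meets H sub full
          where
          R : PSet n
          R = residue (Hs F)
          bdR : Bounded R R k′
          bdR = Residual.bounded-≤ G (tf 2 (s≤s z≤n) (≤-trans (s≤s (s≤s z≤n)) (proj₁ bounds))) {R} {R} (ramsey-≤ k (<⇒≤ (few F)))
                  (Residual.residual-bounded G (tf 2 (s≤s z≤n) (≤-trans (s≤s (s≤s z≤n)) (proj₁ bounds))) A k (Hs F) (subs (fulls F)) bd)
          nontrivial : ∀ {h} → card R ≤ Constants.coreIndex k′ r * h → 1 < h
          nontrivial {h} dense = <-trans ≤-refl (*-cancelˡ-< (Constants.coreIndex k′ r) 2 h (≤-<-trans (≤-trans (≤-reflexive (*-comm (Constants.coreIndex k′ r) 2)) (m≤n+m _ (Constants.coreSize k′ r))) (≤-trans big dense)))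
          meets : ∀ H → IsSub H → r * card (H ∖ R) ≤ card H → ∃ λ z → T (H z) × T (R z)
          meets H sub full = split (someElement {S = H ∩ R} (n≢0⇒n>0 (λ none → <⇒≱ (card>0 sub) (*-cancelˡ-≤ 2 {{_}}
              (lin _ _ 0 (full ⊹ *-monoˡ-≤ (card (H ∖ R)) 3≤r ⊹ 3 ⊛ card-split H R ⊹ 3 ⊛ ≤-reflexive none) (eq r (card H) (card (H ∖ R)) (card (H ∩ R))))))))
            where
            eq : ∀ r h g c → 2 * h + (h + r * g + 3 * (c + g) + 3 * 0) + 0 ≡ 2 * 0 + (r * g + 3 * g + 3 * h + 3 * c)
            eq = solve-∀
            split : (∃ λ z → T ((H ∩ R) z)) → ∃ λ z → T (H z) × T (R z)
            split (z , p) = z , ∧-fst {H z} p , ∧-snd {H z} p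

        structure : ∃ λ F → card (residue (Hs F)) ≤ C × (length (Hs F) + 1 ≡ k → ∀ x → ¬ T (residue (Hs F) x))
        structure = let F , small = Exhaust.exhaust C step (card (residue [])) (family [] [] []) ≤-refl
                    in F , small , Complete.complete M C tf (proj₁ (proj₂ bounds)) 1≤k (n<1+n (3 + 3 * k)) F small

    module Answer {n : ℕ} (G : FinAbGroup n) (A : Subset n) (bd : Doubling.Bounded G (members A) (members A) k) (tf : Grp.TorsionFreeUpTo G M) where
      open Structure G (members A) bd tf

      H : ∀ Ks → Fin (length Ks) → Subset n
      H Ks i = toSubset (lookup Ks i)

      member-H : ∀ Ks i x → members (H Ks i) x ≡ lookup Ks i x
      member-H Ks i = members-toSubset (lookup Ks i)

      fullAt : ∀ {Ks} → All Full Ks → ∀ i → Full (lookup Ks i)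
      fullAt {Ks} fs i = All.lookup fs (∈-lookup {xs = Ks} i)

      isSubgroup : ∀ Ks → All Full Ks → ∀ i → IsSubgroup G (H Ks i)
      isSubgroup Ks fs i = to 0∈ , (λ p q → to (+∈ (from p) (from q))) , (λ p → to (-∈ (from p)))
        where
        open Subgroups.IsSub (Full.sub (fullAt fs i))
        to : ∀ {x} → T (lookup Ks i x) → x ∈ H Ks i
        to {x} p = member⇒∈ (subst T (sym (member-H Ks i x)) p)
        from : ∀ {x} → x ∈ H Ks i → T (lookup Ks i x)
        from {x} p = subst T (member-H Ks i x) (∈⇒member p)

      isDense : ∀ Ks → All Full Ks → ∀ i → ((1ℚ - ε) *ℚ (ℤ.+ ∣ H Ks i ∣ /ℚ 1)) <ℚ (ℤ.+ ∣ A ∩ˢ H Ks i ∣ /ℚ 1)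
      isDense Ks fs i = density-bound ε 0<ε (∣ H Ks i ∣) (card (K ∖ members A)) (∣ A ∩ˢ H Ks i ∣)
          (≤-trans (≤-trans (s≤s z≤n) (Full.nontrivial f)) (≤-reflexive (sym size)))
          (≤-trans (≤-trans (*-monoˡ-≤ (card (K ∖ members A)) q≤r) (Full.full f)) (≤-reflexive (sym size)))
          (≤-trans (≤-reflexive size) (≤-trans (card-split K (members A)) (+-monoˡ-≤ (card (K ∖ members A)) common)))
        where
        K : PSet n
        K = lookup Ks i
        f : Full K
        f = fullAt fs i
        size : ∣ H Ks i ∣ ≡ card K
        size = trans (∣∣≡card (H Ks i)) (card-ext (member-H Ks i))
        q≤r : suc (denominator ε) ≤ r
        q≤r = ≤-trans (m≤n+m _ t) (m≤m+n _ 3)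
        common : card (K ∩ members A) ≤ ∣ A ∩ˢ H Ks i ∣
        common = ≤-trans (card-mono (λ x p → subst T (sym (trans (lookup-zipWith _∧_ x A (H Ks i)) (cong (members A x ∧_) (member-H Ks i x)))) (∧-intro {members A x} (∧-snd {K x} p) (∧-fst {K x} p))))
                   (≤-reflexive (sym (∣∣≡card (A ∩ˢ H Ks i))))

      remainder⊆ : ∀ Ks x → T (members (remainder A (H Ks)) x) → T (residue Ks x)
      remainder⊆ Ks x p = let a , out = ─-out A _ x p in ∧-intro {members A x} a (not-intro (λ q → out (subst T (sym (members-⋃ Ks x)) q)))

      answer : ∀ C₀ → C ≤ C₀ → Σ ℕ λ m → m < k × Σ (Fin m → Subset n) λ H →
                 (∀ i → IsSubgroup G (H i)) × (∀ i → ((1ℚ - ε) *ℚ (ℤ.+ ∣ H i ∣ /ℚ 1)) <ℚ (ℤ.+ ∣ A ∩ˢ H i ∣ /ℚ 1))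
                 × ∣ remainder A H ∣ ≤ C₀ × (m + 1 ≡ k → Empty (remainder A H))
      answer C₀ C≤ = let F , small , none = structure in
        length (Hs F) , few F , H (Hs F) , isSubgroup (Hs F) (fulls F) , isDense (Hs F) (fulls F) ,
        ≤-trans (≤-reflexive (∣∣≡card (remainder A (H (Hs F))))) (≤-trans (card-mono (remainder⊆ (Hs F))) (≤-trans small C≤)) ,
        λ eq (x , x∈) → none eq x (remainder⊆ (Hs F) x (∈⇒member x∈))

open import Data.Nat using (ℕ; _≤_; _<_; _+_)
open import Data.Nat.Divisibility using (_∣_)
open import Data.Nat.Primality using (Prime)
open import Data.Integer using (+_)
open import Data.Rational using (ℚ; _/_; 0ℚ; 1ℚ; _-_; _*_) renaming (_<_ to _<ℚ_)
open import Data.Fin using (Fin)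
open import Data.Fin.Subset using (Subset; _∩_; ∣_∣; Empty)
open import Data.Product using (Σ; ∃; _×_)
open import Relation.Nullary using (¬_)
open import Relation.Binary.PropositionalEquality using (_≡_)
open import Data.Nat using (suc; s≤s)
open import Data.Nat.Properties using (≤-trans; m≤m+n; m≤n+m)
open import Data.Product using (_,_)
open Proof using (module Main; module Translate; module Order)

theorem4p5 : (k : ℕ) (ε : ℚ) → 0ℚ <ℚ ε →
    ∃ λ (Cstar : ℕ) → ∀ (C₀ : ℕ) → Cstar ≤ C₀ →
    ∀ (n : ℕ) (G : FinAbGroup n) →
    (∀ (p : ℕ) → Prime p → p < C₀ → ¬ (p ∣ n)) →
    ∀ (A : Subset n) → PhiLessThan G A k → C₀ ≤ ∣ A ∣ →
    Σ ℕ λ m → m < k × Σ (Fin m → Subset n) λ H →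
    (∀ i → IsSubgroup G (H i))
    × (∀ i → ((1ℚ - ε) * ((+ ∣ H i ∣) / 1)) <ℚ ((+ ∣ A ∩ H i ∣) / 1))
    × ∣ remainder A H ∣ ≤ C₀
    × (m + 1 ≡ k → Empty (remainder A H))
-- `suc` gives M < C₀, so that excluding the primes below C₀ makes 1, ..., M invertible; the summand
-- `C` bounds the remainder.
theorem4p5 k ε 0<ε = suc (Main.M k ε 0<ε + Main.C k ε 0<ε) , λ C₀ C≤ n G noSmall A phi _ →
  Main.Answer.answer k ε 0<ε G A (Translate.bounded G A k phi) (Order.torsionFree G noSmall (≤-trans (s≤s (m≤m+n _ _)) C≤))
    C₀ (≤-trans (m≤n+m _ (suc (Main.M k ε 0<ε))) C≤)
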